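{- For every $\epsilon > 0$ there exists $c > 0$ such that for every finite convex set $A \subset \mathbb{R}$, \[ |A+A| \geq c\,|A|^{\frac{46}{29} - \epsilon}. \]
   Context: A finite set $A = \{a_1 < a_2 < \dots < a_n\} \subset \mathbb{R}$ is called convex if the sequence of consecutive gaps $(a_{j+1}-a_j)_{j=1}^{n-1}$ is strictly increasing. $A+A = \{a_1+a_2 : a_1,a_2\in A\}$. -}

module Defs where

open import Data.Empty using (⊥-elim)
open import Data.Fin.Base as Fin using (Fin; inject₁)
open import Data.Integer.Base as ℤ using (ℤ; +_; -[1+_])
import Data.Integer.Properties as ℤₚ
import Data.Integer.Tactic.RingSolver as ℤ-Ring
open import Data.Nat.Base as ℕ using (ℕ; zero; suc; pred)
import Data.Nat.Properties as ℕₚ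
import Data.Nat.Tactic.RingSolver as ℕ-Ring
open import Data.Product.Base using (Σ; ∃-syntax; _×_; _,_)
open import Data.Rational.Base as ℚ using (ℚ; 0ℚ; 1ℚ; ½; ∣_∣; ↥_; ↧ₙ_; toℚᵘ; fromℚᵘ)
import Data.Rational.Properties as ℚₚ
import Data.Rational.Unnormalised.Base as ℚᵘ
import Data.Rational.Unnormalised.Properties as ℚᵘₚ
open import Data.Rational.Solver using (module +-*-Solver)
open import Data.Sum.Base using (inj₁; inj₂)
open import Function.Bundles using (_⇔_)
open import Level using (0ℓ)
open import Relation.Binary.PropositionalEquality using (_≡_; refl; sym; trans; cong; cong₂; subst₂)
open import Relation.Nullary using (¬_; yes; no)
open import Relation.Unary using (Pred; Decidable; _∈_)

private
  halves : ∀ ε → ½ ℚ.* ε ℚ.+ ½ ℚ.* ε ≡ ε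
  halves ε = trans (sym (ℚₚ.*-distribʳ-+ ε ½ ½)) (ℚₚ.*-identityˡ ε)

  *-pos : ∀ {p q} → 0ℚ ℚ.< p → 0ℚ ℚ.< q → 0ℚ ℚ.< p ℚ.* q
  *-pos {p} {q} 0<p 0<q =
    ℚₚ.positive⁻¹ (p ℚ.* q) {{ℚₚ.pos*pos⇒pos p {{ℚ.positive 0<p}} q {{ℚ.positive 0<q}}}}

  half-pos : ∀ {ε} → 0ℚ ℚ.< ε → 0ℚ ℚ.< ½ ℚ.* ε
  half-pos = *-pos (ℚₚ.positive⁻¹ ½)

  0≤∣_∣ : ∀ p → 0ℚ ℚ.≤ ∣ p ∣
  0≤∣ p ∣ = ℚₚ.nonNegative⁻¹ ∣ p ∣ {{ℚₚ.∣-∣-nonNeg p}}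

  p≤∣p∣ : ∀ p → p ℚ.≤ ∣ p ∣
  p≤∣p∣ p with ℚₚ.≤-total 0ℚ p
  ... | inj₁ 0≤p = ℚₚ.≤-reflexive (sym (ℚₚ.0≤p⇒∣p∣≡p 0≤p))
  ... | inj₂ p≤0 = ℚₚ.≤-trans p≤0 0≤∣ p ∣

  ∣-∣-bound : ∀ {p q e} → p ℚ.≤ q ℚ.+ e → q ℚ.≤ p ℚ.+ e → ∣ p ℚ.- q ∣ ℚ.≤ e
  ∣-∣-bound {p} {q} {e} p≤ q≤ with ℚₚ.∣p∣≡p∨∣p∣≡-p (p ℚ.- q)
  ... | inj₁ eq = ℚₚ.≤-trans (ℚₚ.≤-reflexive eq)
        (ℚₚ.≤-trans (ℚₚ.+-monoˡ-≤ (ℚ.- q) p≤) (ℚₚ.≤-reflexive (lem q e)))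
    where
    open +-*-Solver
    lem : ∀ q e → q ℚ.+ e ℚ.- q ≡ e
    lem = solve 2 (λ q e → q :+ e :- q := e) refl
  ... | inj₂ eq = ℚₚ.≤-trans (ℚₚ.≤-reflexive (trans eq (lem₁ p q)))
        (ℚₚ.≤-trans (ℚₚ.+-monoˡ-≤ (ℚ.- p) q≤) (ℚₚ.≤-reflexive (lem₂ p e)))
    where
    open +-*-Solver
    lem₁ : ∀ p q → ℚ.- (p ℚ.- q) ≡ q ℚ.- p
    lem₁ = solve 2 (λ p q → :- (p :- q) := q :- p) refl
    lem₂ : ∀ q e → q ℚ.+ e ℚ.- q ≡ e
    lem₂ = solve 2 (λ q e → q :+ e :- q := e) refl

  *-mono-≤-nonNeg : ∀ {p q r s} → 0ℚ ℚ.≤ r → 0ℚ ℚ.≤ q →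
                    p ℚ.≤ q → r ℚ.≤ s → p ℚ.* r ℚ.≤ q ℚ.* s
  *-mono-≤-nonNeg {p} {q} {r} {s} 0≤r 0≤q p≤q r≤s = ℚₚ.≤-trans
    (ℚₚ.*-monoʳ-≤-nonNeg r {{ℚ.nonNegative 0≤r}} p≤q)
    (ℚₚ.*-monoˡ-≤-nonNeg q {{ℚ.nonNegative 0≤q}} r≤s)

  scale : ∀ {B} → 0ℚ ℚ.< B → ∀ {ε} → 0ℚ ℚ.< ε → ∃[ δ ] 0ℚ ℚ.< δ × B ℚ.* δ ≡ ε
  scale {B} 0<B {ε} 0<ε = ℚ.1/ B ℚ.* ε
    , *-pos (ℚₚ.positive⁻¹ (ℚ.1/ B) {{ℚₚ.1/pos⇒pos B}}) 0<ε
    , trans (sym (ℚₚ.*-assoc B (ℚ.1/ B) ε))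
        (trans (cong (ℚ._* ε) (ℚₚ.*-inverseʳ B)) (ℚₚ.*-identityˡ ε))
    where instance
      B-pos : ℚ.Positive B
      B-pos = ℚ.positive 0<B
      B≢0 : ℚ.NonZero B
      B≢0 = ℚₚ.pos⇒nonZero B

-- Reals are Cauchy sequences of rationals taken up to _≈_; no quotient is formed.
record ℝ : Set where
  field
    seq    : ℕ → ℚ
    cauchy : ∀ ε → 0ℚ ℚ.< ε →
             ∃[ N ] (∀ m n → N ℕ.≤ m → N ℕ.≤ n → ∣ seq m ℚ.- seq n ∣ ℚ.≤ ε)

open ℝ public

infix 4 _≈_ _<_ _≤_

_≈_ : ℝ → ℝ → Set
x ≈ y = ∀ ε → 0ℚ ℚ.< ε → ∃[ N ] (∀ n → N ℕ.≤ n → ∣ seq x n ℚ.- seq y n ∣ ℚ.≤ ε)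

_<_ : ℝ → ℝ → Set
x < y = ∃[ δ ] 0ℚ ℚ.< δ × (∃[ N ] (∀ n → N ℕ.≤ n → seq x n ℚ.+ δ ℚ.≤ seq y n))

_≤_ : ℝ → ℝ → Set
x ≤ y = ¬ (y < x)

fromℚ : ℚ → ℝ
fromℚ q .seq _ = q
fromℚ q .cauchy ε 0<ε = 0 , λ _ _ _ _ →
  ℚₚ.≤-trans (ℚₚ.≤-reflexive (cong ∣_∣ (ℚₚ.+-inverseʳ q))) (ℚₚ.<⇒≤ 0<ε)

fromℕ : ℕ → ℝ
fromℕ n = fromℚ (+ n ℚ./ 1)

0ℝ : ℝ
0ℝ = fromℚ 0ℚ

infixl 6 _+_ _-_
infixl 7 _*_
infix  8 -_

_+_ : ℝ → ℝ → ℝ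
(x + y) .seq n = seq x n ℚ.+ seq y n
(x + y) .cauchy ε 0<ε
  with cauchy x (½ ℚ.* ε) (half-pos 0<ε) | cauchy y (½ ℚ.* ε) (half-pos 0<ε)
... | N₁ , close₁ | N₂ , close₂ = N₁ ℕ.⊔ N₂ , λ m n N≤m N≤n →
  let open ℚₚ.≤-Reasoning in begin
    ∣ (seq x m ℚ.+ seq y m) ℚ.- (seq x n ℚ.+ seq y n) ∣
      ≡⟨ cong ∣_∣ (rearrange (seq x m) (seq y m) (seq x n) (seq y n)) ⟩
    ∣ (seq x m ℚ.- seq x n) ℚ.+ (seq y m ℚ.- seq y n) ∣
      ≤⟨ ℚₚ.∣p+q∣≤∣p∣+∣q∣ (seq x m ℚ.- seq x n) (seq y m ℚ.- seq y n) ⟩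
    ∣ seq x m ℚ.- seq x n ∣ ℚ.+ ∣ seq y m ℚ.- seq y n ∣
      ≤⟨ ℚₚ.+-mono-≤
           (close₁ m n (ℕₚ.m⊔n≤o⇒m≤o N₁ N₂ N≤m) (ℕₚ.m⊔n≤o⇒m≤o N₁ N₂ N≤n))
           (close₂ m n (ℕₚ.m⊔n≤o⇒n≤o N₁ N₂ N≤m) (ℕₚ.m⊔n≤o⇒n≤o N₁ N₂ N≤n)) ⟩
    ½ ℚ.* ε ℚ.+ ½ ℚ.* ε
      ≡⟨ halves ε ⟩
    ε ∎
  where
  open +-*-Solver
  rearrange : ∀ a b c d → (a ℚ.+ b) ℚ.- (c ℚ.+ d) ≡ (a ℚ.- c) ℚ.+ (b ℚ.- d)
  rearrange = solve 4 (λ a b c d → (a :+ b) :- (c :+ d) := (a :- c) :+ (b :- d)) refl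

-_ : ℝ → ℝ
(- x) .seq n = ℚ.- seq x n
(- x) .cauchy ε 0<ε with cauchy x ε 0<ε
... | N , close = N , λ m n N≤m N≤n → ℚₚ.≤-trans
  (ℚₚ.≤-reflexive (trans (cong ∣_∣ (rearrange (seq x m) (seq x n)))
                         (ℚₚ.∣-p∣≡∣p∣ (seq x m ℚ.- seq x n))))
  (close m n N≤m N≤n)
  where
  open +-*-Solver
  rearrange : ∀ a b → (ℚ.- a) ℚ.- (ℚ.- b) ≡ ℚ.- (a ℚ.- b)
  rearrange = solve 2 (λ a b → (:- a) :- (:- b) := :- (a :- b)) refl

_-_ : ℝ → ℝ → ℝ
x - y = x + (- y)

private
  bounded : (x : ℝ) → ∃[ B ] 0ℚ ℚ.< B × (∃[ N ] (∀ n → N ℕ.≤ n → ∣ seq x n ∣ ℚ.≤ B))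
  bounded x with cauchy x 1ℚ (ℚₚ.positive⁻¹ 1ℚ)
  ... | N , close = 1ℚ ℚ.+ ∣ seq x N ∣
      , ℚₚ.+-mono-<-≤ (ℚₚ.positive⁻¹ 1ℚ) 0≤∣ seq x N ∣
      , N , λ n N≤n → let open ℚₚ.≤-Reasoning in begin
          ∣ seq x n ∣
            ≡⟨ cong ∣_∣ (rearrange (seq x n) (seq x N)) ⟩
          ∣ (seq x n ℚ.- seq x N) ℚ.+ seq x N ∣
            ≤⟨ ℚₚ.∣p+q∣≤∣p∣+∣q∣ (seq x n ℚ.- seq x N) (seq x N) ⟩
          ∣ seq x n ℚ.- seq x N ∣ ℚ.+ ∣ seq x N ∣
            ≤⟨ ℚₚ.+-monoˡ-≤ ∣ seq x N ∣ (close n N N≤n ℕₚ.≤-refl) ⟩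
          1ℚ ℚ.+ ∣ seq x N ∣ ∎
    where
    open +-*-Solver
    rearrange : ∀ a b → a ≡ (a ℚ.- b) ℚ.+ b
    rearrange = solve 2 (λ a b → a := (a :- b) :+ b) refl

  product-close : ∀ {B C δ η ε} a b c d → 0ℚ ℚ.≤ B → 0ℚ ℚ.≤ C →
                  B ℚ.* δ ≡ ½ ℚ.* ε → C ℚ.* η ≡ ½ ℚ.* ε →
                  ∣ a ∣ ℚ.≤ B → ∣ d ∣ ℚ.≤ C → ∣ b ℚ.- d ∣ ℚ.≤ δ → ∣ a ℚ.- c ∣ ℚ.≤ η →
                  ∣ a ℚ.* b ℚ.- c ℚ.* d ∣ ℚ.≤ ε
  product-close {B} {C} {δ} {η} {ε} a b c d 0≤B 0≤C Bδ Cη a≤B d≤C b~d a~c = begin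
    ∣ a ℚ.* b ℚ.- c ℚ.* d ∣
      ≡⟨ cong ∣_∣ (rearrange a b c d) ⟩
    ∣ a ℚ.* (b ℚ.- d) ℚ.+ d ℚ.* (a ℚ.- c) ∣
      ≤⟨ ℚₚ.∣p+q∣≤∣p∣+∣q∣ (a ℚ.* (b ℚ.- d)) (d ℚ.* (a ℚ.- c)) ⟩
    ∣ a ℚ.* (b ℚ.- d) ∣ ℚ.+ ∣ d ℚ.* (a ℚ.- c) ∣
      ≡⟨ cong₂ ℚ._+_ (ℚₚ.∣p*q∣≡∣p∣*∣q∣ a (b ℚ.- d)) (ℚₚ.∣p*q∣≡∣p∣*∣q∣ d (a ℚ.- c)) ⟩
    ∣ a ∣ ℚ.* ∣ b ℚ.- d ∣ ℚ.+ ∣ d ∣ ℚ.* ∣ a ℚ.- c ∣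
      ≤⟨ ℚₚ.+-mono-≤ (*-mono-≤-nonNeg 0≤∣ b ℚ.- d ∣ 0≤B a≤B b~d)
                     (*-mono-≤-nonNeg 0≤∣ a ℚ.- c ∣ 0≤C d≤C a~c) ⟩
    B ℚ.* δ ℚ.+ C ℚ.* η
      ≡⟨ cong₂ ℚ._+_ Bδ Cη ⟩
    ½ ℚ.* ε ℚ.+ ½ ℚ.* ε
      ≡⟨ halves ε ⟩
    ε ∎
    where
    open ℚₚ.≤-Reasoning
    open +-*-Solver using (solve; _:=_; _:+_; _:-_; _:*_)
    rearrange : ∀ a b c d → a ℚ.* b ℚ.- c ℚ.* d ≡ a ℚ.* (b ℚ.- d) ℚ.+ d ℚ.* (a ℚ.- c)
    rearrange = solve 4 (λ a b c d → a :* b :- c :* d := a :* (b :- d) :+ d :* (a :- c)) refl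

_*_ : ℝ → ℝ → ℝ
(x * y) .seq n = seq x n ℚ.* seq y n
(x * y) .cauchy ε 0<ε =
  let B , 0<B , N₁ , bd₁ = bounded x
      C , 0<C , N₂ , bd₂ = bounded y
      δ , 0<δ , Bδ       = scale 0<B (half-pos 0<ε)
      η , 0<η , Cη       = scale 0<C (half-pos 0<ε)
      N₃ , close₃        = cauchy y δ 0<δ
      N₄ , close₄        = cauchy x η 0<η
      split : ∀ {k} → (N₁ ℕ.⊔ N₂) ℕ.⊔ (N₃ ℕ.⊔ N₄) ℕ.≤ k →
              (N₁ ℕ.≤ k × N₂ ℕ.≤ k) × (N₃ ℕ.≤ k × N₄ ℕ.≤ k)
      split N≤k =
        let N₁₂≤k = ℕₚ.m⊔n≤o⇒m≤o (N₁ ℕ.⊔ N₂) (N₃ ℕ.⊔ N₄) N≤k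
            N₃₄≤k = ℕₚ.m⊔n≤o⇒n≤o (N₁ ℕ.⊔ N₂) (N₃ ℕ.⊔ N₄) N≤k
        in (ℕₚ.m⊔n≤o⇒m≤o N₁ N₂ N₁₂≤k , ℕₚ.m⊔n≤o⇒n≤o N₁ N₂ N₁₂≤k)
         , (ℕₚ.m⊔n≤o⇒m≤o N₃ N₄ N₃₄≤k , ℕₚ.m⊔n≤o⇒n≤o N₃ N₄ N₃₄≤k)
  in (N₁ ℕ.⊔ N₂) ℕ.⊔ (N₃ ℕ.⊔ N₄) , λ m n N≤m N≤n →
     let (N₁≤m , _) , (N₃≤m , N₄≤m) = split N≤m
         (_ , N₂≤n) , (N₃≤n , N₄≤n) = split N≤n
     in product-close (seq x m) (seq y m) (seq x n) (seq y n)
          (ℚₚ.<⇒≤ 0<B) (ℚₚ.<⇒≤ 0<C) Bδ Cη (bd₁ m N₁≤m) (bd₂ n N₂≤n)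
          (close₃ m n N₃≤m N₃≤n) (close₄ m n N₄≤m N₄≤n)

posPart negPart : ℤ → ℕ
posPart (+ n)    = n
posPart -[1+ n ] = 0
negPart (+ n)    = 0
negPart -[1+ n ] = suc n

greatest : {P : Pred ℕ 0ℓ} → Decidable P → ℕ → ℕ
greatest P? zero = zero
greatest P? (suc b) with P? (suc b)
... | yes _ = suc b
... | no  _ = greatest P? b

-- For r = p/q in lowest terms this is (j/K)^q ≤ n^p, i.e. j/K ≤ n^r, with
-- denominators (and a possible negative power of n) cleared.
Below : ℕ → ℚ → ℕ → Pred ℕ 0ℓ
Below n r K j = j ℕ.^ ↧ₙ r ℕ.* n ℕ.^ negPart (↥ r) ℕ.≤ n ℕ.^ posPart (↥ r) ℕ.* K ℕ.^ ↧ₙ r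

below? : ∀ n r K → Decidable (Below n r K)
below? n r K j = _ ℕₚ.≤? _

-- ⌊K · n^r⌋ for n ≥ 1; the search bound is at least K · n^r.
⌊_·_^_⌋ : ℕ → ℕ → ℚ → ℕ
⌊ K · n ^ r ⌋ = greatest (below? n r K) (n ℕ.^ posPart (↥ r) ℕ.* K)

private
  ^-distrib-* : ∀ a b n → (a ℕ.* b) ℕ.^ n ≡ a ℕ.^ n ℕ.* b ℕ.^ n
  ^-distrib-* a b zero    = refl
  ^-distrib-* a b (suc n) = trans (cong (a ℕ.* b ℕ.*_) (^-distrib-* a b n))
                                  (interchange a b (a ℕ.^ n) (b ℕ.^ n))
    where
    interchange : ∀ a b c d → a ℕ.* b ℕ.* (c ℕ.* d) ≡ a ℕ.* c ℕ.* (b ℕ.* d)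
    interchange = ℕ-Ring.solve-∀

  ^-cancelˡ-≤ : ∀ a b n .{{_ : ℕ.NonZero n}} → a ℕ.^ n ℕ.≤ b ℕ.^ n → a ℕ.≤ b
  ^-cancelˡ-≤ a b n a^n≤b^n =
    ℕₚ.≮⇒≥ λ b<a → ℕₚ.<⇒≱ (ℕₚ.^-monoˡ-< n b<a) a^n≤b^n

  bernoulli : ∀ M n t → M ℕ.^ t ℕ.* (M ℕ.+ t ℕ.* n) ℕ.≤ M ℕ.* (M ℕ.+ n) ℕ.^ t
  bernoulli M n zero    = ℕₚ.≤-reflexive (base M)
    where
    base : ∀ M → 1 ℕ.* (M ℕ.+ 0) ≡ M ℕ.* 1
    base = ℕ-Ring.solve-∀
  bernoulli M n (suc t) = begin
    M ℕ.* M ℕ.^ t ℕ.* (M ℕ.+ suc t ℕ.* n)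
      ≤⟨ ℕₚ.m≤m+n _ (M ℕ.^ t ℕ.* (t ℕ.* n ℕ.* n)) ⟩
    M ℕ.* M ℕ.^ t ℕ.* (M ℕ.+ suc t ℕ.* n) ℕ.+ M ℕ.^ t ℕ.* (t ℕ.* n ℕ.* n)
      ≡⟨ step₁ M n t (M ℕ.^ t) ⟩
    (M ℕ.+ n) ℕ.* (M ℕ.^ t ℕ.* (M ℕ.+ t ℕ.* n))
      ≤⟨ ℕₚ.*-monoʳ-≤ (M ℕ.+ n) (bernoulli M n t) ⟩
    (M ℕ.+ n) ℕ.* (M ℕ.* (M ℕ.+ n) ℕ.^ t)
      ≡⟨ step₂ M n ((M ℕ.+ n) ℕ.^ t) ⟩
    M ℕ.* ((M ℕ.+ n) ℕ.* (M ℕ.+ n) ℕ.^ t) ∎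
    where
    open ℕₚ.≤-Reasoning
    step₁ : ∀ M n t P → M ℕ.* P ℕ.* (M ℕ.+ (n ℕ.+ t ℕ.* n)) ℕ.+ P ℕ.* (t ℕ.* n ℕ.* n)
                      ≡ (M ℕ.+ n) ℕ.* (P ℕ.* (M ℕ.+ t ℕ.* n))
    step₁ = ℕ-Ring.solve-∀
    step₂ : ∀ M n P → (M ℕ.+ n) ℕ.* (M ℕ.* P) ≡ M ℕ.* ((M ℕ.+ n) ℕ.* P)
    step₂ = ℕ-Ring.solve-∀

  root-bound : ∀ M n .{{_ : ℕ.NonZero M}} → M ℕ.^ M ℕ.* n ℕ.≤ (M ℕ.+ n) ℕ.^ M
  root-bound M n = ℕₚ.*-cancelˡ-≤ M (begin
    M ℕ.* (M ℕ.^ M ℕ.* n)              ≡⟨ swap M n (M ℕ.^ M) ⟩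
    M ℕ.^ M ℕ.* (M ℕ.* n)              ≤⟨ ℕₚ.*-monoʳ-≤ (M ℕ.^ M) (ℕₚ.m≤n+m (M ℕ.* n) M) ⟩
    M ℕ.^ M ℕ.* (M ℕ.+ M ℕ.* n)        ≤⟨ bernoulli M n M ⟩
    M ℕ.* (M ℕ.+ n) ℕ.^ M              ∎)
    where
    open ℕₚ.≤-Reasoning
    swap : ∀ M n P → M ℕ.* (P ℕ.* n) ≡ P ℕ.* (M ℕ.* n)
    swap = ℕ-Ring.solve-∀

  -- If a/K ≤ n^((p-s)/q), n^((p′-s′)/q′) ≤ b/K′ and (p-s)/q ≤ (p′-s′)/q′ + 1/M,
  -- then a/K ≤ (b/K′) n^(1/M) ≤ (b/K′) (1 + n/M).
  ratio-bound : ∀ n .{{_ : ℕ.NonZero n}} M .{{_ : ℕ.NonZero M}}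
                a K p s q .{{_ : ℕ.NonZero q}} b K′ p′ s′ q′ .{{_ : ℕ.NonZero q′}} →
                a ℕ.^ q ℕ.* n ℕ.^ s ℕ.≤ n ℕ.^ p ℕ.* K ℕ.^ q →
                n ℕ.^ p′ ℕ.* K′ ℕ.^ q′ ℕ.≤ b ℕ.^ q′ ℕ.* n ℕ.^ s′ →
                (p ℕ.* q′ ℕ.+ s′ ℕ.* q) ℕ.* M ℕ.≤ q ℕ.* q′ ℕ.+ (p′ ℕ.* q ℕ.+ s ℕ.* q′) ℕ.* M →
                a ℕ.* K′ ℕ.* M ℕ.≤ b ℕ.* K ℕ.* (M ℕ.+ n)
  ratio-bound n M a K p s q b K′ p′ s′ q′ lower upper near =
    ^-cancelˡ-≤ _ _ M (begin
      (a ℕ.* K′ ℕ.* M) ℕ.^ M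
        ≡⟨ ^-distrib-* (a ℕ.* K′) M M ⟩
      (a ℕ.* K′) ℕ.^ M ℕ.* M ℕ.^ M
        ≤⟨ ℕₚ.*-monoˡ-≤ (M ℕ.^ M) (^-cancelˡ-≤ _ _ Q {{ℕₚ.m*n≢0 q q′}} rooted) ⟩
      (b ℕ.* K) ℕ.^ M ℕ.* n ℕ.* M ℕ.^ M
        ≡⟨ shuffle ((b ℕ.* K) ℕ.^ M) n (M ℕ.^ M) ⟩
      (b ℕ.* K) ℕ.^ M ℕ.* (M ℕ.^ M ℕ.* n)
        ≤⟨ ℕₚ.*-monoʳ-≤ ((b ℕ.* K) ℕ.^ M) (root-bound M n) ⟩
      (b ℕ.* K) ℕ.^ M ℕ.* (M ℕ.+ n) ℕ.^ M
        ≡⟨ sym (^-distrib-* (b ℕ.* K) (M ℕ.+ n) M) ⟩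
      (b ℕ.* K ℕ.* (M ℕ.+ n)) ℕ.^ M ∎)
    where
    open ℕₚ.≤-Reasoning
    Q = q ℕ.* q′
    E = (p′ ℕ.* q ℕ.+ s ℕ.* q′) ℕ.* M
    shuffle : ∀ x y z → x ℕ.* y ℕ.* z ≡ x ℕ.* (z ℕ.* y)
    shuffle = ℕ-Ring.solve-∀

    e₁ : ∀ q q′ M → q ℕ.* (q′ ℕ.* M) ≡ M ℕ.* (q ℕ.* q′)
    e₁ = ℕ-Ring.solve-∀
    e₂ : ∀ q q′ M → q′ ℕ.* (q ℕ.* M) ≡ M ℕ.* (q ℕ.* q′)
    e₂ = ℕ-Ring.solve-∀

    raise : ∀ {u v x} i j k t → k ℕ.* t ≡ x →
            u ℕ.^ k ℕ.* n ℕ.^ i ℕ.≤ n ℕ.^ j ℕ.* v ℕ.^ k →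
            u ℕ.^ x ℕ.* n ℕ.^ (i ℕ.* t) ℕ.≤ n ℕ.^ (j ℕ.* t) ℕ.* v ℕ.^ x
    raise {u} {v} i j k t refl h = begin
      u ℕ.^ (k ℕ.* t) ℕ.* n ℕ.^ (i ℕ.* t)
        ≡⟨ cong₂ ℕ._*_ (sym (ℕₚ.^-*-assoc u k t)) (sym (ℕₚ.^-*-assoc n i t)) ⟩
      (u ℕ.^ k) ℕ.^ t ℕ.* (n ℕ.^ i) ℕ.^ t
        ≡⟨ sym (^-distrib-* (u ℕ.^ k) (n ℕ.^ i) t) ⟩
      (u ℕ.^ k ℕ.* n ℕ.^ i) ℕ.^ t
        ≤⟨ ℕₚ.^-monoˡ-≤ t h ⟩
      (n ℕ.^ j ℕ.* v ℕ.^ k) ℕ.^ t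
        ≡⟨ ^-distrib-* (n ℕ.^ j) (v ℕ.^ k) t ⟩
      (n ℕ.^ j) ℕ.^ t ℕ.* (v ℕ.^ k) ℕ.^ t
        ≡⟨ cong₂ ℕ._*_ (ℕₚ.^-*-assoc n j t) (ℕₚ.^-*-assoc v k t) ⟩
      n ℕ.^ (j ℕ.* t) ℕ.* v ℕ.^ (k ℕ.* t) ∎

    lower′ : a ℕ.^ (M ℕ.* Q) ℕ.* n ℕ.^ (s ℕ.* (q′ ℕ.* M))
           ℕ.≤ n ℕ.^ (p ℕ.* (q′ ℕ.* M)) ℕ.* K ℕ.^ (M ℕ.* Q)
    lower′ = raise s p q (q′ ℕ.* M) (e₁ q q′ M) lower

    upper′ : K′ ℕ.^ (M ℕ.* Q) ℕ.* n ℕ.^ (p′ ℕ.* (q ℕ.* M))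
           ℕ.≤ n ℕ.^ (s′ ℕ.* (q ℕ.* M)) ℕ.* b ℕ.^ (M ℕ.* Q)
    upper′ = raise p′ s′ q′ (q ℕ.* M) (e₂ q q′ M)
      (subst₂ ℕ._≤_ (ℕₚ.*-comm (n ℕ.^ p′) (K′ ℕ.^ q′)) (ℕₚ.*-comm (b ℕ.^ q′) (n ℕ.^ s′)) upper)

    interchange : ∀ a b c d → a ℕ.* b ℕ.* (c ℕ.* d) ≡ a ℕ.* c ℕ.* (b ℕ.* d)
    interchange = ℕ-Ring.solve-∀
    reorder : ∀ x y z w → (x ℕ.* y) ℕ.* (z ℕ.* w) ≡ (w ℕ.* y) ℕ.* (x ℕ.* z)
    reorder = ℕ-Ring.solve-∀
    exp₁ : ∀ p′ s q q′ M → (p′ ℕ.* q ℕ.+ s ℕ.* q′) ℕ.* M ≡ s ℕ.* (q′ ℕ.* M) ℕ.+ p′ ℕ.* (q ℕ.* M)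
    exp₁ = ℕ-Ring.solve-∀
    exp₂ : ∀ p s′ q q′ M → p ℕ.* (q′ ℕ.* M) ℕ.+ s′ ℕ.* (q ℕ.* M) ≡ (p ℕ.* q′ ℕ.+ s′ ℕ.* q) ℕ.* M
    exp₂ = ℕ-Ring.solve-∀

    rooted : ((a ℕ.* K′) ℕ.^ M) ℕ.^ Q ℕ.≤ ((b ℕ.* K) ℕ.^ M ℕ.* n) ℕ.^ Q
    rooted = ℕₚ.*-cancelʳ-≤ _ _ (n ℕ.^ E) {{ℕₚ.m^n≢0 n E}} (begin
      ((a ℕ.* K′) ℕ.^ M) ℕ.^ Q ℕ.* n ℕ.^ E
        ≡⟨ cong₂ ℕ._*_
             (trans (ℕₚ.^-*-assoc (a ℕ.* K′) M Q) (^-distrib-* a K′ (M ℕ.* Q)))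
             (trans (cong (n ℕ.^_) (exp₁ p′ s q q′ M))
                    (ℕₚ.^-distribˡ-+-* n (s ℕ.* (q′ ℕ.* M)) (p′ ℕ.* (q ℕ.* M)))) ⟩
      (a ℕ.^ (M ℕ.* Q) ℕ.* K′ ℕ.^ (M ℕ.* Q)) ℕ.* (n ℕ.^ (s ℕ.* (q′ ℕ.* M)) ℕ.* n ℕ.^ (p′ ℕ.* (q ℕ.* M)))
        ≡⟨ interchange (a ℕ.^ (M ℕ.* Q)) (K′ ℕ.^ (M ℕ.* Q)) _ _ ⟩
      (a ℕ.^ (M ℕ.* Q) ℕ.* n ℕ.^ (s ℕ.* (q′ ℕ.* M))) ℕ.* (K′ ℕ.^ (M ℕ.* Q) ℕ.* n ℕ.^ (p′ ℕ.* (q ℕ.* M)))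
        ≤⟨ ℕₚ.*-mono-≤ lower′ upper′ ⟩
      (n ℕ.^ (p ℕ.* (q′ ℕ.* M)) ℕ.* K ℕ.^ (M ℕ.* Q)) ℕ.* (n ℕ.^ (s′ ℕ.* (q ℕ.* M)) ℕ.* b ℕ.^ (M ℕ.* Q))
        ≡⟨ reorder (n ℕ.^ (p ℕ.* (q′ ℕ.* M))) (K ℕ.^ (M ℕ.* Q)) (n ℕ.^ (s′ ℕ.* (q ℕ.* M))) (b ℕ.^ (M ℕ.* Q)) ⟩
      (b ℕ.^ (M ℕ.* Q) ℕ.* K ℕ.^ (M ℕ.* Q)) ℕ.* (n ℕ.^ (p ℕ.* (q′ ℕ.* M)) ℕ.* n ℕ.^ (s′ ℕ.* (q ℕ.* M)))
        ≡⟨ cong₂ ℕ._*_ (sym (^-distrib-* b K (M ℕ.* Q)))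
             (trans (sym (ℕₚ.^-distribˡ-+-* n (p ℕ.* (q′ ℕ.* M)) (s′ ℕ.* (q ℕ.* M))))
                    (cong (n ℕ.^_) (exp₂ p s′ q q′ M))) ⟩
      (b ℕ.* K) ℕ.^ (M ℕ.* Q) ℕ.* n ℕ.^ ((p ℕ.* q′ ℕ.+ s′ ℕ.* q) ℕ.* M)
        ≤⟨ ℕₚ.*-monoʳ-≤ ((b ℕ.* K) ℕ.^ (M ℕ.* Q)) (ℕₚ.^-monoʳ-≤ n near) ⟩
      (b ℕ.* K) ℕ.^ (M ℕ.* Q) ℕ.* n ℕ.^ (Q ℕ.+ E)
        ≡⟨ cong₂ ℕ._*_ (sym (ℕₚ.^-*-assoc (b ℕ.* K) M Q)) (ℕₚ.^-distribˡ-+-* n Q E) ⟩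
      ((b ℕ.* K) ℕ.^ M) ℕ.^ Q ℕ.* (n ℕ.^ Q ℕ.* n ℕ.^ E)
        ≡⟨ sym (ℕₚ.*-assoc (((b ℕ.* K) ℕ.^ M) ℕ.^ Q) (n ℕ.^ Q) (n ℕ.^ E)) ⟩
      ((b ℕ.* K) ℕ.^ M) ℕ.^ Q ℕ.* n ℕ.^ Q ℕ.* n ℕ.^ E
        ≡⟨ cong (ℕ._* n ℕ.^ E) (sym (^-distrib-* ((b ℕ.* K) ℕ.^ M) n Q)) ⟩
      ((b ℕ.* K) ℕ.^ M ℕ.* n) ℕ.^ Q ℕ.* n ℕ.^ E ∎)

  greatest-true : {P : Pred ℕ 0ℓ} (P? : Decidable P) → P 0 → ∀ b → P (greatest P? b)
  greatest-true P? P0 zero = P0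
  greatest-true P? P0 (suc b) with P? (suc b)
  ... | yes p = p
  ... | no  _ = greatest-true P? P0 b

  greatest-max : {P : Pred ℕ 0ℓ} (P? : Decidable P) → ∀ b → ¬ P (suc b) → ¬ P (suc (greatest P? b))
  greatest-max P? zero ¬P = ¬P
  greatest-max P? (suc b) ¬P with P? (suc b)
  ... | yes _ = ¬P
  ... | no ¬p = greatest-max P? b ¬p

  ⌊⌋-lower : ∀ K n r → Below n r K ⌊ K · n ^ r ⌋
  ⌊⌋-lower K n r@record{} = greatest-true (below? n r K) ℕ.z≤n (n ℕ.^ posPart (↥ r) ℕ.* K)

  ⌊⌋-upper : ∀ K n .{{_ : ℕ.NonZero n}} r → ¬ Below n r K (suc ⌊ K · n ^ r ⌋)
  ⌊⌋-upper K n r@record{} = greatest-max (below? n r K) b (ℕₚ.<⇒≱ (begin-strict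
    c ℕ.* K ℕ.^ q              ≤⟨ ℕₚ.*-monoˡ-≤ (K ℕ.^ q) c≤c^q ⟩
    c ℕ.^ q ℕ.* K ℕ.^ q        ≡⟨ sym (^-distrib-* c K q) ⟩
    b ℕ.^ q                    <⟨ ℕₚ.^-monoˡ-< q (ℕₚ.n<1+n b) ⟩
    suc b ℕ.^ q                ≤⟨ ℕₚ.m≤m*n (suc b ℕ.^ q) d {{ℕₚ.m^n≢0 n (negPart (↥ r))}} ⟩
    suc b ℕ.^ q ℕ.* d          ∎))
    where
    open ℕₚ.≤-Reasoning
    q = ↧ₙ r
    c = n ℕ.^ posPart (↥ r)
    b = c ℕ.* K
    d = n ℕ.^ negPart (↥ r)
    instance
      c≢0 : ℕ.NonZero c
      c≢0 = ℕₚ.m^n≢0 n (posPart (↥ r))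
    c≤c^q : c ℕ.≤ c ℕ.^ q
    c≤c^q = ℕₚ.m≤m*n c (c ℕ.^ ℚ.denominator-1 r) {{ℕₚ.m^n≢0 c (ℚ.denominator-1 r)}}

  ℤ-parts : ∀ i → i ≡ + posPart i ℤ.- + negPart i
  ℤ-parts (+ n)    = sym (ℤₚ.+-identityʳ (+ n))
  ℤ-parts -[1+ n ] = refl

  clear : ∀ p s q p′ s′ q′ M →
          ((+ p ℤ.- + s) ℤ.* + q′ ℤ.+ ℤ.- (+ p′ ℤ.- + s′) ℤ.* + q) ℤ.* + M ℤ.≤ + 1 ℤ.* + (q ℕ.* q′) →
          (p ℕ.* q′ ℕ.+ s′ ℕ.* q) ℕ.* M ℕ.≤ q ℕ.* q′ ℕ.+ (p′ ℕ.* q ℕ.+ s ℕ.* q′) ℕ.* M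
  clear p s q p′ s′ q′ M h = ℤₚ.drop‿+≤+ (begin
    + ((p ℕ.* q′ ℕ.+ s′ ℕ.* q) ℕ.* M)
      ≡⟨ cast p q′ s′ q M ⟩
    (+ p ℤ.* + q′ ℤ.+ + s′ ℤ.* + q) ℤ.* + M
      ≡⟨ rearrange (+ p) (+ s) (+ q) (+ p′) (+ s′) (+ q′) (+ M) ⟩
    ((+ p ℤ.- + s) ℤ.* + q′ ℤ.+ ℤ.- (+ p′ ℤ.- + s′) ℤ.* + q) ℤ.* + M
      ℤ.+ (+ p′ ℤ.* + q ℤ.+ + s ℤ.* + q′) ℤ.* + M
      ≤⟨ ℤₚ.+-monoˡ-≤ ((+ p′ ℤ.* + q ℤ.+ + s ℤ.* + q′) ℤ.* + M) h ⟩
    + 1 ℤ.* + (q ℕ.* q′) ℤ.+ (+ p′ ℤ.* + q ℤ.+ + s ℤ.* + q′) ℤ.* + M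
      ≡⟨ cong₂ ℤ._+_ (ℤₚ.*-identityˡ (+ (q ℕ.* q′))) (sym (cast p′ q s q′ M)) ⟩
    + (q ℕ.* q′ ℕ.+ (p′ ℕ.* q ℕ.+ s ℕ.* q′) ℕ.* M) ∎)
    where
    open ℤₚ.≤-Reasoning
    cast : ∀ a b c d e → + ((a ℕ.* b ℕ.+ c ℕ.* d) ℕ.* e) ≡ (+ a ℤ.* + b ℤ.+ + c ℤ.* + d) ℤ.* + e
    cast a b c d e = trans (ℤₚ.pos-* (a ℕ.* b ℕ.+ c ℕ.* d) e)
      (cong (ℤ._* + e) (cong₂ ℤ._+_ (ℤₚ.pos-* a b) (ℤₚ.pos-* c d)))
    rearrange : ∀ p s q p′ s′ q′ M →
      (p ℤ.* q′ ℤ.+ s′ ℤ.* q) ℤ.* M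
        ≡ ((p ℤ.- s) ℤ.* q′ ℤ.+ ℤ.- (p′ ℤ.- s′) ℤ.* q) ℤ.* M ℤ.+ (p′ ℤ.* q ℤ.+ s ℤ.* q′) ℤ.* M
    rearrange = ℤ-Ring.solve-∀

  clear-near : ∀ r r′ M → r ℚ.- r′ ℚ.≤ + 1 ℚ./ suc M →
    (posPart (↥ r) ℕ.* ↧ₙ r′ ℕ.+ negPart (↥ r′) ℕ.* ↧ₙ r) ℕ.* suc M
      ℕ.≤ ↧ₙ r ℕ.* ↧ₙ r′ ℕ.+ (posPart (↥ r′) ℕ.* ↧ₙ r ℕ.+ negPart (↥ r) ℕ.* ↧ₙ r′) ℕ.* suc M
  clear-near r@(ℚ.mkℚ i d _) r′@(ℚ.mkℚ i′ d′ _) M h =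
    clear (posPart i) (negPart i) (suc d) (posPart i′) (negPart i′) (suc d′) (suc M)
      (subst₂ (λ u v → (u ℤ.* + suc d′ ℤ.+ ℤ.- v ℤ.* + suc d) ℤ.* + suc M ℤ.≤ + 1 ℤ.* + (suc d ℕ.* suc d′))
        (ℤ-parts i) (ℤ-parts i′) (ℚᵘₚ.drop-*≤* unnormalised))
    where
    open ℚᵘₚ.≤-Reasoning
    unnormalised : ℚᵘ.mkℚᵘ i d ℚᵘ.- ℚᵘ.mkℚᵘ i′ d′ ℚᵘ.≤ ℚᵘ.mkℚᵘ (+ 1) M
    unnormalised = begin
      toℚᵘ r ℚᵘ.- toℚᵘ r′         ≃⟨ ℚᵘₚ.+-congʳ (toℚᵘ r) (ℚᵘₚ.≃-sym (ℚₚ.toℚᵘ-homo‿- r′)) ⟩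
      toℚᵘ r ℚᵘ.+ toℚᵘ (ℚ.- r′)   ≃⟨ ℚᵘₚ.≃-sym (ℚₚ.toℚᵘ-homo-+ r (ℚ.- r′)) ⟩
      toℚᵘ (r ℚ.- r′)             ≤⟨ ℚₚ.toℚᵘ-mono-≤ h ⟩
      toℚᵘ (+ 1 ℚ./ suc M)        ≃⟨ ℚₚ.toℚᵘ-fromℚᵘ (ℚᵘ.mkℚᵘ (+ 1) M) ⟩
      ℚᵘ.mkℚᵘ (+ 1) M             ∎

  fromℚᵘ-mono-≤ : ∀ {p q} → p ℚᵘ.≤ q → fromℚᵘ p ℚ.≤ fromℚᵘ q
  fromℚᵘ-mono-≤ {p} {q} p≤q = ℚₚ.toℚᵘ-cancel-≤ (begin
    toℚᵘ (fromℚᵘ p)  ≃⟨ ℚₚ.toℚᵘ-fromℚᵘ p ⟩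
    p                ≤⟨ p≤q ⟩
    q                ≃⟨ ℚᵘₚ.≃-sym (ℚₚ.toℚᵘ-fromℚᵘ q) ⟩
    toℚᵘ (fromℚᵘ q)  ∎)
    where open ℚᵘₚ.≤-Reasoning

  fromℚᵘ-homo-+ : ∀ p q → fromℚᵘ (p ℚᵘ.+ q) ≡ fromℚᵘ p ℚ.+ fromℚᵘ q
  fromℚᵘ-homo-+ p q = trans (ℚₚ.fromℚᵘ-cong (ℚᵘₚ.+-cong (ℚᵘₚ.≃-sym (ℚₚ.toℚᵘ-fromℚᵘ p)) (ℚᵘₚ.≃-sym (ℚₚ.toℚᵘ-fromℚᵘ q))))
    (trans (ℚₚ.fromℚᵘ-cong (ℚᵘₚ.≃-sym (ℚₚ.toℚᵘ-homo-+ (fromℚᵘ p) (fromℚᵘ q)))) (ℚₚ.fromℚᵘ-toℚᵘ _))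

  fromℚᵘ-homo-* : ∀ p q → fromℚᵘ (p ℚᵘ.* q) ≡ fromℚᵘ p ℚ.* fromℚᵘ q
  fromℚᵘ-homo-* p q = trans (ℚₚ.fromℚᵘ-cong (ℚᵘₚ.*-cong (ℚᵘₚ.≃-sym (ℚₚ.toℚᵘ-fromℚᵘ p)) (ℚᵘₚ.≃-sym (ℚₚ.toℚᵘ-fromℚᵘ q))))
    (trans (ℚₚ.fromℚᵘ-cong (ℚᵘₚ.≃-sym (ℚₚ.toℚᵘ-homo-* (fromℚᵘ p) (fromℚᵘ q)))) (ℚₚ.fromℚᵘ-toℚᵘ _))

  fraction-≤ : ∀ a b c d M n →
    a ℕ.* suc d ℕ.* suc M ℕ.≤ suc c ℕ.* suc b ℕ.* (suc M ℕ.+ n) →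
    + a ℚ./ suc b ℚ.≤ (+ c ℚ./ suc d ℚ.+ + 1 ℚ./ suc d) ℚ.* (1ℚ ℚ.+ + n ℚ./ suc M)
  fraction-≤ a b c d M n h = ℚₚ.≤-trans (fromℚᵘ-mono-≤ unnormalised) (ℚₚ.≤-reflexive homo)
    where
    C = ℚᵘ.mkℚᵘ (+ c) d
    D = ℚᵘ.mkℚᵘ (+ 1) d
    F = ℚᵘ.mkℚᵘ (+ n) M
    homo : fromℚᵘ ((C ℚᵘ.+ D) ℚᵘ.* (ℚᵘ.1ℚᵘ ℚᵘ.+ F))
         ≡ (fromℚᵘ C ℚ.+ fromℚᵘ D) ℚ.* (1ℚ ℚ.+ fromℚᵘ F)
    homo = trans (fromℚᵘ-homo-* (C ℚᵘ.+ D) (ℚᵘ.1ℚᵘ ℚᵘ.+ F)) (cong₂ ℚ._*_ (fromℚᵘ-homo-+ C D) (fromℚᵘ-homo-+ ℚᵘ.1ℚᵘ F))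

    left : ∀ a d M → a ℤ.* ((d ℤ.* d) ℤ.* (+ 1 ℤ.* M)) ≡ d ℤ.* (a ℤ.* d ℤ.* M)
    left = ℤ-Ring.solve-∀
    right : ∀ c d b M n → d ℤ.* ((+ 1 ℤ.+ c) ℤ.* b ℤ.* (M ℤ.+ n))
          ≡ ((c ℤ.* d ℤ.+ + 1 ℤ.* d) ℤ.* (+ 1 ℤ.* M ℤ.+ n ℤ.* + 1)) ℤ.* b
    right = ℤ-Ring.solve-∀
    cast₃ : ∀ x y z → + (x ℕ.* y ℕ.* z) ≡ + x ℤ.* + y ℤ.* + z
    cast₃ x y z = trans (ℤₚ.pos-* (x ℕ.* y) z) (cong (ℤ._* + z) (ℤₚ.pos-* x y))

    unnormalised : ℚᵘ.mkℚᵘ (+ a) b ℚᵘ.≤ (C ℚᵘ.+ D) ℚᵘ.* (ℚᵘ.1ℚᵘ ℚᵘ.+ F)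
    unnormalised = ℚᵘ.*≤* (begin
      + a ℤ.* + ((suc d ℕ.* suc d) ℕ.* (1 ℕ.* suc M))
        ≡⟨ cong (+ a ℤ.*_) (trans (ℤₚ.pos-* (suc d ℕ.* suc d) (1 ℕ.* suc M))
             (cong₂ ℤ._*_ (ℤₚ.pos-* (suc d) (suc d)) (ℤₚ.pos-* 1 (suc M)))) ⟩
      + a ℤ.* ((+ suc d ℤ.* + suc d) ℤ.* (+ 1 ℤ.* + suc M))
        ≡⟨ left (+ a) (+ suc d) (+ suc M) ⟩
      + suc d ℤ.* (+ a ℤ.* + suc d ℤ.* + suc M)
        ≡⟨ cong (+ suc d ℤ.*_) (sym (cast₃ a (suc d) (suc M))) ⟩
      + suc d ℤ.* + (a ℕ.* suc d ℕ.* suc M)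
        ≤⟨ ℤₚ.*-monoˡ-≤-nonNeg (+ suc d) (ℤ.+≤+ h) ⟩
      + suc d ℤ.* + (suc c ℕ.* suc b ℕ.* (suc M ℕ.+ n))
        ≡⟨ cong (+ suc d ℤ.*_) (cast₃ (suc c) (suc b) (suc M ℕ.+ n)) ⟩
      + suc d ℤ.* ((+ 1 ℤ.+ + c) ℤ.* + suc b ℤ.* (+ suc M ℤ.+ + n))
        ≡⟨ right (+ c) (+ suc d) (+ suc b) (+ suc M) (+ n) ⟩
      ((+ c ℤ.* + suc d ℤ.+ + 1 ℤ.* + suc d) ℤ.* (+ 1 ℤ.* + suc M ℤ.+ + n ℤ.* + 1)) ℤ.* + suc b ∎)
      where open ℤₚ.≤-Reasoning

rationalApprox : ℕ → ℚ → ℕ → ℚ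
rationalApprox n r k = + ⌊ suc k · n ^ r ⌋ ℚ./ suc k

private
  approx-≤ : ∀ n .{{_ : ℕ.NonZero n}} r r′ k l M → r ℚ.- r′ ℚ.≤ + 1 ℚ./ suc M →
    rationalApprox n r k ℚ.≤ (rationalApprox n r′ l ℚ.+ + 1 ℚ./ suc l) ℚ.* (1ℚ ℚ.+ + n ℚ./ suc M)
  approx-≤ n r@record{} r′@record{} k l M h =
    fraction-≤ ⌊ suc k · n ^ r ⌋ k ⌊ suc l · n ^ r′ ⌋ l M n
      (ratio-bound n (suc M)
        ⌊ suc k · n ^ r ⌋ (suc k) (posPart (↥ r)) (negPart (↥ r)) (↧ₙ r)
        (suc ⌊ suc l · n ^ r′ ⌋) (suc l) (posPart (↥ r′)) (negPart (↥ r′)) (↧ₙ r′)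
        (⌊⌋-lower (suc k) n r) (ℕₚ.≰⇒≥ (⌊⌋-upper (suc l) n r′)) (clear-near r r′ M h))

  unit-pos : ∀ M → 0ℚ ℚ.< + 1 ℚ./ suc M
  unit-pos M = ℚₚ.positive⁻¹ (+ 1 ℚ./ suc M) {{ℚₚ.normalize-pos 1 (suc M)}}

  unit-antimono : ∀ {M N} → M ℕ.≤ N → + 1 ℚ./ suc N ℚ.≤ + 1 ℚ./ suc M
  unit-antimono {M} {N} M≤N = fromℚᵘ-mono-≤ {ℚᵘ.mkℚᵘ (+ 1) N} {ℚᵘ.mkℚᵘ (+ 1) M}
    (ℚᵘ.*≤* (ℤₚ.*-monoˡ-≤-nonNeg (+ 1) (ℤ.+≤+ (ℕ.s≤s M≤N))))

  archimedean : ∀ ε → 0ℚ ℚ.< ε → ∃[ M ] + 1 ℚ./ suc M ℚ.≤ ε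
  archimedean ε@(ℚ.mkℚ (+ suc a) d _) _ = d , ℚₚ.≤-trans
    (fromℚᵘ-mono-≤ {ℚᵘ.mkℚᵘ (+ 1) d} {ℚᵘ.mkℚᵘ (+ suc a) d}
      (ℚᵘ.*≤* (ℤₚ.*-monoʳ-≤-nonNeg (+ suc d) {+ 1} {+ suc a} (ℤ.+≤+ (ℕ.s≤s ℕ.z≤n)))))
    (ℚₚ.≤-reflexive (ℚₚ.fromℚᵘ-toℚᵘ ε))
  archimedean (ℚ.mkℚ (+ zero) d _) 0<ε = ⊥-elim (ℚₚ.<⇒≢ 0<ε (sym (ℚₚ.↥p≡0⇒p≡0 _ refl)))
  archimedean (ℚ.mkℚ -[1+ a ] d _) (ℚ.*<* ())

  approx-nonNeg : ∀ n r k → 0ℚ ℚ.≤ rationalApprox n r k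
  approx-nonNeg n r k =
    ℚₚ.nonNegative⁻¹ (rationalApprox n r k) {{ℚₚ.normalize-nonNeg ⌊ suc k · n ^ r ⌋ (suc k)}}

  module _ (n : ℕ) .{{_ : ℕ.NonZero n}} (x : ℝ) where

    approx : ℕ → ℚ
    approx k = rationalApprox n (seq x k) k

    approx-bounded : ∃[ B ] 0ℚ ℚ.< B × (∃[ N ] (∀ k → N ℕ.≤ k → approx k ℚ.+ + 1 ℚ./ suc k ℚ.≤ B))
    approx-bounded with cauchy x 1ℚ (ℚₚ.positive⁻¹ 1ℚ)
    ... | N , close = B₀ ℚ.+ 1ℚ
        , ℚₚ.+-mono-≤-< (ℚₚ.≤-trans (approx-nonNeg n (seq x N) N) (bd N ℕₚ.≤-refl)) (ℚₚ.positive⁻¹ 1ℚ)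
        , N , λ k N≤k → ℚₚ.+-mono-≤ (bd k N≤k) (unit-antimono {0} {k} ℕ.z≤n)
      where
      B₀ = (approx N ℚ.+ + 1 ℚ./ suc N) ℚ.* (1ℚ ℚ.+ + n ℚ./ 1)
      bd : ∀ k → N ℕ.≤ k → approx k ℚ.≤ B₀
      bd k N≤k = approx-≤ n (seq x k) (seq x N) k N 0
        (ℚₚ.≤-trans (p≤∣p∣ (seq x k ℚ.- seq x N)) (close k N N≤k ℕₚ.≤-refl))

    approx-step : ∀ {B δ ε} M → 0ℚ ℚ.< B → + 1 ℚ./ suc M ℚ.≤ δ →
      (B ℚ.* (+ n ℚ./ 1)) ℚ.* δ ≡ ½ ℚ.* ε →
      ∀ k l → approx l ℚ.+ + 1 ℚ./ suc l ℚ.≤ B → + 1 ℚ./ suc l ℚ.≤ ½ ℚ.* ε →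
      ∣ seq x k ℚ.- seq x l ∣ ℚ.≤ + 1 ℚ./ suc M → approx k ℚ.≤ approx l ℚ.+ ε
    approx-step {B} {δ} {ε} M 0<B 1/M≤δ Bnδ k l g≤B 1/l≤ε/2 close = begin
      approx k
        ≤⟨ approx-≤ n (seq x k) (seq x l) k l M (ℚₚ.≤-trans (p≤∣p∣ (seq x k ℚ.- seq x l)) close) ⟩
      (approx l ℚ.+ + 1 ℚ./ suc l) ℚ.* (1ℚ ℚ.+ + n ℚ./ suc M)
        ≡⟨ cong (λ u → (approx l ℚ.+ + 1 ℚ./ suc l) ℚ.* (1ℚ ℚ.+ u)) split ⟩
      (approx l ℚ.+ + 1 ℚ./ suc l) ℚ.* (1ℚ ℚ.+ N ℚ.* (+ 1 ℚ./ suc M))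
        ≡⟨ expand (approx l) (+ 1 ℚ./ suc l) (N ℚ.* (+ 1 ℚ./ suc M)) ⟩
      approx l ℚ.+ (+ 1 ℚ./ suc l ℚ.+ (approx l ℚ.+ + 1 ℚ./ suc l) ℚ.* (N ℚ.* (+ 1 ℚ./ suc M)))
        ≤⟨ ℚₚ.+-monoʳ-≤ (approx l) (ℚₚ.+-mono-≤ 1/l≤ε/2
             (*-mono-≤-nonNeg 0≤N/M (ℚₚ.<⇒≤ 0<B) g≤B
               (ℚₚ.*-monoˡ-≤-nonNeg N {{N-nonNeg}} 1/M≤δ))) ⟩
      approx l ℚ.+ (½ ℚ.* ε ℚ.+ B ℚ.* (N ℚ.* δ))
        ≡⟨ cong (λ u → approx l ℚ.+ (½ ℚ.* ε ℚ.+ u)) (trans (sym (ℚₚ.*-assoc B N δ)) Bnδ) ⟩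
      approx l ℚ.+ (½ ℚ.* ε ℚ.+ ½ ℚ.* ε)
        ≡⟨ cong (approx l ℚ.+_) (halves ε) ⟩
      approx l ℚ.+ ε ∎
      where
      open ℚₚ.≤-Reasoning
      N = + n ℚ./ 1
      N-nonNeg : ℚ.NonNegative N
      N-nonNeg = ℚₚ.normalize-nonNeg n 1
      0≤N/M : 0ℚ ℚ.≤ N ℚ.* (+ 1 ℚ./ suc M)
      0≤N/M = ℚₚ.nonNegative⁻¹ (N ℚ.* (+ 1 ℚ./ suc M))
        {{ℚₚ.nonNeg*nonNeg⇒nonNeg N {{N-nonNeg}} (+ 1 ℚ./ suc M) {{ℚₚ.normalize-nonNeg 1 (suc M)}}}}
      split : + n ℚ./ suc M ≡ N ℚ.* (+ 1 ℚ./ suc M)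
      split = trans
        (ℚₚ.fromℚᵘ-cong {ℚᵘ.mkℚᵘ (+ n) M} {ℚᵘ.mkℚᵘ (+ n) 0 ℚᵘ.* ℚᵘ.mkℚᵘ (+ 1) M}
          (ℚᵘ.*≡* (cong₂ ℤ._*_ (sym (ℤₚ.*-identityʳ (+ n))) (cong +_ (ℕₚ.*-identityˡ (suc M))))))
        (fromℚᵘ-homo-* (ℚᵘ.mkℚᵘ (+ n) 0) (ℚᵘ.mkℚᵘ (+ 1) M))
      open +-*-Solver using (solve; _:=_; _:+_; _:*_; con)
      expand : ∀ g u v → (g ℚ.+ u) ℚ.* (1ℚ ℚ.+ v) ≡ g ℚ.+ (u ℚ.+ (g ℚ.+ u) ℚ.* v)
      expand = solve 3 (λ g u v → (g :+ u) :* (con 1ℚ :+ v) := g :+ (u :+ (g :+ u) :* v)) refl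

    approx-cauchy : ∀ ε → 0ℚ ℚ.< ε →
      ∃[ N ] (∀ k l → N ℕ.≤ k → N ℕ.≤ l → ∣ approx k ℚ.- approx l ∣ ℚ.≤ ε)
    approx-cauchy ε 0<ε =
      let B , 0<B , N₁ , bd = approx-bounded
          δ , 0<δ , Bnδ     = scale (*-pos 0<B 0<n) (half-pos 0<ε)
          M , 1/M≤δ         = archimedean δ 0<δ
          N₂ , 1/N₂≤ε/2     = archimedean (½ ℚ.* ε) (half-pos 0<ε)
          N₃ , close        = cauchy x (+ 1 ℚ./ suc M) (unit-pos M)
          split : ∀ {k} → (N₁ ℕ.⊔ N₂) ℕ.⊔ N₃ ℕ.≤ k → N₁ ℕ.≤ k × N₂ ℕ.≤ k × N₃ ℕ.≤ k
          split N≤k =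
            let N₁₂≤k = ℕₚ.m⊔n≤o⇒m≤o (N₁ ℕ.⊔ N₂) N₃ N≤k
            in ℕₚ.m⊔n≤o⇒m≤o N₁ N₂ N₁₂≤k , ℕₚ.m⊔n≤o⇒n≤o N₁ N₂ N₁₂≤k
             , ℕₚ.m⊔n≤o⇒n≤o (N₁ ℕ.⊔ N₂) N₃ N≤k
          step : ∀ k l → (N₁ ℕ.⊔ N₂) ℕ.⊔ N₃ ℕ.≤ k → (N₁ ℕ.⊔ N₂) ℕ.⊔ N₃ ℕ.≤ l → approx k ℚ.≤ approx l ℚ.+ ε
          step k l N≤k N≤l =
            let _ , _ , N₃≤k       = split N≤k
                N₁≤l , N₂≤l , N₃≤l = split N≤l
            in approx-step M 0<B 1/M≤δ Bnδ k l (bd l N₁≤l)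
                 (ℚₚ.≤-trans (unit-antimono N₂≤l) 1/N₂≤ε/2) (close k l N₃≤k N₃≤l)
      in (N₁ ℕ.⊔ N₂) ℕ.⊔ N₃ , λ k l N≤k N≤l →
           ∣-∣-bound (step k l N≤k N≤l) (step l k N≤l N≤k)
      where
      0<n : 0ℚ ℚ.< + n ℚ./ 1
      0<n = ℚₚ.positive⁻¹ (+ n ℚ./ 1) {{ℚₚ.normalize-pos n 1}}

infixr 8 _^_

-- For n ≥ 1 and x = lim xₖ, n^x is the limit of n^xₖ, each rounded down to a
-- multiple of 1/(k+1). By convention 0^x = 0 for every x.
_^_ : ℕ → ℝ → ℝ
zero      ^ x = 0ℝ
n@(suc _) ^ x = record
  { seq    = λ k → rationalApprox n (seq x k) k
  ; cauchy = approx-cauchy n x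
  }

_IsEnumeratedBy_ : Pred ℝ 0ℓ → ∀ {n} → (Fin n → ℝ) → Set
A IsEnumeratedBy a = ∀ x → x ∈ A ⇔ (∃[ i ] x ≈ a i)

HasCardinality : Pred ℝ 0ℓ → ℕ → Set
HasCardinality A n =
  Σ (Fin n → ℝ) λ a → A IsEnumeratedBy a × (∀ {i j} → a i ≈ a j → i ≡ j)

_⊕_ : Pred ℝ 0ℓ → Pred ℝ 0ℓ → Pred ℝ 0ℓ
(A ⊕ B) x = ∃[ a ] ∃[ b ] a ∈ A × b ∈ B × x ≈ a + b

StrictlyIncreasing : ∀ {n} → (Fin n → ℝ) → Set
StrictlyIncreasing f = ∀ {i j} → i Fin.< j → f i < f j

gaps : ∀ {n} → (Fin n → ℝ) → (Fin (pred n) → ℝ)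
gaps {suc n} a j = a (Fin.suc j) - a (inject₁ j)

Convex : Pred ℝ 0ℓ → Set
Convex A = ∃[ n ] Σ (Fin n → ℝ) λ a →
  A IsEnumeratedBy a × StrictlyIncreasing a × StrictlyIncreasing (gaps a)

{-# OPTIONS --safe #-}
module Submission where

-- Let A be convex, n = |A|, m = |A + A|; ≲ hides powers of log n.
--
-- Incidences.  For fixed y, the solutions of z + y = a with z ∈ Z and a ∈ A form a monotone chain
-- in a grid of blocks of Z and of A, and two solutions in one cell are determined by the two values
-- of z and an index difference in A, because A is convex.  Hence there are O(n^(1/3) (|Z||Y|)^(2/3))
-- solutions with y ∈ Y, which replaces the Szemerédi–Trotter theorem.  In particular only
-- O(n |D|² / t³) elements have t representations in A − D.
--
-- Sums.  Pass to a regular B ⊆ A on which most sums are popular, i.e. have ≳ n²/m representations.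
-- Let D be a level set {x : r(x) ≥ Δ} of the representation function r of B − B for which
-- M = Δ^(12/7) |D| is maximal.  Apply Cauchy–Schwarz to the triples with a − b ∈ D and a + c, b + c
-- popular; since Σ r³ ≲ n³ this gives n² |D|² Δ² ≲ n³ W, where W counts the pairs of popular sums
-- with difference in D.  Writing out both popular sums, W ≲ (m/n²)² Q, where Q counts the solutions
-- of (a − d) + (e − c) ∈ A with d ∈ D; splitting into levels, the incidence bound gives
-- Q ≲ n |D|^(5/6) F^(2/3) with F = max Δ'^(3/2) |D'| over all level sets D'.  As F interpolates
-- between Σ r ≤ n² and M, this closes up to M ≲ m^(20/7) n^(−16/7).  Interpolating between M and
-- Σ r³ ≲ n³ bounds Σ r², which is at least of order n⁴/m, and the result is n^46 ≲ m^29.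
--
-- Reals.  Simultaneous Diophantine approximation replaces A by a convex set of integers which has
-- all the coincidences among the sums of A.

-- The weight 12/7 is forced. Interpolation for the level sets of B - D produces the factor
-- |D|^(5/6), so that the Cauchy-Schwarz bound compares Δ² |D|² / |D|^(5/6) = Δ² |D|^(7/6) with a
-- power of F. The argument can close on a quantity Δ^s |D| only if Δ² |D|^(7/6) is a power of it,
-- hence s = 2 / (7/6) = 12/7.
--
-- Reals are Cauchy sequences here, on which equality and order cannot be decided, so the sums of A
-- cannot be listed without repetition and counted. Rational approximations alone would not do: they
-- keep convexity, but they separate equal sums, and the bound on the number of sums would be lost.
-- Multiplying by a suitable integer before rounding keeps both. After that all counting is done
-- with lists of integers, and every estimate compares natural numbers raised to integral powers;
-- fractional exponents appear only as ratios of such powers.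

-- Elementary arithmetic

module Arithmetic where

  open import Data.Nat.Base
  open import Data.Nat.DivMod using (m≡m%n+[m/n]*n; m%n<n; m/n*n≤m)
  open import Data.Nat.Properties
  open import Data.Nat.Tactic.RingSolver using (solve-∀)
  open import Relation.Binary.PropositionalEquality using (_≡_; refl; trans; cong)

  same-quotient-< : ∀ a b k .{{_ : NonZero k}} → a / k ≡ b / k → a < b + k
  same-quotient-< a b k eq = begin-strict
    a                  ≡⟨ m≡m%n+[m/n]*n a k ⟩
    a % k + a / k * k  <⟨ +-monoˡ-< (a / k * k) (m%n<n a k) ⟩
    k + a / k * k      ≡⟨ cong (λ q → k + q * k) eq ⟩
    k + b / k * k      ≤⟨ +-monoʳ-≤ k (m/n*n≤m b k) ⟩
    k + b              ≡⟨ +-comm k b ⟩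
    b + k              ∎
    where open ≤-Reasoning

  ^-distribʳ-* : ∀ e a b → (a * b) ^ e ≡ a ^ e * b ^ e
  ^-distribʳ-* zero    a b = refl
  ^-distribʳ-* (suc e) a b = trans (cong (a * b *_) (^-distribʳ-* e a b)) (interchange a b (a ^ e) (b ^ e))
    where
    interchange : ∀ a b c d → a * b * (c * d) ≡ a * c * (b * d)
    interchange = solve-∀

-- Sums over lists, injections, multiplicities and their dyadic level sets

module Counting where

  open import Data.Empty using (⊥-elim)
  open import Data.List.Base using (List; []; _∷_; _++_; length; map; filter; cartesianProduct; applyUpTo; upTo; deduplicate)
  open import Data.List.Membership.Propositional using (_∈_)
  open import Data.List.Membership.Propositional.Properties using (∈-∃++; ∈-++⁺ˡ; ∈-++⁺ʳ; ∈-++⁻; ∈-filter⁻; ∈-upTo⁺; ∈-upTo⁻; ∈-deduplicate⁺; ∈-deduplicate⁻)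
  open import Data.List.Properties using (length-++; length-upTo)
  open import Data.List.Relation.Unary.Any using (here; there)
  import Data.List.Relation.Unary.All as All
  open import Data.List.Relation.Unary.AllPairs using ([]; _∷_)
  open import Data.List.Relation.Unary.Unique.Propositional using (Unique)
  import Data.List.Relation.Unary.Unique.Propositional.Properties as Uniqueₚ
  import Data.List.Relation.Unary.Unique.DecPropositional.Properties as DecUniqueₚ
  open import Data.Nat.Base
  open import Data.Nat.Properties hiding (_≟_)
  open import Data.Nat.Tactic.RingSolver using (solve-∀)
  open import Data.Product.Base using (∃-syntax; _×_; _,_; proj₁; proj₂)
  open import Data.Sum.Base using (inj₁; inj₂)
  open import Function.Base using (_∘_)
  open import Relation.Binary.Definitions using (DecidableEquality)
  open import Relation.Binary.PropositionalEquality
  open import Relation.Nullary using (¬_; Dec; yes; no)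
  open import Relation.Unary using (Pred; Decidable)
  open import Level using (0ℓ)

  private
    variable
      X Y : Set
      xs ys : List X

  𝟙 : {P : Set} → Dec P → ℕ
  𝟙 (yes _) = 1
  𝟙 (no  _) = 0

  𝟙-yes : {P : Set} (P? : Dec P) → P → 𝟙 P? ≡ 1
  𝟙-yes (yes _) _ = refl
  𝟙-yes (no ¬p) p = ⊥-elim (¬p p)

  𝟙-no : {P : Set} (P? : Dec P) → ¬ P → 𝟙 P? ≡ 0
  𝟙-no (yes p) ¬p = ⊥-elim (¬p p)
  𝟙-no (no _)  _  = refl

  𝟙-mono : {P Q : Set} (P? : Dec P) (Q? : Dec Q) → (P → Q) → 𝟙 P? ≤ 𝟙 Q?
  𝟙-mono (yes p) Q? f = ≤-reflexive (sym (𝟙-yes Q? (f p)))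
  𝟙-mono (no _)  Q? f = z≤n

  2ab≤a²+b² : ∀ a b → a * b + a * b ≤ a * a + b * b
  2ab≤a²+b² a b with ≤-total a b
  ... | inj₁ a≤b = subst (λ b → a * b + a * b ≤ a * a + b * b) (m+[n∸m]≡n a≤b)
    (≤-trans (m≤m+n _ (c * c)) (≤-reflexive (lem a c)))
    where
    c = b ∸ a
    lem : ∀ a c → a * (a + c) + a * (a + c) + c * c ≡ a * a + (a + c) * (a + c)
    lem = solve-∀
  ... | inj₂ b≤a = subst (λ a → a * b + a * b ≤ a * a + b * b) (m+[n∸m]≡n b≤a)
    (≤-trans (m≤m+n _ (c * c)) (≤-reflexive (lem b c)))
    where
    c = a ∸ b
    lem : ∀ b c → (b + c) * b + (b + c) * b + c * c ≡ (b + c) * (b + c) + b * b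
    lem = solve-∀

  abstract

    ∑ : List X → (X → ℕ) → ℕ
    ∑ []       f = 0
    ∑ (x ∷ xs) f = f x + ∑ xs f

    ∑-mono : {f g : X → ℕ} → (∀ {x} → x ∈ xs → f x ≤ g x) → ∑ xs f ≤ ∑ xs g
    ∑-mono {xs = []}     h = z≤n
    ∑-mono {xs = x ∷ xs} h = +-mono-≤ (h (here refl)) (∑-mono (h ∘ there))

    ∑-cong : {f g : X → ℕ} → (∀ {x} → x ∈ xs → f x ≡ g x) → ∑ xs f ≡ ∑ xs g
    ∑-cong {xs = []}     h = refl
    ∑-cong {xs = x ∷ xs} h = cong₂ _+_ (h (here refl)) (∑-cong (h ∘ there))

    ∑-+ : ∀ xs (f g : X → ℕ) → ∑ xs (λ x → f x + g x) ≡ ∑ xs f + ∑ xs g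
    ∑-+ []       f g = refl
    ∑-+ (x ∷ xs) f g = trans (cong (f x + g x +_) (∑-+ xs f g)) (interchange (f x) (g x) (∑ xs f) (∑ xs g))
      where
      interchange : ∀ a b c d → a + b + (c + d) ≡ a + c + (b + d)
      interchange = solve-∀

    ∑-*ˡ : ∀ xs c (f : X → ℕ) → ∑ xs (λ x → c * f x) ≡ c * ∑ xs f
    ∑-*ˡ []       c f = sym (*-zeroʳ c)
    ∑-*ˡ (x ∷ xs) c f = trans (cong (c * f x +_) (∑-*ˡ xs c f)) (sym (*-distribˡ-+ c (f x) (∑ xs f)))

    ∑-const : ∀ (xs : List X) c → ∑ xs (λ _ → c) ≡ length xs * c
    ∑-const []       c = refl
    ∑-const (x ∷ xs) c = cong (c +_) (∑-const xs c)

    ∑-empty : (f : X → ℕ) → ∑ [] f ≡ 0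
    ∑-empty f = refl

    ∑-∷ : ∀ x xs (f : X → ℕ) → ∑ (x ∷ xs) f ≡ f x + ∑ xs f
    ∑-∷ x xs f = refl

    ∑-zero : ∀ (xs : List X) → ∑ xs (λ _ → 0) ≡ 0
    ∑-zero xs = trans (∑-const xs 0) (*-zeroʳ (length xs))

    ∑-swap : ∀ (xs : List X) (ys : List Y) (f : X → Y → ℕ) →
             ∑ xs (λ x → ∑ ys (f x)) ≡ ∑ ys (λ y → ∑ xs (λ x → f x y))
    ∑-swap []       ys f = sym (∑-zero ys)
    ∑-swap (x ∷ xs) ys f = trans (cong (∑ ys (f x) +_) (∑-swap xs ys f))
      (sym (∑-+ ys (f x) (λ y → ∑ xs (λ x → f x y))))

    ∑-map : ∀ (g : X → Y) xs (f : Y → ℕ) → ∑ (map g xs) f ≡ ∑ xs (f ∘ g)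
    ∑-map g []       f = refl
    ∑-map g (x ∷ xs) f = cong (f (g x) +_) (∑-map g xs f)

    ∑-++ : ∀ (xs ys : List X) f → ∑ (xs ++ ys) f ≡ ∑ xs f + ∑ ys f
    ∑-++ []       ys f = refl
    ∑-++ (x ∷ xs) ys f = trans (cong (f x +_) (∑-++ xs ys f)) (sym (+-assoc (f x) (∑ xs f) (∑ ys f)))

    ∑-× : ∀ (xs : List X) (ys : List Y) f →
          ∑ (cartesianProduct xs ys) f ≡ ∑ xs (λ x → ∑ ys (λ y → f (x , y)))
    ∑-× []       ys f = refl
    ∑-× (x ∷ xs) ys f = trans (∑-++ (map (x ,_) ys) (cartesianProduct xs ys) f)
      (cong₂ _+_ (∑-map (x ,_) ys f) (∑-× xs ys f))

    ∑-∈ : ∀ {x} (f : X → ℕ) → x ∈ xs → f x ≤ ∑ xs f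
    ∑-∈ {xs = y ∷ xs} f (here refl) = m≤m+n (f y) (∑ xs f)
    ∑-∈ {xs = y ∷ xs} f (there x∈)  = ≤-trans (∑-∈ f x∈) (m≤n+m (∑ xs f) (f y))

    ∑-filter : {P : Pred X 0ℓ} (P? : Decidable P) → ∀ xs f → ∑ (filter P? xs) f ≡ ∑ xs (λ x → 𝟙 (P? x) * f x)
    ∑-filter P? []       f = refl
    ∑-filter P? (x ∷ xs) f with P? x
    ... | yes _ = cong₂ _+_ (sym (*-identityˡ (f x))) (∑-filter P? xs f)
    ... | no  _ = ∑-filter P? xs f

    -- Induction on the list: the cross terms between the head and the tail are bounded one by one
    -- with 2ab ≤ a² + b², which avoids subtraction.
    cauchy-schwarz : ∀ (xs : List X) f → ∑ xs f * ∑ xs f ≤ length xs * ∑ xs (λ x → f x * f x)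
    cauchy-schwarz []       f = z≤n
    cauchy-schwarz (x ∷ xs) f = begin
      (a + s) * (a + s)                  ≡⟨ expand a s ⟩
      a * a + (a * s + a * s) + s * s    ≤⟨ +-mono-≤ (+-monoʳ-≤ (a * a) cross) (cauchy-schwarz xs f) ⟩
      a * a + (k * (a * a) + q) + k * q  ≡⟨ collect a k q ⟩
      suc k * (a * a + q)                ∎
      where
      open ≤-Reasoning
      a s k q : ℕ
      a = f x
      s = ∑ xs f
      k = length xs
      q = ∑ xs (λ x → f x * f x)
      expand : ∀ a s → (a + s) * (a + s) ≡ a * a + (a * s + a * s) + s * s
      expand = solve-∀
      collect : ∀ a k q → a * a + (k * (a * a) + q) + k * q ≡ suc k * (a * a + q)
      collect = solve-∀
      cross : a * s + a * s ≤ k * (a * a) + q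
      cross = begin
        a * s + a * s                             ≡⟨ sym (cong₂ _+_ (∑-*ˡ xs a f) (∑-*ˡ xs a f)) ⟩
        ∑ xs (λ y → a * f y) + ∑ xs (λ y → a * f y) ≡⟨ sym (∑-+ xs (λ y → a * f y) (λ y → a * f y)) ⟩
        ∑ xs (λ y → a * f y + a * f y)            ≤⟨ ∑-mono {xs = xs} (λ {y} _ → 2ab≤a²+b² a (f y)) ⟩
        ∑ xs (λ y → a * a + f y * f y)            ≡⟨ ∑-+ xs (λ _ → a * a) (λ y → f y * f y) ⟩
        ∑ xs (λ _ → a * a) + q                    ≡⟨ cong (_+ q) (∑-const xs (a * a)) ⟩
        k * (a * a) + q                           ∎

  ∑-*ʳ : ∀ xs c (f : X → ℕ) → ∑ xs (λ x → f x * c) ≡ ∑ xs f * c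
  ∑-*ʳ xs c f = trans (∑-cong λ {x} _ → *-comm (f x) c) (trans (∑-*ˡ xs c f) (*-comm c (∑ xs f)))

  ∑-one : ∀ (xs : List X) → ∑ xs (λ _ → 1) ≡ length xs
  ∑-one xs = trans (∑-const xs 1) (*-identityʳ (length xs))

  length-× : ∀ (xs : List X) (ys : List Y) → length (cartesianProduct xs ys) ≡ length xs * length ys
  length-× xs ys = trans (sym (∑-one (cartesianProduct xs ys))) (trans (∑-× xs ys (λ _ → 1))
    (trans (∑-cong λ _ → ∑-one ys) (∑-const xs (length ys))))

  argmax : ∀ (f : X → ℕ) x xs → ∃[ y ] (y ∈ x ∷ xs) × (∀ {z} → z ∈ x ∷ xs → f z ≤ f y)
  argmax f x []        = x , here refl , λ { (here refl) → ≤-refl }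
  argmax f x (x′ ∷ xs) with argmax f x′ xs
  ... | y , y∈ , max with ≤-total (f x) (f y)
  ... | inj₁ fx≤fy = y , there y∈ , λ { (here refl) → fx≤fy ; (there z∈) → max z∈ }
  ... | inj₂ fy≤fx = x , here refl , λ { (here refl) → ≤-refl ; (there z∈) → ≤-trans (max z∈) fy≤fx }

  ∑-≤-max : ∀ (xs : List X) (f : X → ℕ) c → (∀ {x} → x ∈ xs → f x ≤ c) → ∑ xs f ≤ length xs * c
  ∑-≤-max xs f c h = ≤-trans (∑-mono h) (≤-reflexive (∑-const xs c))

  -- Pigeonhole over the scales: one of the l + 1 scales carries at least the average, at the price
  -- of one logarithmic factor.
  ∑-upTo-max : ∀ l (f : ℕ → ℕ) → ∃[ i ] i < suc l × ∑ (upTo (suc l)) f ≤ suc l * f i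
  ∑-upTo-max l f =
    let i , i∈ , max = argmax f 0 (applyUpTo suc l)
    in i , ∈-upTo⁻ i∈ , ≤-trans (∑-≤-max (upTo (suc l)) f (f i) max)
         (≤-reflexive (cong (_* f i) (length-upTo (suc l))))

  argmax-upTo : ∀ l (f : ℕ → ℕ) → ∃[ i ] i < suc l × (∀ {j} → j < suc l → f j ≤ f i)
  argmax-upTo l f =
    let i , i∈ , max = argmax f 0 (applyUpTo suc l)
    in i , ∈-upTo⁻ i∈ , λ j< → max (∈-upTo⁺ j<)

  length-filter : {P : Pred X 0ℓ} (P? : Decidable P) → ∀ xs → length (filter P? xs) ≡ ∑ xs (𝟙 ∘ P?)
  length-filter P? xs = trans (sym (∑-one (filter P? xs)))
    (trans (∑-filter P? xs (λ _ → 1)) (∑-cong λ {x} _ → *-identityʳ (𝟙 (P? x))))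

  -- The partner of the head is cut out of `ys`, and injectivity keeps the partners of the tail away
  -- from it. A relation is allowed in place of a function because the integer sums will be matched
  -- with labels that depend on a chosen representation of the sum.
  relation-injection : (R : X → Y → Set) → Unique xs →
    (∀ {x} → x ∈ xs → ∃[ y ] y ∈ ys × R x y) →
    (∀ {x x′ y} → x ∈ xs → x′ ∈ xs → R x y → R x′ y → x ≡ x′) →
    length xs ≤ length ys
  relation-injection {xs = []} R _ _ _ = z≤n
  relation-injection {xs = x ∷ xs} R (x∉ ∷ uniq) total inj with total (here refl)
  ... | y , y∈ , Rxy with ∈-∃++ y∈
  ... | ys₁ , ys₂ , refl = begin
    suc (length xs)                ≤⟨ s≤s (relation-injection R uniq total′ (λ p q → inj (there p) (there q))) ⟩
    suc (length (ys₁ ++ ys₂))      ≡⟨ cong suc (length-++ ys₁) ⟩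
    suc (length ys₁ + length ys₂)  ≡⟨ sym (+-suc (length ys₁) (length ys₂)) ⟩
    length ys₁ + length (y ∷ ys₂)  ≡⟨ sym (length-++ ys₁) ⟩
    length (ys₁ ++ y ∷ ys₂)        ∎
    where
    open ≤-Reasoning
    total′ : ∀ {x′} → x′ ∈ xs → ∃[ y′ ] y′ ∈ ys₁ ++ ys₂ × R x′ y′
    total′ {x′} x′∈ with total (there x′∈)
    ... | y′ , y′∈ , Rx′y′ with ∈-++⁻ ys₁ y′∈
    ... | inj₁ y′∈₁           = y′ , ∈-++⁺ˡ y′∈₁ , Rx′y′
    ... | inj₂ (there y′∈₂)   = y′ , ∈-++⁺ʳ ys₁ y′∈₂ , Rx′y′
    ... | inj₂ (here refl)    = ⊥-elim (All.lookup x∉ x′∈ (inj (here refl) (there x′∈) Rxy Rx′y′))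

  injection : (f : X → Y) → Unique xs → (∀ {x} → x ∈ xs → f x ∈ ys) →
    (∀ {x x′} → x ∈ xs → x′ ∈ xs → f x ≡ f x′ → x ≡ x′) → length xs ≤ length ys
  injection f uniq into inj = relation-injection (λ x y → f x ≡ y) uniq
    (λ x∈ → f _ , into x∈ , refl) (λ x∈ x′∈ p q → inj x∈ x′∈ (trans p (sym q)))

  module Multiplicity {Y : Set} (_≟_ : DecidableEquality Y) where

    -- Lists with repetitions serve as multisets: when `ws` lists all sums or differences of pairs,
    -- `mult ws` is its representation function.
    mult : List Y → Y → ℕ
    mult ws y = ∑ ws (λ w → 𝟙 (w ≟ y))

    ∑-point-≤ : ∀ {z} (f : Y → ℕ) → Unique ys → ∑ ys (λ y → 𝟙 (z ≟ y) * f y) ≤ f z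
    ∑-point-≤ f [] = ≤-trans (≤-reflexive (∑-empty _)) z≤n
    ∑-point-≤ {ys = y ∷ ys} {z} f (y∉ ∷ uniq) = ≤-trans (≤-reflexive (∑-∷ y ys (λ y → 𝟙 (z ≟ y) * f y))) (split (z ≟ y))
      where
      split : (d : Dec (z ≡ y)) → 𝟙 d * f y + ∑ ys (λ y → 𝟙 (z ≟ y) * f y) ≤ f z
      split (no  _)    = ∑-point-≤ f uniq
      split (yes refl) = ≤-reflexive (trans (cong₂ _+_ (*-identityˡ (f z)) rest) (+-identityʳ (f z)))
        where
        rest : ∑ ys (λ y → 𝟙 (z ≟ y) * f y) ≡ 0
        rest = trans (∑-cong λ {y} y∈ → cong (_* f y) (𝟙-no (z ≟ y) (All.lookup y∉ y∈))) (∑-zero ys)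

    ∑-point : ∀ {z} (f : Y → ℕ) → Unique ys → z ∈ ys → ∑ ys (λ y → 𝟙 (z ≟ y) * f y) ≡ f z
    ∑-point {ys} {z} f uniq z∈ = ≤-antisym (∑-point-≤ f uniq)
      (≤-trans (≤-reflexive (trans (sym (*-identityˡ (f z))) (cong (_* f z) (sym (𝟙-yes (z ≟ z) refl)))))
        (∑-∈ (λ y → 𝟙 (z ≟ y) * f y) z∈))

    ∑-fibre : ∀ ws (f : Y → ℕ) → Unique ys → (∀ {w} → w ∈ ws → w ∈ ys) →
              ∑ ws f ≡ ∑ ys (λ y → mult ws y * f y)
    ∑-fibre {ys} ws f uniq into = begin
      ∑ ws f                                     ≡⟨ ∑-cong (λ w∈ → sym (∑-point f uniq (into w∈))) ⟩
      ∑ ws (λ w → ∑ ys (λ y → 𝟙 (w ≟ y) * f y))  ≡⟨ ∑-swap ws ys (λ w y → 𝟙 (w ≟ y) * f y) ⟩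
      ∑ ys (λ y → ∑ ws (λ w → 𝟙 (w ≟ y) * f y))  ≡⟨ ∑-cong (λ {y} _ → ∑-*ʳ ws (f y) (λ w → 𝟙 (w ≟ y))) ⟩
      ∑ ys (λ y → mult ws y * f y)               ∎
      where open ≡-Reasoning

    ∑-fibre-≤ : ∀ ws (f : Y → ℕ) → Unique ys → ∑ ys (λ y → mult ws y * f y) ≤ ∑ ws f
    ∑-fibre-≤ {ys} ws f uniq = begin
      ∑ ys (λ y → mult ws y * f y)               ≡⟨ ∑-cong (λ {y} _ → ∑-*ʳ ws (f y) (λ w → 𝟙 (w ≟ y))) ⟨
      ∑ ys (λ y → ∑ ws (λ w → 𝟙 (w ≟ y) * f y))  ≡⟨ ∑-swap ws ys (λ w y → 𝟙 (w ≟ y) * f y) ⟨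
      ∑ ws (λ w → ∑ ys (λ y → 𝟙 (w ≟ y) * f y))  ≤⟨ ∑-mono (λ _ → ∑-point-≤ f uniq) ⟩
      ∑ ws f                                     ∎
      where open ≤-Reasoning

    length-∑-mult : ∀ ws → Unique ys → (∀ {w} → w ∈ ws → w ∈ ys) → length ws ≡ ∑ ys (mult ws)
    length-∑-mult {ys = ys} ws uniq into = begin
      length ws                     ≡⟨ sym (∑-one ws) ⟩
      ∑ ws (λ _ → 1)                ≡⟨ ∑-fibre ws (λ _ → 1) uniq into ⟩
      ∑ ys (λ y → mult ws y * 1)    ≡⟨ ∑-cong {xs = ys} {f = λ y → mult ws y * 1} {g = mult ws} (λ {y} _ → *-identityʳ (mult ws y)) ⟩
      ∑ ys (mult ws)                ∎
      where open ≡-Reasoning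

    ∑-mult-≤-length : ∀ ws → Unique ys → ∑ ys (mult ws) ≤ length ws
    ∑-mult-≤-length {ys = ys} ws uniq = begin
      ∑ ys (mult ws)                ≡⟨ ∑-cong {xs = ys} {f = mult ws} {g = λ y → mult ws y * 1} (λ {y} _ → sym (*-identityʳ (mult ws y))) ⟩
      ∑ ys (λ y → mult ws y * 1)    ≤⟨ ∑-fibre-≤ ws (λ _ → 1) uniq ⟩
      ∑ ws (λ _ → 1)                ≡⟨ ∑-one ws ⟩
      length ws                     ∎
      where open ≤-Reasoning

    mult-map : ∀ (g : X → Y) xs y → mult (map g xs) y ≡ length (filter (λ x → g x ≟ y) xs)
    mult-map g xs y = trans (∑-map g xs (λ w → 𝟙 (w ≟ y))) (sym (length-filter (λ x → g x ≟ y) xs))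

    -- The sum of the squared multiplicities, that is, the number of ordered pairs of positions with
    -- equal entries. For a list of sums or differences this is the additive energy.
    collisions : List Y → ℕ
    collisions ws = ∑ ws (mult ws)

    collisions-bound : ∀ ws → Unique ys → (∀ {w} → w ∈ ws → w ∈ ys) →
                       length ws * length ws ≤ length ys * collisions ws
    collisions-bound {ys} ws uniq into = begin
      length ws * length ws                        ≡⟨ cong₂ _*_ (length-∑-mult ws uniq into) (length-∑-mult ws uniq into) ⟩
      ∑ ys (mult ws) * ∑ ys (mult ws)              ≤⟨ cauchy-schwarz ys (mult ws) ⟩
      length ys * ∑ ys (λ y → mult ws y * mult ws y) ≡⟨ cong (length ys *_) (sym (∑-fibre ws (mult ws) uniq into)) ⟩
      length ys * collisions ws                    ∎
      where open ≤-Reasoning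

    -- Presents the collisions as a list of pairs, so that `injection` can bound them. Cells of the
    -- incidence grid, equal sums and triples with equal corners are all counted in this way.
    collisions-map : ∀ (g : X → Y) xs →
      collisions (map g xs) ≡ length (filter (λ p → g (proj₂ p) ≟ g (proj₁ p)) (cartesianProduct xs xs))
    collisions-map g xs = begin
      ∑ (map g xs) (mult (map g xs))               ≡⟨ ∑-map g xs (mult (map g xs)) ⟩
      ∑ xs (λ x → mult (map g xs) (g x))           ≡⟨ ∑-cong (λ {x} _ → ∑-map g xs (λ w → 𝟙 (w ≟ g x))) ⟩
      ∑ xs (λ x → ∑ xs (λ x′ → 𝟙 (g x′ ≟ g x)))    ≡⟨ sym (∑-× xs xs (λ p → 𝟙 (g (proj₂ p) ≟ g (proj₁ p)))) ⟩
      ∑ (cartesianProduct xs xs) (λ p → 𝟙 (g (proj₂ p) ≟ g (proj₁ p)))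
        ≡⟨ sym (length-filter (λ p → g (proj₂ p) ≟ g (proj₁ p)) (cartesianProduct xs xs)) ⟩
      length (filter (λ p → g (proj₂ p) ≟ g (proj₁ p)) (cartesianProduct xs xs)) ∎
      where open ≡-Reasoning

    support : List Y → List Y
    support = deduplicate _≟_

    support-unique : ∀ ws → Unique (support ws)
    support-unique = DecUniqueₚ.deduplicate-! _≟_

    ∈-support : ∀ {ws w} → w ∈ ws → w ∈ support ws
    ∈-support = ∈-deduplicate⁺ _≟_

    mult-pos : ∀ {ws w} → w ∈ ws → 1 ≤ mult ws w
    mult-pos {ws} {w} w∈ = ≤-trans (≤-reflexive (sym (𝟙-yes (w ≟ w) refl))) (∑-∈ (λ v → 𝟙 (v ≟ w)) w∈)

    -- A superlevel set, not the shell between two powers of 2. An element then lies on several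
    -- levels, which only enlarges the upper bound in `∑-dyadic`.
    level : List Y → ℕ → List Y
    level ws i = filter (λ y → 2 ^ i ≤? mult ws y) (support ws)

    level-unique : ∀ ws i → Unique (level ws i)
    level-unique ws i = Uniqueₚ.filter⁺ (λ y → 2 ^ i ≤? mult ws y) (support-unique ws)

    ∈-level⁻ : ∀ ws i {y} → y ∈ level ws i → 2 ^ i ≤ mult ws y
    ∈-level⁻ ws i y∈ = proj₂ (∈-filter⁻ (λ y → 2 ^ i ≤? mult ws y) {xs = support ws} y∈)

    level-∑ : ∀ ws i → 2 ^ i * length (level ws i) ≤ ∑ (level ws i) (mult ws)
    level-∑ ws i = ≤-trans (≤-reflexive (trans (*-comm (2 ^ i) _) (sym (∑-const (level ws i) (2 ^ i)))))
      (∑-mono (∈-level⁻ ws i))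

    level-length : ∀ ws i → 2 ^ i * length (level ws i) ≤ length ws
    level-length ws i = ≤-trans (level-∑ ws i) (∑-mult-≤-length ws (level-unique ws i))

    dyadic-scale : ∀ k l → 1 ≤ k → k < 2 ^ l → ∃[ i ] i < l × 2 ^ i ≤ k × k ≤ 2 ^ suc i
    dyadic-scale k zero    1≤k k<1 = ⊥-elim (<⇒≱ k<1 1≤k)
    dyadic-scale k (suc l) 1≤k k<  with 2 ^ l ≤? k
    ... | yes 2^l≤k = l , ≤-refl , 2^l≤k , <⇒≤ k<
    ... | no  2^l≰k with dyadic-scale k l 1≤k (≰⇒> 2^l≰k)
    ... | i , i<l , lower , upper = i , m≤n⇒m≤1+n i<l , lower , upper

    -- Each `y` is charged to the one scale with 2^i ≤ `mult ws y` ≤ 2^(i+1). In the applications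
    -- `φ` is the first, second or third power, so replacing the multiplicity by 2^(i+1) costs a
    -- factor of at most 2, 4 or 8.
    ∑-dyadic : ∀ ws l (φ : ℕ → ℕ) (f : Y → ℕ) → (∀ {a b} → a ≤ b → φ a ≤ φ b) →
      (∀ {w} → mult ws w < 2 ^ l) →
      ∑ (support ws) (λ y → φ (mult ws y) * f y) ≤ ∑ (upTo l) (λ i → φ (2 ^ suc i) * ∑ (level ws i) f)
    ∑-dyadic ws l φ f φ-mono bounded = begin
      ∑ (support ws) (λ y → φ (mult ws y) * f y)
        ≤⟨ ∑-mono pointwise ⟩
      ∑ (support ws) (λ y → ∑ (upTo l) (λ i → φ (2 ^ suc i) * (𝟙 (2 ^ i ≤? mult ws y) * f y)))
        ≡⟨ ∑-swap (support ws) (upTo l) (λ y i → φ (2 ^ suc i) * (𝟙 (2 ^ i ≤? mult ws y) * f y)) ⟩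
      ∑ (upTo l) (λ i → ∑ (support ws) (λ y → φ (2 ^ suc i) * (𝟙 (2 ^ i ≤? mult ws y) * f y)))
        ≡⟨ ∑-cong (λ {i} _ → trans (∑-*ˡ (support ws) (φ (2 ^ suc i)) (λ y → 𝟙 (2 ^ i ≤? mult ws y) * f y))
             (cong (φ (2 ^ suc i) *_) (sym (∑-filter (λ y → 2 ^ i ≤? mult ws y) (support ws) f)))) ⟩
      ∑ (upTo l) (λ i → φ (2 ^ suc i) * ∑ (level ws i) f) ∎
      where
      open ≤-Reasoning
      pointwise : ∀ {y} → y ∈ support ws →
        φ (mult ws y) * f y ≤ ∑ (upTo l) (λ i → φ (2 ^ suc i) * (𝟙 (2 ^ i ≤? mult ws y) * f y))
      pointwise {y} y∈ with dyadic-scale (mult ws y) l (mult-pos (∈-deduplicate⁻ _≟_ ws y∈)) bounded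
      ... | i , i<l , lower , upper = begin
        φ (mult ws y) * f y
          ≤⟨ *-monoˡ-≤ (f y) (φ-mono upper) ⟩
        φ (2 ^ suc i) * f y
          ≡⟨ cong (φ (2 ^ suc i) *_) (trans (sym (*-identityˡ (f y)))
               (cong (_* f y) (sym (𝟙-yes (2 ^ i ≤? mult ws y) lower)))) ⟩
        φ (2 ^ suc i) * (𝟙 (2 ^ i ≤? mult ws y) * f y)
          ≤⟨ ∑-∈ (λ i → φ (2 ^ suc i) * (𝟙 (2 ^ i ≤? mult ws y) * f y)) (∈-upTo⁺ i<l) ⟩
        ∑ (upTo l) (λ i → φ (2 ^ suc i) * (𝟙 (2 ^ i ≤? mult ws y) * f y)) ∎

-- Inequalities between monomials, and the elimination that yields the exponent 46/29

module Monomials where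

  open import Data.Fin.Base using (Fin; zero; suc)
  open import Data.Nat.Base
  open import Data.Nat.Properties
  open Arithmetic using (^-distribʳ-*)
  open import Data.Nat.Tactic.RingSolver using (solve-∀)
  open import Data.Vec.Base using (Vec; []; _∷_; lookup; zipWith; replicate) renaming (map to mapᵛ)
  open import Data.Fin.Patterns
  open import Relation.Binary.PropositionalEquality

  infixl 7 _⊗_
  infixl 8 _↑_
  infix  8 2↑_

  -- Syntax for products of powers, in which all constants are powers of 2. Identities are checked
  -- by comparing exponent vectors, whose first coordinate belongs to the base 2, so a number such
  -- as 2^1191 is never evaluated.
  data Monomial (k : ℕ) : Set where
    var : Fin k → Monomial k
    2↑_ : ℕ → Monomial k
    _⊗_ : Monomial k → Monomial k → Monomial k
    _↑_ : Monomial k → ℕ → Monomial k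

  private
    variable
      k : ℕ

    unit : Fin k → Vec ℕ k
    unit zero    = 1 ∷ replicate _ 0
    unit (suc i) = 0 ∷ unit i

    power : Vec ℕ k → Vec ℕ k → ℕ
    power []       []       = 1
    power (x ∷ xs) (e ∷ es) = x ^ e * power xs es

    power-0 : ∀ (xs : Vec ℕ k) → power xs (replicate k 0) ≡ 1
    power-0 []       = refl
    power-0 (x ∷ xs) = trans (+-identityʳ _) (power-0 xs)

    power-unit : ∀ (xs : Vec ℕ k) i → power xs (unit i) ≡ lookup xs i
    power-unit (x ∷ xs) zero    = trans (cong (x * 1 *_) (power-0 xs)) (trans (*-identityʳ (x * 1)) (*-identityʳ x))
    power-unit (x ∷ xs) (suc i) = trans (+-identityʳ _) (power-unit xs i)

    power-+ : ∀ (xs es fs : Vec ℕ k) → power xs (zipWith _+_ es fs) ≡ power xs es * power xs fs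
    power-+ []       []       []       = refl
    power-+ (x ∷ xs) (e ∷ es) (f ∷ fs) = trans (cong₂ _*_ (^-distribˡ-+-* x e f) (power-+ xs es fs))
      (interchange (x ^ e) (x ^ f) (power xs es) (power xs fs))
      where
      interchange : ∀ a b c d → a * b * (c * d) ≡ a * c * (b * d)
      interchange = solve-∀

    power-* : ∀ e (xs es : Vec ℕ k) → power xs (mapᵛ (_* e) es) ≡ power xs es ^ e
    power-* e []       []       = sym (^-zeroˡ e)
    power-* e (x ∷ xs) (f ∷ es) = trans (cong₂ _*_ (sym (^-*-assoc x f e)) (power-* e xs es))
      (sym (^-distribʳ-* e (x ^ f) (power xs es)))

  exponents : Monomial k → Vec ℕ (suc k)
  exponents (var i) = 0 ∷ unit i
  exponents (2↑ e)  = e ∷ replicate _ 0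
  exponents (s ⊗ t) = zipWith _+_ (exponents s) (exponents t)
  exponents (s ↑ e) = mapᵛ (_* e) (exponents s)

  module Valuation {k : ℕ} (v : Vec ℕ k) where

    ⟦_⟧ : Monomial k → ℕ
    ⟦ var i ⟧ = lookup v i
    ⟦ 2↑ e ⟧  = 2 ^ e
    ⟦ s ⊗ t ⟧ = ⟦ s ⟧ * ⟦ t ⟧
    ⟦ s ↑ e ⟧ = ⟦ s ⟧ ^ e

    private
      ⟦⟧-exponents : ∀ t → ⟦ t ⟧ ≡ power (2 ∷ v) (exponents t)
      ⟦⟧-exponents (var i) = trans (sym (power-unit v i)) (sym (+-identityʳ _))
      ⟦⟧-exponents (2↑ e)  = trans (sym (*-identityʳ (2 ^ e))) (cong (2 ^ e *_) (sym (power-0 v)))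
      ⟦⟧-exponents (s ⊗ t) = trans (cong₂ _*_ (⟦⟧-exponents s) (⟦⟧-exponents t)) (sym (power-+ (2 ∷ v) (exponents s) (exponents t)))
      ⟦⟧-exponents (s ↑ e) = trans (cong (_^ e) (⟦⟧-exponents s)) (sym (power-* e (2 ∷ v) (exponents s)))

    infix 4 _≼_

    -- A record, so that the two monomials can be read off from the type of a proof; they could not
    -- be recovered from their values.
    record _≼_ (s t : Monomial k) : Set where
      constructor ≼-intro
      field holds : ⟦ s ⟧ ≤ ⟦ t ⟧

    open _≼_ public

    normalise : ∀ s t → exponents s ≡ exponents t → ⟦ s ⟧ ≡ ⟦ t ⟧
    normalise s t eq = trans (⟦⟧-exponents s) (trans (cong (power (2 ∷ v)) eq) (sym (⟦⟧-exponents t)))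

    ≼-pow : ∀ e {s t} → s ≼ t → s ↑ e ≼ t ↑ e
    ≼-pow e (≼-intro s≤t) = ≼-intro (^-monoˡ-≤ e s≤t)

    ≼-normal : ∀ {s t} s′ t′ → s ≼ t → exponents s′ ≡ exponents s → exponents t ≡ exponents t′ → s′ ≼ t′
    ≼-normal {s} {t} s′ t′ (≼-intro s≤t) p q =
      ≼-intro (≤-trans (≤-reflexive (normalise s′ s p)) (≤-trans s≤t (≤-reflexive (normalise t t′ q))))

    -- One elimination step: `g` completes the bound `t` to a product containing the e-th power of
    -- `u`, which is then replaced by the e-th power of its own bound `w`.
    ≼-substitute : ∀ e g h {s t u w} → s ≼ t → u ≼ w → exponents (t ⊗ g) ≡ exponents (h ⊗ u ↑ e) → s ⊗ g ≼ h ⊗ w ↑ e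
    ≼-substitute e g h {s} {t} {u} {w} (≼-intro s≤t) (≼-intro u≤w) eq = ≼-intro (begin
      ⟦ s ⟧ * ⟦ g ⟧      ≤⟨ *-monoˡ-≤ ⟦ g ⟧ s≤t ⟩
      ⟦ t ⟧ * ⟦ g ⟧      ≡⟨ normalise (t ⊗ g) (h ⊗ u ↑ e) eq ⟩
      ⟦ h ⟧ * ⟦ u ⟧ ^ e  ≤⟨ *-monoʳ-≤ ⟦ h ⟧ (^-monoˡ-≤ e u≤w) ⟩
      ⟦ h ⟧ * ⟦ w ⟧ ^ e  ∎)
      where open ≤-Reasoning

    ≼-cancel : ∀ {s t} c s′ t′ → s ≼ t → NonZero ⟦ c ⟧ → exponents s ≡ exponents (s′ ⊗ c) → exponents t ≡ exponents (t′ ⊗ c) → s′ ≼ t′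
    ≼-cancel {s} {t} c s′ t′ (≼-intro s≤t) c≢0 p q = ≼-intro (*-cancelʳ-≤ ⟦ s′ ⟧ ⟦ t′ ⟧ ⟦ c ⟧ {{c≢0}}
      (≤-trans (≤-reflexive (sym (normalise s (s′ ⊗ c) p))) (≤-trans s≤t (≤-reflexive (normalise t (t′ ⊗ c) q)))))

  -- Stated for arbitrary exponents so that closed powers are never unfolded.
  record PowerBound (a b c e n L m : ℕ) : Set where
    constructor power-bound-intro
    field bound : n ^ a ≤ 2 ^ b * L ^ c * m ^ e

  power-bound-mono : ∀ {a b c e n L m m′} → m ≤ m′ → PowerBound a b c e n L m → PowerBound a b c e n L m′
  power-bound-mono {b = b} {c} {e} {L = L} m≤m′ (power-bound-intro bound) =
    power-bound-intro (≤-trans bound (*-monoʳ-≤ (2 ^ b * L ^ c) (^-monoˡ-≤ e m≤m′)))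

  -- In the application `Δ` and `d` are the threshold and the size of the extremal level D, `W`
  -- counts popular differences and `Q` quadruples; `p`, `X` are scale and size of a level of B - D,
  -- `q`, `Y` of a level of B - B, and `j` counts the incidences between these two; `u`, `U` belong
  -- to the level that carries the additive energy. `f₁` is Cauchy-Schwarz, `f₂` the expansion of
  -- popular sums, `f₃` the dyadic decomposition, `f₄` the incidence bound, `f₈` and `f₁₁` the
  -- maximality of D, `f₉` the lower bound for the energy, and the others are moment bounds. The
  -- interpolations use the exponents 1/2, 1/3, 1/5, 1/6 and 1/15, which become integral in the 30th
  -- power of `f₁`.
  module Combination
    (L n m d Δ W Q p X q Y j u U : ℕ) .{{_ : NonZero n}} .{{_ : NonZero Δ}}
    (f₁ : (Δ * d * n) * (Δ * d * n) ≤ 4 * (W * (L * (4096 * (n * (n * n))))))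
    (f₂ : n * n * (n * n) * W ≤ (64 * m) * (64 * m) * Q)
    (f₃ : Q ≤ L * (2 * p * (L * (2 * q * j))))
    (f₄ : j * (j * j) ≤ 512 * (n * ((X * X) * (Y * Y))))
    (f₅ : p * X ≤ n * d)
    (f₆ : p * (p * p) * X ≤ 512 * (n * (d * d)))
    (f₇ : q * Y ≤ n * n)
    (f₈ : q ^ 12 * Y ^ 7 ≤ Δ ^ 12 * d ^ 7)
    (f₉ : n ^ 4 ≤ 16 * (m * (L * (2 * u * (2 * u) * U))))
    (f₁₀ : u * (u * u) * U ≤ 512 * (n * (n * n)))
    (f₁₁ : u ^ 12 * U ^ 7 ≤ Δ ^ 12 * d ^ 7)
    where

    open Valuation (L ∷ n ∷ m ∷ d ∷ Δ ∷ W ∷ Q ∷ p ∷ X ∷ q ∷ Y ∷ j ∷ u ∷ U ∷ [])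

    private
      pattern 10F = suc 9F
      pattern 11F = suc 10F
      pattern 12F = suc 11F
      pattern 13F = suc 12F

      L̂ n̂ m̂ d̂ Δ̂ Ŵ Q̂ p̂ X̂ q̂ Ŷ ĵ û Û : Monomial 14
      L̂ = var 0F
      n̂ = var 1F
      m̂ = var 2F
      d̂ = var 3F
      Δ̂ = var 4F
      Ŵ = var 5F
      Q̂ = var 6F
      p̂ = var 7F
      X̂ = var 8F
      q̂ = var 9F
      Ŷ = var 10F
      ĵ = var 11F
      û = var 12F
      Û = var 13F

      g₁ : (Δ̂ ⊗ d̂ ⊗ n̂) ⊗ (Δ̂ ⊗ d̂ ⊗ n̂) ≼ 2↑ 2 ⊗ (Ŵ ⊗ (L̂ ⊗ (2↑ 12 ⊗ (n̂ ⊗ (n̂ ⊗ n̂)))))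
      g₁ = ≼-intro f₁
      g₂ : n̂ ⊗ n̂ ⊗ (n̂ ⊗ n̂) ⊗ Ŵ ≼ (2↑ 6 ⊗ m̂) ⊗ (2↑ 6 ⊗ m̂) ⊗ Q̂
      g₂ = ≼-intro f₂
      g₃ : Q̂ ≼ L̂ ⊗ (2↑ 1 ⊗ p̂ ⊗ (L̂ ⊗ (2↑ 1 ⊗ q̂ ⊗ ĵ)))
      g₃ = ≼-intro f₃
      g₄ : ĵ ⊗ (ĵ ⊗ ĵ) ≼ 2↑ 9 ⊗ (n̂ ⊗ ((X̂ ⊗ X̂) ⊗ (Ŷ ⊗ Ŷ)))
      g₄ = ≼-intro f₄
      g₅ : p̂ ⊗ X̂ ≼ n̂ ⊗ d̂
      g₅ = ≼-intro f₅
      g₆ : p̂ ⊗ (p̂ ⊗ p̂) ⊗ X̂ ≼ 2↑ 9 ⊗ (n̂ ⊗ (d̂ ⊗ d̂))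
      g₆ = ≼-intro f₆
      g₇ : q̂ ⊗ Ŷ ≼ n̂ ⊗ n̂
      g₇ = ≼-intro f₇
      g₈ : q̂ ↑ 12 ⊗ Ŷ ↑ 7 ≼ Δ̂ ↑ 12 ⊗ d̂ ↑ 7
      g₈ = ≼-intro f₈
      g₉ : n̂ ↑ 4 ≼ 2↑ 4 ⊗ (m̂ ⊗ (L̂ ⊗ (2↑ 1 ⊗ û ⊗ (2↑ 1 ⊗ û) ⊗ Û)))
      g₉ = ≼-intro f₉
      g₁₀ : û ⊗ (û ⊗ û) ⊗ Û ≼ 2↑ 9 ⊗ (n̂ ⊗ (n̂ ⊗ n̂))
      g₁₀ = ≼-intro f₁₀
      g₁₁ : û ↑ 12 ⊗ Û ↑ 7 ≼ Δ̂ ↑ 12 ⊗ d̂ ↑ 7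
      g₁₁ = ≼-intro f₁₁

      one : Monomial 14
      one = 2↑ 0

      -- u⁵⁴ U²⁷ = (u¹² U⁷)³ (u³ U)⁶.
      energy : n̂ ↑ 108 ≼ 2↑ 216 ⊗ m̂ ↑ 27 ⊗ L̂ ↑ 27 ⊗ n̂ ↑ 18 ⊗ (Δ̂ ↑ 36 ⊗ d̂ ↑ 21)
      energy = ≼-normal _ _ s₂ refl refl
        where
        s₁ = ≼-substitute 3 one (2↑ 162 ⊗ m̂ ↑ 27 ⊗ L̂ ↑ 27 ⊗ û ↑ 18 ⊗ Û ↑ 6) (≼-pow 27 g₉) g₁₁ refl
        s₂ = ≼-substitute 6 one (2↑ 162 ⊗ m̂ ↑ 27 ⊗ L̂ ↑ 27 ⊗ (Δ̂ ↑ 36 ⊗ d̂ ↑ 21)) s₁ g₁₀ refl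

      -- p³⁰ X²⁰ = (p X)¹⁵ (p³ X)⁵ and q³⁰ Y²⁰ = (q Y)⁶ (q¹² Y⁷)².
      level-sets : n̂ ↑ 180 ⊗ Δ̂ ↑ 60 ⊗ d̂ ↑ 60 ≼ 2↑ 975 ⊗ L̂ ↑ 90 ⊗ n̂ ↑ 132 ⊗ d̂ ↑ 39 ⊗ Δ̂ ↑ 24 ⊗ m̂ ↑ 60
      level-sets = ≼-normal _ _ s₇ refl refl
        where
        s₁ = ≼-substitute 30 (n̂ ↑ 120) (2↑ 420 ⊗ L̂ ↑ 30 ⊗ n̂ ↑ 90) (≼-pow 30 g₁) g₂ refl
        s₂ = ≼-substitute 30 one (2↑ 780 ⊗ L̂ ↑ 30 ⊗ n̂ ↑ 90 ⊗ m̂ ↑ 60) s₁ g₃ refl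
        s₃ = ≼-substitute 10 one (2↑ 840 ⊗ L̂ ↑ 90 ⊗ n̂ ↑ 90 ⊗ m̂ ↑ 60 ⊗ p̂ ↑ 30 ⊗ q̂ ↑ 30) s₂ g₄ refl
        s₄ = ≼-substitute 15 one (2↑ 930 ⊗ L̂ ↑ 90 ⊗ n̂ ↑ 100 ⊗ m̂ ↑ 60 ⊗ p̂ ↑ 15 ⊗ X̂ ↑ 5 ⊗ q̂ ↑ 30 ⊗ Ŷ ↑ 20) s₃ g₅ refl
        s₅ = ≼-substitute 5 one (2↑ 930 ⊗ L̂ ↑ 90 ⊗ n̂ ↑ 115 ⊗ m̂ ↑ 60 ⊗ d̂ ↑ 15 ⊗ q̂ ↑ 30 ⊗ Ŷ ↑ 20) s₄ g₆ refl
        s₆ = ≼-substitute 6 one (2↑ 975 ⊗ L̂ ↑ 90 ⊗ n̂ ↑ 120 ⊗ m̂ ↑ 60 ⊗ d̂ ↑ 25 ⊗ q̂ ↑ 24 ⊗ Ŷ ↑ 14) s₅ g₇ refl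
        s₇ = ≼-substitute 2 one (2↑ 975 ⊗ L̂ ↑ 90 ⊗ n̂ ↑ 132 ⊗ m̂ ↑ 60 ⊗ d̂ ↑ 25) s₆ g₈ refl

      -- `energy` bounds a power of the positive number `n` by a multiple of `d`, so the extremal
      -- level cannot be empty.
      d≢0 : NonZero d
      d≢0 = ≢-nonZero λ d≡0 → n≮0 (<-≤-trans (>-nonZero⁻¹ (n ^ 108) {{m^n≢0 n 108}})
        (≤-trans (holds energy) (≤-reflexive (vanish d≡0))))
        where
        vanish : d ≡ 0 → ⟦ 2↑ 216 ⊗ m̂ ↑ 27 ⊗ L̂ ↑ 27 ⊗ n̂ ↑ 18 ⊗ (Δ̂ ↑ 36 ⊗ d̂ ↑ 21) ⟧ ≡ 0
        vanish d≡0 = trans (cong (⟦ 2↑ 216 ⊗ m̂ ↑ 27 ⊗ L̂ ↑ 27 ⊗ n̂ ↑ 18 ⟧ *_)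
          (trans (cong (λ d → Δ ^ 36 * d ^ 21) d≡0) (*-zeroʳ (Δ ^ 36)))) (*-zeroʳ ⟦ 2↑ 216 ⊗ m̂ ↑ 27 ⊗ L̂ ↑ 27 ⊗ n̂ ↑ 18 ⟧)

      -- The unknowns `Δ` and `d` are left in the combination (Δ^12 d^7)³, the power in which they
      -- occur in `energy`. The ninth power of `f₉` would clear the denominators there; the 27th is
      -- taken so that the two fit together.
      extremal : n̂ ↑ 48 ⊗ (Δ̂ ↑ 36 ⊗ d̂ ↑ 21) ≼ 2↑ 975 ⊗ L̂ ↑ 90 ⊗ m̂ ↑ 60
      extremal = ≼-cancel (n̂ ↑ 132 ⊗ (Δ̂ ↑ 24 ⊗ d̂ ↑ 39)) _ _ level-sets
        (m*n≢0 (n ^ 132) (Δ ^ 24 * d ^ 39) {{m^n≢0 n 132}} {{m*n≢0 (Δ ^ 24) (d ^ 39) {{m^n≢0 Δ 24}} {{m^n≢0 d 39 {{d≢0}}}}}}) refl refl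

      -- 138 = 3 · 46 and 87 = 3 · 29. The constant and the logarithm collect 1191 = 216 + 975 and
      -- 117 = 27 + 90 from the two estimates.
      final : n̂ ↑ 138 ≼ 2↑ 1191 ⊗ L̂ ↑ 117 ⊗ m̂ ↑ 87
      final = ≼-cancel (n̂ ↑ 18) _ _ s₁ (m^n≢0 n 18) refl refl
        where
        s₁ = ≼-substitute 1 (n̂ ↑ 48) (2↑ 216 ⊗ m̂ ↑ 27 ⊗ L̂ ↑ 27 ⊗ n̂ ↑ 18) energy extremal refl

    combination : PowerBound 138 1191 117 87 n L m
    combination = to-bound final
      where
      to-bound : ∀ {a b c e} → n̂ ↑ a ≼ 2↑ b ⊗ L̂ ↑ c ⊗ m̂ ↑ e → PowerBound a b c e n L m
      to-bound (≼-intro bound) = power-bound-intro bound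

-- Incidences with a convex set of integers

module Incidence where

  open import Data.Integer.Base as ℤ using (ℤ)
  open import Data.List.Base using (List; []; _∷_; _++_; length; map; filter; cartesianProduct; upTo)
  open import Data.List.Membership.Propositional using (_∈_; find; lose)
  open import Data.List.Relation.Unary.Unique.Propositional using (Unique)
  open import Data.Nat.Base
  open import Relation.Binary.PropositionalEquality hiding (J)

  -- `idx` is the position in `A` in increasing order. Convexity enters only through `idx-convex`: a
  -- nonzero difference v′ - v together with its index distance determines v. Both equalities are
  -- written with sums, which avoids subtraction in ℕ.
  module ConvexSets
    (A : List ℤ) (idx : ℤ → ℕ)
    (idx-mono : ∀ {v w} → v ∈ A → w ∈ A → v ℤ.< w → idx v < idx w)
    (idx-< : ∀ {v} → v ∈ A → idx v < length A)
    (idx-convex : ∀ {v v′ w w′} → v ∈ A → v′ ∈ A → w ∈ A → w′ ∈ A → v ≢ v′ →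
                  v′ ℤ.+ w ≡ v ℤ.+ w′ → idx v′ + idx w ≡ idx v + idx w′ → v ≡ w)
    where

    open Arithmetic using (same-quotient-<)
    open Counting
    open Monomials
    open import Data.Empty using (⊥-elim)
    import Data.Integer.Properties as ℤₚ
    import Algebra.Properties.AbelianGroup ℤₚ.+-0-abelianGroup as ℤ-Group
    import Data.Integer.Tactic.RingSolver as ℤ-Ring
    open import Data.List.Membership.DecPropositional ℤₚ._≟_ using (_∈?_)
    open import Data.List.Membership.Propositional.Properties using (∈-++⁺ˡ; ∈-++⁺ʳ; ∈-filter⁺; ∈-filter⁻; ∈-upTo⁺; ∈-map⁺; ∈-map⁻; ∈-cartesianProduct⁺; ∈-cartesianProduct⁻)
    open import Data.List.Properties using (length-++; length-upTo; length-map)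
    open import Data.List.Relation.Unary.Any using (here; there; any?)
    import Data.List.Relation.Unary.All as All
    open import Data.List.Relation.Unary.AllPairs using ([]; _∷_)
    open import Data.List.Relation.Unary.Unique.Propositional using (Unique)
    import Data.List.Relation.Unary.Unique.Propositional.Properties as Uniqueₚ
    open import Data.Nat.DivMod
    open import Data.Nat.Properties hiding (_≟_)
    open import Data.Nat.Tactic.RingSolver using (solve-∀)
    open import Data.Product.Base using (∃-syntax; _×_; _,_; proj₁; proj₂)
    open import Data.Product.Properties using (≡-dec)
    open import Data.Sum.Base using (_⊎_; inj₁; inj₂)
    open import Function.Base using (_∘_)
    open import Relation.Binary.Definitions using (DecidableEquality; tri<; tri≈; tri>)
    open import Relation.Nullary using (¬_; Dec; yes; no)
    open import Relation.Nullary.Decidable using (¬?; _×-dec_)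
    open import Relation.Unary using (Decidable)

    private
      n = length A

    J : List ℤ → List ℤ → ℕ
    J Z Y = ∑ Z (λ z → ∑ Y (λ y → 𝟙 (z ℤ.+ y ∈? A)))

    incidence? : Decidable (λ (p : ℤ × ℤ) → proj₁ p ℤ.+ proj₂ p ∈ A)
    incidence? p = proj₁ p ℤ.+ proj₂ p ∈? A

    incidences : List ℤ → List ℤ → List (ℤ × ℤ)
    incidences Z Y = filter incidence? (cartesianProduct Z Y)

    length-incidences : ∀ Z Y → length (incidences Z Y) ≡ J Z Y
    length-incidences Z Y = trans (length-filter incidence? (cartesianProduct Z Y))
      (∑-× Z Y (λ p → 𝟙 (incidence? p)))

    ∈-incidences⁻ : ∀ Z Y {z y} → (z , y) ∈ incidences Z Y → z ∈ Z × y ∈ Y × z ℤ.+ y ∈ A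
    ∈-incidences⁻ Z Y p∈ =
      let p∈× , zy∈A = ∈-filter⁻ incidence? {xs = cartesianProduct Z Y} p∈
          z∈ , y∈ = ∈-cartesianProduct⁻ Z Y p∈×
      in z∈ , y∈ , zy∈A

    ∑-translate-≤ : ∀ z {Y} → Unique Y → ∑ Y (λ y → 𝟙 (z ℤ.+ y ∈? A)) ≤ n
    ∑-translate-≤ z {Y} uniq = ≤-trans (≤-reflexive (sym (length-filter (λ y → z ℤ.+ y ∈? A) Y)))
      (injection (λ y → z ℤ.+ y) (Uniqueₚ.filter⁺ (λ y → z ℤ.+ y ∈? A) uniq)
        (λ y∈ → proj₂ (∈-filter⁻ (λ y → z ℤ.+ y ∈? A) {xs = Y} y∈)) (λ _ _ → ℤ-Group.∙-cancelˡ z _ _))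

    J≤Z*n : ∀ Z {Y} → Unique Y → J Z Y ≤ length Z * n
    J≤Z*n Z uniq = ∑-≤-max Z _ n (λ {z} _ → ∑-translate-≤ z uniq)

    J-comm : ∀ Z Y → J Z Y ≡ J Y Z
    J-comm Z Y = trans (∑-swap Z Y (λ z y → 𝟙 (z ℤ.+ y ∈? A)))
      (∑-cong λ {y} _ → ∑-cong λ {z} _ → cong (λ v → 𝟙 (v ∈? A)) (ℤₚ.+-comm z y))

    J≤Z*Y : ∀ Z Y → J Z Y ≤ length Z * length Y
    J≤Z*Y Z Y = ∑-≤-max Z _ (length Y) (λ {z} _ → ≤-trans
      (∑-mono {g = λ _ → 1} (λ {y} _ → 𝟙≤1 (z ℤ.+ y ∈? A))) (≤-reflexive (∑-one Y)))
      where
      𝟙≤1 : {P : Set} (d : Dec P) → 𝟙 d ≤ 1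
      𝟙≤1 (yes _) = ≤-refl
      𝟙≤1 (no _)  = z≤n

    -- The position of `z` in a sorted copy of `Z`, without sorting.
    rank : List ℤ → ℤ → ℕ
    rank Z z = length (filter (ℤₚ._<? z) Z)

    module _ {Z : List ℤ} (Z-unique : Unique Z) {z : ℤ} (z∈ : z ∈ Z) where

      private
        z∷below-unique : Unique (z ∷ filter (ℤₚ._<? z) Z)
        z∷below-unique = All.tabulate (λ w∈ z≡w →
            ℤₚ.<-irrefl (sym z≡w) (proj₂ (∈-filter⁻ (ℤₚ._<? z) {xs = Z} w∈)))
          ∷ Uniqueₚ.filter⁺ (ℤₚ._<? z) Z-unique

      rank-< : rank Z z < length Z
      rank-< = injection (λ w → w) z∷below-unique
        (λ { (here refl) → z∈ ; (there w∈) → proj₁ (∈-filter⁻ (ℤₚ._<? z) {xs = Z} w∈) }) (λ _ _ eq → eq)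

      rank-mono : ∀ {z′} → z ℤ.< z′ → rank Z z < rank Z z′
      rank-mono {z′} z<z′ = injection (λ w → w) z∷below-unique
        (λ { (here refl) → ∈-filter⁺ (ℤₚ._<? z′) z∈ z<z′
           ; (there w∈) → let w∈Z , w<z = ∈-filter⁻ (ℤₚ._<? z) {xs = Z} w∈
                          in ∈-filter⁺ (ℤₚ._<? z′) w∈Z (ℤₚ.<-trans w<z z<z′) }) (λ _ _ eq → eq)

    rank-injective : ∀ {Z} → Unique Z → ∀ {z z′} → z ∈ Z → z′ ∈ Z → rank Z z ≡ rank Z z′ → z ≡ z′
    rank-injective uniq {z} {z′} z∈ z′∈ eq with ℤₚ.<-cmp z z′
    ... | tri< z<z′ _ _ = ⊥-elim (<-irrefl eq (rank-mono uniq z∈ z<z′))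
    ... | tri≈ _ z≡z′ _ = z≡z′
    ... | tri> _ _ z′<z = ⊥-elim (<-irrefl (sym eq) (rank-mono uniq z′∈ z′<z))

    +-equality : ∀ {a a′ b b′} → a ≤ a′ → b ≤ b′ → a + b ≡ a′ + b′ → a ≡ a′ × b ≡ b′
    +-equality {a} {a′} {b} {b′} a≤a′ b≤b′ eq = a≡a′ , +-cancelˡ-≡ a b b′ (trans eq (cong (_+ b′) (sym a≡a′)))
      where
      a≡a′ : a ≡ a′
      a≡a′ = ≤-antisym a≤a′ (+-cancelʳ-≤ b a′ a (≤-trans (+-monoʳ-≤ a′ b≤b′) (≤-reflexive (sym eq))))

    -- For fixed y the incidences (z , y), ordered by z, run monotonically through a t × t grid whose
    -- cells are blocks of k consecutive elements of A times blocks of l consecutive elements of Z, so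
    -- they meet fewer than 2t cells.  Two of them in one cell are determined by the two values of z
    -- and the distance of the two elements of A, since A is convex.
    module Cells {Z Y : List ℤ} (Z-unique : Unique Z) (Y-unique : Unique Y)
      (t k l : ℕ) .{{_ : NonZero k}} .{{_ : NonZero l}}
      (A-covered : n ≤ t * k) (Z-covered : length Z ≤ t * l) where

      private
        -- For fixed `y` both block numbers are nondecreasing in `z`, so by `+-equality` their sum
        -- already names the cell. The sum takes fewer than 2t values, where the pair could take t².
        diagonal : ℤ → ℤ → ℕ
        diagonal z y = idx (z ℤ.+ y) / k + rank Z z / l

        cell : ℤ × ℤ → ℤ × ℕ
        cell (z , y) = y , diagonal z y

        _≟ᶜ_ : DecidableEquality (ℤ × ℕ)
        _≟ᶜ_ = ≡-dec ℤₚ._≟_ Data.Nat.Properties._≟_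

        open Multiplicity _≟ᶜ_

        cells : List (ℤ × ℕ)
        cells = cartesianProduct Y (upTo (t + t))

        into-cells : ∀ {w} → w ∈ map cell (incidences Z Y) → w ∈ cells
        into-cells w∈ with ∈-map⁻ cell w∈
        ... | (z , y) , p∈ , refl with ∈-incidences⁻ Z Y p∈
        ... | z∈ , y∈ , zy∈A = ∈-cartesianProduct⁺ y∈ (∈-upTo⁺ (+-mono-<
          (m<n*o⇒m/o<n {n = t} (<-≤-trans (idx-< zy∈A) A-covered))
          (m<n*o⇒m/o<n {n = t} (<-≤-trans (rank-< Z-unique z∈) Z-covered))))

        same-cell : ∀ {z z′ y} → z ∈ Z → z′ ∈ Z → z ℤ.+ y ∈ A → z′ ℤ.+ y ∈ A →
          diagonal z y ≡ diagonal z′ y →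
          idx (z ℤ.+ y) / k ≡ idx (z′ ℤ.+ y) / k × rank Z z / l ≡ rank Z z′ / l
        same-cell {z} {z′} {y} z∈ z′∈ zy∈ z′y∈ eq with ℤₚ.<-cmp z z′
        ... | tri< z<z′ _ _ = +-equality
          (/-monoˡ-≤ k (<⇒≤ (idx-mono zy∈ z′y∈ (ℤₚ.+-monoˡ-< y z<z′))))
          (/-monoˡ-≤ l (<⇒≤ (rank-mono Z-unique z∈ z<z′))) eq
        ... | tri≈ _ refl _ = refl , refl
        ... | tri> _ _ z′<z =
          let p , q = +-equality
                (/-monoˡ-≤ k (<⇒≤ (idx-mono z′y∈ zy∈ (ℤₚ.+-monoˡ-< y z′<z))))
                (/-monoˡ-≤ l (<⇒≤ (rank-mono Z-unique z′∈ z′<z))) (sym eq)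
          in sym p , sym q

        Code : Set
        Code = (ℤ × ℤ) ⊎ (ℤ × (ℕ × ℕ))

        -- If z = z′ the incidence itself is kept. Otherwise `y` is forgotten: `z` fixes the block
        -- of `z′`, the remainder fixes `z′` in it, and convexity recovers `y` from the index
        -- distance. The distance lies strictly between -k and k, so adding `k` makes the truncated
        -- subtraction exact and puts it into [0, 2k).
        encode : ∀ {z z′ : ℤ} → Dec (z ≡ z′) → ℤ → ℤ → Code
        encode {z} {z′} (yes _) y y′ = inj₁ (z , y)
        encode {z} {z′} (no  _) y y′ = inj₂ (z , rank Z z′ % l , idx (z′ ℤ.+ y′) + k ∸ idx (z ℤ.+ y))

        code : (ℤ × ℤ) × (ℤ × ℤ) → Code
        code ((z , y) , (z′ , y′)) = encode (z ℤₚ.≟ z′) y y′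

        codes : List Code
        codes = map inj₁ (incidences Z Y) ++
                map inj₂ (cartesianProduct Z (cartesianProduct (upTo l) (upTo (k + k))))

        colliding? : Decidable (λ (p : (ℤ × ℤ) × (ℤ × ℤ)) → cell (proj₂ p) ≡ cell (proj₁ p))
        colliding? p = cell (proj₂ p) ≟ᶜ cell (proj₁ p)

        colliding : List ((ℤ × ℤ) × (ℤ × ℤ))
        colliding = filter colliding? (cartesianProduct (incidences Z Y) (incidences Z Y))

        record Collision (z y z′ y′ : ℤ) : Set where
          field
            z∈ : z ∈ Z
            z′∈ : z′ ∈ Z
            zy∈ : z ℤ.+ y ∈ A
            z′y∈ : z′ ℤ.+ y ∈ A
            incident : (z , y) ∈ incidences Z Y
            y′≡y : y′ ≡ y
            same-A : idx (z ℤ.+ y) / k ≡ idx (z′ ℤ.+ y) / k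
            same-Z : rank Z z / l ≡ rank Z z′ / l

        collision : ∀ {z y z′ y′} → ((z , y) , (z′ , y′)) ∈ colliding → Collision z y z′ y′
        collision {z} {y} {z′} {y′} p∈ with ∈-filter⁻ colliding? {xs = cartesianProduct (incidences Z Y) (incidences Z Y)} p∈
        ... | p∈× , eq with ∈-cartesianProduct⁻ (incidences Z Y) (incidences Z Y) p∈× | cong proj₁ eq
        ... | i∈ , i′∈ | refl with ∈-incidences⁻ Z Y i∈ | ∈-incidences⁻ Z Y i′∈
        ... | z∈ , _ , zy∈ | z′∈ , _ , z′y∈ with same-cell z∈ z′∈ zy∈ z′y∈ (sym (cong proj₂ eq))
        ... | p , q = record { z∈ = z∈ ; z′∈ = z′∈ ; zy∈ = zy∈ ; z′y∈ = z′y∈ ; incident = i∈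
                             ; y′≡y = refl ; same-A = p ; same-Z = q }

        code∈ : ∀ {p} → p ∈ colliding → code p ∈ codes
        code∈ {(z , y) , (z′ , y′)} p∈ = go (z ℤₚ.≟ z′) (collision p∈)
          where
          go : (d : Dec (z ≡ z′)) → Collision z y z′ y′ → encode d y y′ ∈ codes
          go (yes _) c = ∈-++⁺ˡ (∈-map⁺ inj₁ (Collision.incident c))
          go (no  _) record { z∈ = z∈ ; y′≡y = refl ; same-A = same-A } = ∈-++⁺ʳ (map inj₁ (incidences Z Y))
            (∈-map⁺ inj₂ (∈-cartesianProduct⁺ z∈ (∈-cartesianProduct⁺ (∈-upTo⁺ (m%n<n (rank Z z′) l))
              (∈-upTo⁺ (m<n+o⇒m∸n<o _ (idx (z ℤ.+ y)) (begin-strict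
                idx (z′ ℤ.+ y) + k           <⟨ +-monoˡ-< k (same-quotient-< (idx (z′ ℤ.+ y)) (idx (z ℤ.+ y)) k (sym same-A)) ⟩
                idx (z ℤ.+ y) + k + k        ≡⟨ +-assoc (idx (z ℤ.+ y)) k k ⟩
                idx (z ℤ.+ y) + (k + k)      ∎))))))
            where
            open ≤-Reasoning
            instance
              k+k≢0 : NonZero (k + k)
              k+k≢0 = >-nonZero (<-≤-trans (>-nonZero⁻¹ k) (m≤m+n k k))

        rank-from-cell : ∀ {z z₁ z₂} → z₁ ∈ Z → z₂ ∈ Z → rank Z z / l ≡ rank Z z₁ / l → rank Z z / l ≡ rank Z z₂ / l →
          rank Z z₁ % l ≡ rank Z z₂ % l → z₁ ≡ z₂
        rank-from-cell {z} {z₁} {z₂} z₁∈ z₂∈ q₁ q₂ r = rank-injective Z-unique z₁∈ z₂∈ (begin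
          rank Z z₁                               ≡⟨ m≡m%n+[m/n]*n (rank Z z₁) l ⟩
          rank Z z₁ % l + rank Z z₁ / l * l       ≡⟨ cong₂ (λ a b → a + b * l) r (trans (sym q₁) q₂) ⟩
          rank Z z₂ % l + rank Z z₂ / l * l       ≡⟨ sym (m≡m%n+[m/n]*n (rank Z z₂) l) ⟩
          rank Z z₂                               ∎)
          where open ≡-Reasoning

        offset-injective : ∀ {i i′ j j′} → i < i′ + k → j < j′ + k → i′ + k ∸ i ≡ j′ + k ∸ j → i′ + j ≡ i + j′
        offset-injective {i} {i′} {j} {j′} i< j< eq = +-cancelʳ-≡ k (i′ + j) (i + j′) (begin
          i′ + j + k               ≡⟨ swap i′ j k ⟩
          i′ + k + j               ≡⟨ cong (_+ j) (sym (m∸n+n≡m (<⇒≤ i<))) ⟩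
          i′ + k ∸ i + i + j       ≡⟨ cong (λ d → d + i + j) eq ⟩
          j′ + k ∸ j + i + j       ≡⟨ swap (j′ + k ∸ j) i j ⟩
          j′ + k ∸ j + j + i       ≡⟨ cong (_+ i) (m∸n+n≡m (<⇒≤ j<)) ⟩
          j′ + k + i               ≡⟨ rotate j′ k i ⟩
          i + j′ + k               ∎)
          where
          open ≡-Reasoning
          swap : ∀ a b c → a + b + c ≡ a + c + b
          swap = solve-∀
          rotate : ∀ a b c → a + b + c ≡ c + a + b
          rotate = solve-∀

        code-injective : ∀ {p q} → p ∈ colliding → q ∈ colliding → code p ≡ code q → p ≡ q
        code-injective {(z , y) , (z′ , y′)} {(w , x) , (w′ , x′)} p∈ q∈ = go (z ℤₚ.≟ z′) (w ℤₚ.≟ w′) (collision p∈) (collision q∈)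
          where
          go : (d : Dec (z ≡ z′)) (e : Dec (w ≡ w′)) → Collision z y z′ y′ → Collision w x w′ x′ →
               encode d y y′ ≡ encode e x x′ → ((z , y) , (z′ , y′)) ≡ ((w , x) , (w′ , x′))
          go (yes refl) (yes refl) record { y′≡y = refl } record { y′≡y = refl } refl = refl
          go (no z≢z′) (no _) c@record { y′≡y = refl } d@record { y′≡y = refl } eq
            with inj₂-injective eq
            where
            inj₂-injective : ∀ {a b : ℤ × (ℕ × ℕ)} → inj₂ {A = ℤ × ℤ} a ≡ inj₂ b → a ≡ b
            inj₂-injective refl = refl
          ... | eq′ with cong proj₁ eq′
          ... | refl with rank-from-cell (Collision.z′∈ c) (Collision.z′∈ d) (Collision.same-Z c) (Collision.same-Z d)
                            (cong (proj₁ ∘ proj₂) eq′)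
          -- The pairs z + y, z′ + y and z + x, z′ + x have the same nonzero difference and the same
          -- index distance in `A`, hence the same first element.
          ... | refl with ℤ-Group.∙-cancelˡ z y x (idx-convex {z ℤ.+ y} {z′ ℤ.+ y} {z ℤ.+ x} {z′ ℤ.+ x}
                            (Collision.zy∈ c) (Collision.z′y∈ c) (Collision.zy∈ d) (Collision.z′y∈ d)
                            (λ e → z≢z′ (ℤ-Group.∙-cancelʳ y z z′ e)) (parallelogram z z′ y x)
                            (offset-injective
                              (same-quotient-< _ _ k (Collision.same-A c))
                              (same-quotient-< _ _ k (Collision.same-A d))
                              (cong (proj₂ ∘ proj₂) eq′)))
            where
            parallelogram : ∀ z z′ y x → (z′ ℤ.+ y) ℤ.+ (z ℤ.+ x) ≡ (z ℤ.+ y) ℤ.+ (z′ ℤ.+ x)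
            parallelogram = ℤ-Ring.solve-∀
          ... | refl = refl

        incidences-unique : Unique (incidences Z Y)
        incidences-unique = Uniqueₚ.filter⁺ incidence? (Uniqueₚ.cartesianProduct⁺ Z-unique Y-unique)

        length-codes : length codes ≡ J Z Y + length Z * (l * (k + k))
        length-codes = trans (length-++ (map inj₁ (incidences Z Y))) (cong₂ _+_
          (trans (length-map inj₁ (incidences Z Y)) (length-incidences Z Y))
          (trans (length-map inj₂ (cartesianProduct Z (cartesianProduct (upTo l) (upTo (k + k)))))
            (trans (length-× Z _) (cong (length Z *_)
              (trans (length-× (upTo l) _) (cong₂ _*_ (length-upTo l) (length-upTo (k + k))))))))

      -- Cauchy-Schwarz over |Y| · 2t cells. The coincidences are coded by the incidences themselves
      -- (the case z = z′) or by |Z| · l · 2k further codes.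
      J²-bound : J Z Y * J Z Y ≤ length Y * (t + t) * (J Z Y + length Z * (l * (k + k)))
      J²-bound = begin
        J Z Y * J Z Y
          ≡⟨ sym (cong₂ _*_ len len) ⟩
        length ws * length ws
          ≤⟨ collisions-bound ws (Uniqueₚ.cartesianProduct⁺ Y-unique (Uniqueₚ.upTo⁺ (t + t))) into-cells ⟩
        length cells * collisions ws
          ≡⟨ cong₂ _*_ (trans (length-× Y (upTo (t + t))) (cong (length Y *_) (length-upTo (t + t))))
               (collisions-map cell (incidences Z Y)) ⟩
        length Y * (t + t) * length colliding
          ≤⟨ *-monoʳ-≤ (length Y * (t + t)) (injection code
               (Uniqueₚ.filter⁺ colliding? (Uniqueₚ.cartesianProduct⁺ incidences-unique incidences-unique))
               code∈ code-injective) ⟩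
        length Y * (t + t) * length codes
          ≡⟨ cong (length Y * (t + t) *_) length-codes ⟩
        length Y * (t + t) * (J Z Y + length Z * (l * (k + k))) ∎
        where
        open ≤-Reasoning
        ws = map cell (incidences Z Y)
        len : length ws ≡ J Z Y
        len = trans (length-map cell (incidences Z Y)) (length-incidences Z Y)

    private
      ceiling-covers : ∀ m t .{{_ : NonZero t}} → m ≤ t * suc (m / t)
      ceiling-covers m t = begin
        m                  ≡⟨ m≡m%n+[m/n]*n m t ⟩
        m % t + m / t * t  ≤⟨ +-monoˡ-≤ (m / t * t) (<⇒≤ (m%n<n m t)) ⟩
        t + m / t * t      ≡⟨ *-comm (suc (m / t)) t ⟩
        t * suc (m / t)    ∎
        where open ≤-Reasoning

      ceiling-≤ : ∀ m t .{{_ : NonZero t}} → t ≤ m → t * suc (m / t) ≤ 2 * m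
      ceiling-≤ m t t≤m = begin
        t * suc (m / t)    ≡⟨ *-comm t (suc (m / t)) ⟩
        t + m / t * t      ≤⟨ +-mono-≤ t≤m (m/n*n≤m m t) ⟩
        m + m              ≡⟨ cong (m +_) (sym (+-identityʳ m)) ⟩
        2 * m              ∎
        where open ≤-Reasoning

      m≤m*m : ∀ m → m ≤ m * m
      m≤m*m zero    = z≤n
      m≤m*m (suc m) = m≤m+n (suc m) (m * suc m)

    -- The number t of blocks is chosen so that the diagonal term of J²-bound is half the left side.
    J³-bound : ∀ {Z Y} → Unique Z → Unique Y →
      J Z Y * (J Z Y * J Z Y) ≤ 512 * (n * ((length Z * length Z) * (length Y * length Y)))
    J³-bound {Z} {Y} Z-unique Y-unique = bound (length Y) refl
      where
      open ≤-Reasoning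
      j = J Z Y
      c = length Z
      bound : ∀ d → length Y ≡ d → j * (j * j) ≤ 512 * (n * ((c * c) * (d * d)))
      bound zero Y≡0 = ≤-trans (≤-reflexive (cong (λ k → k * (k * k)) j≡0)) z≤n
        where
        j≡0 : j ≡ 0
        j≡0 = n≤0⇒n≡0 (≤-trans (J≤Z*Y Z Y) (≤-reflexive (trans (cong (c *_) Y≡0) (*-zeroʳ c))))
      bound d@(suc _) Y≡d = by-t (j / (4 * d)) refl
        where
        j<4d[1+t] : ∀ t → j / (4 * d) ≡ t → j < suc t * (4 * d)
        j<4d[1+t] t refl = m<[1+n]*o j (4 * d)
          where
          m<[1+n]*o : ∀ m o .{{_ : NonZero o}} → m < suc (m / o) * o
          m<[1+n]*o m o = ≤-<-trans (≤-reflexive (m≡m%n+[m/n]*n m o)) (+-monoˡ-< (m / o * o) (m%n<n m o))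
        by-t : ∀ t → j / (4 * d) ≡ t → j * (j * j) ≤ 512 * (n * ((c * c) * (d * d)))
        by-t zero t≡0 = begin
          j * (j * j)                                   ≤⟨ *-mono-≤ (J≤Z*n Z Y-unique) (*-mono-≤ j≤4d j≤4d) ⟩
          c * n * ((1 * (4 * d)) * (1 * (4 * d)))       ≤⟨ *-monoˡ-≤ _ (*-monoˡ-≤ n (m≤m*m c)) ⟩
          c * c * n * ((1 * (4 * d)) * (1 * (4 * d)))   ≡⟨ regroup c n d ⟩
          16 * (n * ((c * c) * (d * d)))                ≤⟨ *-monoˡ-≤ (n * ((c * c) * (d * d))) (m≤m+n 16 496) ⟩
          512 * (n * ((c * c) * (d * d)))               ∎
          where
          j≤4d : j ≤ 1 * (4 * d)
          j≤4d = <⇒≤ (j<4d[1+t] 0 t≡0)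
          regroup : ∀ c n d → c * c * n * ((1 * (4 * d)) * (1 * (4 * d))) ≡ 16 * (n * ((c * c) * (d * d)))
          regroup = solve-∀
        by-t t@(suc _) t≡ = begin
          j * (j * j)                               ≤⟨ *-monoʳ-≤ j (*-mono-≤ j≤8td j≤8td) ⟩
          j * ((8 * (t * d)) * (8 * (t * d)))       ≡⟨ regroup j t d ⟩
          64 * (d * d) * (t * t * j)                ≤⟨ *-monoʳ-≤ (64 * (d * d)) t²j≤ ⟩
          64 * (d * d) * (8 * (n * (c * c)))        ≡⟨ collect d n c ⟩
          512 * (n * ((c * c) * (d * d)))           ∎
          where
          regroup : ∀ j t d → j * ((8 * (t * d)) * (8 * (t * d))) ≡ 64 * (d * d) * (t * t * j)
          regroup = solve-∀
          collect : ∀ d n c → 64 * (d * d) * (8 * (n * (c * c))) ≡ 512 * (n * ((c * c) * (d * d)))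
          collect = solve-∀
          4td≤j : t * (4 * d) ≤ j
          4td≤j = ≤-trans (≤-reflexive (cong (_* (4 * d)) (sym t≡))) (m/n*n≤m j (4 * d))
          td≤j : t * d ≤ j
          td≤j = ≤-trans (*-monoʳ-≤ t (m≤m+n d (3 * d))) 4td≤j
          j≤8td : j ≤ 8 * (t * d)
          j≤8td = begin
            j                    ≤⟨ <⇒≤ (j<4d[1+t] t t≡) ⟩
            suc t * (4 * d)      ≤⟨ *-monoˡ-≤ (4 * d) (+-monoˡ-≤ t (>-nonZero⁻¹ t)) ⟩
            (t + t) * (4 * d)    ≡⟨ dbl t d ⟩
            8 * (t * d)          ∎
            where
            dbl : ∀ t d → (t + t) * (4 * d) ≡ 8 * (t * d)
            dbl = solve-∀
          -- With t ≤ n and t ≤ c, rounding the block lengths n/t and c/t up to integers loses only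
          -- a factor 2 each.
          t≤n : t ≤ n
          t≤n = *-cancelʳ-≤ t n d (≤-trans td≤j (≤-trans (≤-reflexive (J-comm Z Y))
                  (≤-trans (J≤Z*n Y Z-unique) (≤-reflexive (trans (cong (_* n) Y≡d) (*-comm d n))))))
          t≤c : t ≤ c
          t≤c = *-cancelʳ-≤ t c d (≤-trans td≤j (≤-trans (J≤Z*Y Z Y) (≤-reflexive (cong (c *_) Y≡d))))
          k l : ℕ
          k = suc (n / t)
          l = suc (c / t)
          instance
            j≢0 : NonZero j
            j≢0 = >-nonZero (<-≤-trans (s≤s z≤n) td≤j)
          j≤2ckl : j ≤ c * (l * (k + k))
          j≤2ckl = +-cancelˡ-≤ j j (c * (l * (k + k))) (*-cancelˡ-≤ j (begin
            j * (j + j)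
              ≡⟨ *-distribˡ-+ j j j ⟩
            j * j + j * j
              ≤⟨ +-mono-≤ square square ⟩
            d * (t + t) * (j + c * (l * (k + k))) + d * (t + t) * (j + c * (l * (k + k)))
              ≡⟨ four t d (j + c * (l * (k + k))) ⟩
            t * (4 * d) * (j + c * (l * (k + k)))
              ≤⟨ *-monoˡ-≤ (j + c * (l * (k + k))) 4td≤j ⟩
            j * (j + c * (l * (k + k))) ∎))
            where
            square : j * j ≤ d * (t + t) * (j + c * (l * (k + k)))
            square = ≤-trans (Cells.J²-bound Z-unique Y-unique t k l (ceiling-covers n t) (ceiling-covers c t))
              (≤-reflexive (cong (λ d → d * (t + t) * (j + c * (l * (k + k)))) Y≡d))
            four : ∀ t d e → d * (t + t) * e + d * (t + t) * e ≡ t * (4 * d) * e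
            four = solve-∀
          t²j≤ : t * t * j ≤ 8 * (n * (c * c))
          t²j≤ = begin
            t * t * j                        ≤⟨ *-monoʳ-≤ (t * t) j≤2ckl ⟩
            t * t * (c * (l * (k + k)))      ≡⟨ pair t c l k ⟩
            2 * c * ((t * l) * (t * k))      ≤⟨ *-monoʳ-≤ (2 * c) (*-mono-≤ (ceiling-≤ c t t≤c) (ceiling-≤ n t t≤n)) ⟩
            2 * c * ((2 * c) * (2 * n))      ≡⟨ eight c n ⟩
            8 * (n * (c * c))                ∎
            where
            pair : ∀ t c l k → t * t * (c * (l * (k + k))) ≡ 2 * c * ((t * l) * (t * k))
            pair = solve-∀
            eight : ∀ c n → 2 * c * ((2 * c) * (2 * n)) ≡ 8 * (n * (c * c))
            eight = solve-∀

    -- Regular subsets, energies and popular sums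

    module Sumset
      (A-unique : Unique A) (S : List ℤ) (S-unique : Unique S)
      (A+A⊆S : ∀ {a b} → a ∈ A → b ∈ A → a ℤ.+ b ∈ S)
      where

      open Multiplicity ℤₚ._≟_

      private
        -- The constant is 64 = 8 · 8: a deleted element has more than n/8 unpopular sums, each
        -- worth `K` in `potential`, so a deletion costs at least 8mn. The cap n² in `potential`
        -- keeps its initial value below mn², and at most n/8 elements are deleted.
        m K : ℕ
        m = length S
        K = 64 * m

        plus minus : ℤ × ℤ → ℤ
        plus  (a , b) = a ℤ.+ b
        minus (a , b) = a ℤ.- b

      sums : List ℤ → List ℤ
      sums B = map plus (cartesianProduct B B)

      differences : List ℤ → List ℤ → List ℤ
      differences B D = map minus (cartesianProduct B D)

      -- Representations are counted in `B` itself, since the quadruples below are formed from `B`.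
      -- Deletions can therefore make further sums unpopular, so a single pass over `A` need not
      -- produce a regular set.
      Popular : List ℤ → ℤ → Set
      Popular B s = n * n ≤ K * mult (sums B) s

      popular? : ∀ B → Decidable (Popular B)
      popular? B s = n * n ≤? K * mult (sums B) s

      unpopular : List ℤ → ℤ → ℕ
      unpopular B a = length (filter (λ c → ¬? (popular? B (a ℤ.+ c))) B)

      -- The constants are chosen for pairs: for any a, b in `B`, at least 7n/8 - 2 · n/8 elements c
      -- of `B` make both a + c and b + c popular, which is more than the n/2 used in
      -- `n≤2completions`.
      record Regular (B : List ℤ) : Set where
        field
          unique  : Unique B
          subset  : ∀ {b} → b ∈ B → b ∈ A
          large   : 7 * n ≤ 8 * length B
          regular : ∀ {a} → a ∈ B → 8 * unpopular B a ≤ n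

      -- Deleting an element with many unpopular sums lowers this potential substantially, so few
      -- elements are deleted before none is left to delete.
      potential : List ℤ → ℕ
      potential B = ∑ S (λ s → (K * mult (sums B) s) ⊓ (n * n))

      module Deletion {B : List ℤ} (B-unique : Unique B) (B⊆A : ∀ {b} → b ∈ B → b ∈ A) {a : ℤ} (a∈ : a ∈ B) where

        ≢a? : Decidable (λ b → ¬ b ≡ a)
        ≢a? b = ¬? (b ℤₚ.≟ a)

        B⁻ : List ℤ
        B⁻ = filter ≢a? B

        B⁻-unique : Unique B⁻
        B⁻-unique = Uniqueₚ.filter⁺ ≢a? B-unique

        B⁻⊆B : ∀ {b} → b ∈ B⁻ → b ∈ B
        B⁻⊆B b∈ = proj₁ (∈-filter⁻ ≢a? {xs = B} b∈)

        a∉B⁻ : ¬ a ∈ B⁻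
        a∉B⁻ a∈⁻ = proj₂ (∈-filter⁻ ≢a? {xs = B} a∈⁻) refl

        length-B⁻-< : length B⁻ < length B
        length-B⁻-< = injection (λ b → b) (All.tabulate (λ { b∈ refl → a∉B⁻ b∈ }) ∷ B⁻-unique)
          (λ { (here refl) → a∈ ; (there b∈) → B⁻⊆B b∈ }) (λ _ _ eq → eq)

        length-B-≤ : length B ≤ suc (length B⁻)
        length-B-≤ = injection (λ b → b) B-unique into (λ _ _ eq → eq)
          where
          into : ∀ {b} → b ∈ B → b ∈ a ∷ B⁻
          into {b} b∈ with b ℤₚ.≟ a
          ... | yes b≡a = here b≡a
          ... | no  b≢a = there (∈-filter⁺ ≢a? b∈ b≢a)

        private
          reps : List ℤ → ℤ → List (ℤ × ℤ)
          reps C s = filter (λ p → plus p ℤₚ.≟ s) (cartesianProduct C C)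

          reps-unique : ∀ {C} s → Unique C → Unique (reps C s)
          reps-unique s uniq = Uniqueₚ.filter⁺ (λ p → plus p ℤₚ.≟ s) (Uniqueₚ.cartesianProduct⁺ uniq uniq)

          reps-B⁻⊆ : ∀ s {p} → p ∈ reps B⁻ s → p ∈ reps B s
          reps-B⁻⊆ s p∈ =
            let p∈× , eq = ∈-filter⁻ (λ p → plus p ℤₚ.≟ s) {xs = cartesianProduct B⁻ B⁻} p∈
                x∈ , y∈ = ∈-cartesianProduct⁻ B⁻ B⁻ p∈×
            in ∈-filter⁺ (λ p → plus p ℤₚ.≟ s) (∈-cartesianProduct⁺ (B⁻⊆B x∈) (B⁻⊆B y∈)) eq

          mult-reps : ∀ C s → mult (sums C) s ≡ length (reps C s)
          mult-reps C s = mult-map plus (cartesianProduct C C) s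

          mult-≤ : ∀ s → mult (sums B⁻) s ≤ mult (sums B) s
          mult-≤ s = subst₂ _≤_ (sym (mult-reps B⁻ s)) (sym (mult-reps B s))
            (injection (λ p → p) (reps-unique s B⁻-unique) (reps-B⁻⊆ s) (λ _ _ eq → eq))

          mult-< : ∀ {c} → c ∈ B → mult (sums B⁻) (a ℤ.+ c) < mult (sums B) (a ℤ.+ c)
          mult-< {c} c∈ = subst₂ _<_ (sym (mult-reps B⁻ s)) (sym (mult-reps B s))
            (injection (λ p → p) (All.tabulate fresh ∷ reps-unique s B⁻-unique)
              (λ { (here refl) → ∈-filter⁺ (λ p → plus p ℤₚ.≟ s) (∈-cartesianProduct⁺ a∈ c∈) refl
                 ; (there p∈) → reps-B⁻⊆ s p∈ }) (λ _ _ eq → eq))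
            where
            s = a ℤ.+ c
            fresh : ∀ {p} → p ∈ reps B⁻ s → (a , c) ≢ p
            fresh p∈ refl = a∉B⁻ (proj₁ (∈-cartesianProduct⁻ B⁻ B⁻
              (proj₁ (∈-filter⁻ (λ p → plus p ℤₚ.≟ s) {xs = cartesianProduct B⁻ B⁻} p∈))))

          drop? : Decidable (λ s → mult (sums B⁻) s < mult (sums B) s × ¬ Popular B s)
          drop? s = (mult (sums B⁻) s <? mult (sums B) s) ×-dec ¬? (popular? B s)

          potential-pointwise : ∀ s → (K * mult (sums B⁻) s) ⊓ (n * n) + 𝟙 (drop? s) * K ≤ (K * mult (sums B) s) ⊓ (n * n)
          potential-pointwise s = go (drop? s)
            where
            open ≤-Reasoning
            ρ⁻ = mult (sums B⁻) s
            ρ = mult (sums B) s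
            go : (d : Dec (ρ⁻ < ρ × ¬ Popular B s)) → (K * ρ⁻) ⊓ (n * n) + 𝟙 d * K ≤ (K * ρ) ⊓ (n * n)
            go (no _) = ≤-trans (≤-reflexive (+-identityʳ _)) (⊓-monoˡ-≤ (n * n) (*-monoʳ-≤ K (mult-≤ s)))
            go (yes (ρ⁻<ρ , ¬pop)) = begin
              (K * ρ⁻) ⊓ (n * n) + (K + 0)  ≤⟨ +-mono-≤ (m⊓n≤m (K * ρ⁻) (n * n)) (≤-reflexive (+-identityʳ K)) ⟩
              K * ρ⁻ + K                    ≡⟨ trans (+-comm (K * ρ⁻) K) (sym (*-suc K ρ⁻)) ⟩
              K * suc ρ⁻                    ≤⟨ *-monoʳ-≤ K ρ⁻<ρ ⟩
              K * ρ                         ≡⟨ sym (m≤n⇒m⊓n≡m (<⇒≤ (≰⇒> ¬pop))) ⟩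
              (K * ρ) ⊓ (n * n)             ∎

          unpopular-≤ : unpopular B a ≤ length (filter drop? S)
          unpopular-≤ = injection (λ c → a ℤ.+ c) (Uniqueₚ.filter⁺ unpop? B-unique)
            (λ c∈ → let c∈B , ¬pop = ∈-filter⁻ unpop? {xs = B} c∈
                    in ∈-filter⁺ drop? (A+A⊆S (B⊆A a∈) (B⊆A c∈B)) (mult-< c∈B , ¬pop))
            (λ _ _ → ℤ-Group.∙-cancelˡ a _ _)
            where
            unpop? : Decidable (λ c → ¬ Popular B (a ℤ.+ c))
            unpop? c = ¬? (popular? B (a ℤ.+ c))

        -- A sum a + c that is unpopular lies below the cap and loses at least the representation (a
        -- , c), hence at least `K` of the potential. Different c give different sums, and all other
        -- terms can only decrease.
        potential-drop : potential B⁻ + unpopular B a * K ≤ potential B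
        potential-drop = begin
          potential B⁻ + unpopular B a * K
            ≤⟨ +-monoʳ-≤ (potential B⁻) (*-monoˡ-≤ K unpopular-≤) ⟩
          potential B⁻ + length (filter drop? S) * K
            ≡⟨ cong (potential B⁻ +_) (trans (cong (_* K) (length-filter drop? S)) (sym (∑-*ʳ S K (𝟙 ∘ drop?)))) ⟩
          potential B⁻ + ∑ S (λ s → 𝟙 (drop? s) * K)
            ≡⟨ sym (∑-+ S (λ s → (K * mult (sums B⁻) s) ⊓ (n * n)) (λ s → 𝟙 (drop? s) * K)) ⟩
          ∑ S (λ s → (K * mult (sums B⁻) s) ⊓ (n * n) + 𝟙 (drop? s) * K)
            ≤⟨ ∑-mono (λ {s} _ → potential-pointwise s) ⟩
          potential B ∎
          where open ≤-Reasoning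

      -- The invariant says that each of the n - |B| deletions so far has used up at least 8mn of
      -- the initial mn². When no bad element is left, dropping the potential gives 8(n - |B|) ≤ n,
      -- which is `large`.
      regularise-from : .{{_ : NonZero n}} .{{_ : NonZero m}} → ∀ fuel B → length B ≤ fuel → Unique B → (∀ {b} → b ∈ B → b ∈ A) →
        potential B + 8 * (m * n) * n ≤ 8 * (m * n) * length B + m * (n * n) → ∃[ B ] Regular B
      regularise-from fuel B fuel≥ uniq ⊆A invariant with any? (λ a → n <? 8 * unpopular B a) B
      ... | no none = B , record
        { unique = uniq ; subset = ⊆A
        ; large = +-cancelˡ-≤ n (7 * n) (8 * length B) (*-cancelˡ-≤ (m * n) {{m*n≢0 m n}} (begin
            m * n * (n + 7 * n)                          ≡⟨ e₁ m n ⟩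
            8 * (m * n) * n                              ≤⟨ m≤n+m _ (potential B) ⟩
            potential B + 8 * (m * n) * n                ≤⟨ invariant ⟩
            8 * (m * n) * length B + m * (n * n)         ≡⟨ e₂ m n (length B) ⟩
            m * n * (n + 8 * length B)                   ∎))
        ; regular = λ a∈ → ≮⇒≥ (λ bad → none (lose a∈ bad)) }
        where
        open ≤-Reasoning
        e₁ : ∀ m n → m * n * (n + 7 * n) ≡ 8 * (m * n) * n
        e₁ = solve-∀
        e₂ : ∀ m n b → 8 * (m * n) * b + m * (n * n) ≡ m * n * (n + 8 * b)
        e₂ = solve-∀
      regularise-from zero [] fuel≥ uniq ⊆A invariant | yes ()
      regularise-from (suc fuel) B fuel≥ uniq ⊆A invariant | yes found with find found
      ... | a , a∈ , bad = regularise-from fuel B⁻ (s≤s⁻¹ (≤-trans length-B⁻-< fuel≥)) B⁻-unique (⊆A ∘ B⁻⊆B)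
        (+-cancelˡ-≤ (8 * (m * n)) _ _ (begin
          8 * (m * n) + (potential B⁻ + 8 * (m * n) * n)
            ≡⟨ e₁ (8 * (m * n)) (potential B⁻) (8 * (m * n) * n) ⟩
          potential B⁻ + 8 * (m * n) + 8 * (m * n) * n
            ≤⟨ +-monoˡ-≤ (8 * (m * n) * n) (+-monoʳ-≤ (potential B⁻) weight) ⟩
          potential B⁻ + unpopular B a * K + 8 * (m * n) * n
            ≤⟨ +-monoˡ-≤ (8 * (m * n) * n) potential-drop ⟩
          potential B + 8 * (m * n) * n
            ≤⟨ invariant ⟩
          8 * (m * n) * length B + m * (n * n)
            ≤⟨ +-monoˡ-≤ (m * (n * n)) (*-monoʳ-≤ (8 * (m * n)) length-B-≤) ⟩
          8 * (m * n) * suc (length B⁻) + m * (n * n)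
            ≡⟨ e₂ (8 * (m * n)) (length B⁻) (m * (n * n)) ⟩
          8 * (m * n) + (8 * (m * n) * length B⁻ + m * (n * n)) ∎))
        where
        open ≤-Reasoning
        open Deletion uniq ⊆A a∈
        e₁ : ∀ w p q → w + (p + q) ≡ p + w + q
        e₁ = solve-∀
        e₂ : ∀ w b q → w * suc b + q ≡ w + (w * b + q)
        e₂ = solve-∀
        e₃ : ∀ m u → 8 * m * (8 * u) ≡ u * (64 * m)
        e₃ = solve-∀
        weight : 8 * (m * n) ≤ unpopular B a * K
        weight = begin
          8 * (m * n)                    ≡⟨ sym (*-assoc 8 m n) ⟩
          8 * m * n                      ≤⟨ *-monoʳ-≤ (8 * m) (<⇒≤ bad) ⟩
          8 * m * (8 * unpopular B a)    ≡⟨ e₃ m (unpopular B a) ⟩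
          unpopular B a * K              ∎

      regularise : .{{_ : NonZero n}} .{{_ : NonZero m}} → ∃[ B ] Regular B
      regularise = regularise-from n A ≤-refl A-unique (λ a∈ → a∈) (begin
        potential A + 8 * (m * n) * n        ≤⟨ +-monoˡ-≤ _ (∑-≤-max S _ (n * n) (λ {s} _ → m⊓n≤n (K * mult (sums A) s) (n * n))) ⟩
        m * (n * n) + 8 * (m * n) * n        ≡⟨ +-comm (m * (n * n)) _ ⟩
        8 * (m * n) * n + m * (n * n)        ∎)
        where open ≤-Reasoning

      𝟙-×-dec : {P Q : Set} (P? : Dec P) (Q? : Dec Q) → 𝟙 (P? ×-dec Q?) ≡ 𝟙 P? * 𝟙 Q?
      𝟙-×-dec (yes _) (yes _) = refl
      𝟙-×-dec (yes _) (no  _) = refl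
      𝟙-×-dec (no  _) (yes _) = refl
      𝟙-×-dec (no  _) (no  _) = refl

      module Regularised {B : List ℤ} (B-regular : Regular B) (l : ℕ) (n<2^[1+l] : n < 2 ^ suc l) where

        open Regular B-regular

        L : ℕ
        L = suc l

        Pairs : List (ℤ × ℤ)
        Pairs = cartesianProduct B B

        Pairs-unique : Unique Pairs
        Pairs-unique = Uniqueₚ.cartesianProduct⁺ unique unique

        ∈-Pairs : ∀ {a b} → a ∈ B → b ∈ B → (a , b) ∈ Pairs
        ∈-Pairs = ∈-cartesianProduct⁺

        diffs : List ℤ
        diffs = differences B B

        B≤n : length B ≤ n
        B≤n = injection (λ b → b) unique subset (λ _ _ eq → eq)

        n≤2B : n ≤ 2 * length B
        n≤2B = *-cancelˡ-≤ 4 (begin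
          4 * n              ≤⟨ *-monoˡ-≤ n (m≤m+n 4 3) ⟩
          7 * n              ≤⟨ large ⟩
          8 * length B       ≡⟨ *-assoc 4 2 (length B) ⟩
          4 * (2 * length B) ∎)
          where open ≤-Reasoning

        mult-differences-< : ∀ {D x} → Unique D → mult (differences B D) x < 2 ^ L
        mult-differences-< {D} {x} D-unique = ≤-<-trans (≤-trans (≤-reflexive (mult-map minus (cartesianProduct B D) x))
          (≤-trans (injection proj₁ (Uniqueₚ.filter⁺ hit? (Uniqueₚ.cartesianProduct⁺ unique D-unique)) into inj) B≤n)) n<2^[1+l]
          where
          hit? : Decidable (λ p → minus p ≡ x)
          hit? p = minus p ℤₚ.≟ x
          into : ∀ {p} → p ∈ filter hit? (cartesianProduct B D) → proj₁ p ∈ B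
          into p∈ = proj₁ (∈-cartesianProduct⁻ B D (proj₁ (∈-filter⁻ hit? {xs = cartesianProduct B D} p∈)))
          inj : ∀ {p q} → p ∈ filter hit? (cartesianProduct B D) → q ∈ filter hit? (cartesianProduct B D) → proj₁ p ≡ proj₁ q → p ≡ q
          inj {a , d} {a , d′} p∈ q∈ refl = cong (a ,_) (ℤₚ.neg-injective (ℤ-Group.∙-cancelˡ a _ _
            (trans (proj₂ (∈-filter⁻ hit? {xs = cartesianProduct B D} p∈))
              (sym (proj₂ (∈-filter⁻ hit? {xs = cartesianProduct B D} q∈))))))

        -- x = a - d means d + x = a ∈ A, which turns representations in B - D into incidences with
        -- `A`.
        mult-differences-≤ : ∀ D x → mult (differences B D) x ≤ ∑ D (λ d → 𝟙 (d ℤ.+ x ∈? A))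
        mult-differences-≤ D x = begin
          mult (differences B D) x                                        ≡⟨ ∑-map minus (cartesianProduct B D) (λ w → 𝟙 (w ℤₚ.≟ x)) ⟩
          ∑ (cartesianProduct B D) (λ p → 𝟙 (minus p ℤₚ.≟ x))             ≡⟨ ∑-× B D (λ p → 𝟙 (minus p ℤₚ.≟ x)) ⟩
          ∑ B (λ a → ∑ D (λ d → 𝟙 (a ℤ.- d ℤₚ.≟ x)))                      ≡⟨ ∑-swap B D (λ a d → 𝟙 (a ℤ.- d ℤₚ.≟ x)) ⟩
          ∑ D (λ d → ∑ B (λ a → 𝟙 (a ℤ.- d ℤₚ.≟ x)))                      ≤⟨ ∑-mono (λ {d} _ → ∑-mono (λ {a} a∈ → pointwise a∈)) ⟩
          ∑ D (λ d → ∑ B (λ a → 𝟙 (d ℤ.+ x ℤₚ.≟ a) * 𝟙 (a ∈? A)))         ≤⟨ ∑-mono (λ _ → ∑-point-≤ (λ a → 𝟙 (a ∈? A)) unique) ⟩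
          ∑ D (λ d → 𝟙 (d ℤ.+ x ∈? A))                                    ∎
          where
          open ≤-Reasoning
          undo : ∀ a d → d ℤ.+ (a ℤ.- d) ≡ a
          undo = ℤ-Ring.solve-∀
          pointwise : ∀ {a d} → a ∈ B → 𝟙 (a ℤ.- d ℤₚ.≟ x) ≤ 𝟙 (d ℤ.+ x ℤₚ.≟ a) * 𝟙 (a ∈? A)
          pointwise {a} {d} a∈ = ≤-trans
            (𝟙-mono (a ℤ.- d ℤₚ.≟ x) (d ℤ.+ x ℤₚ.≟ a) (λ { refl → undo a d }))
            (≤-reflexive (trans (sym (*-identityʳ _)) (cong (𝟙 (d ℤ.+ x ℤₚ.≟ a) *_) (sym (𝟙-yes (a ∈? A) (subset a∈))))))

        level-J : ∀ D i → 2 ^ i * length (level (differences B D) i) ≤ J D (level (differences B D) i)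
        level-J D i = ≤-trans (level-∑ (differences B D) i)
          (≤-trans (∑-mono (λ {x} _ → mult-differences-≤ D x))
            (≤-reflexive (∑-swap (level (differences B D) i) D (λ x d → 𝟙 (d ℤ.+ x ∈? A)))))

        -- A level X satisfies q |X| ≤ J D X. In the cube of this, `J³-bound` has |X|² on its right
        -- side, which cancels.
        level-cube : ∀ {D} → Unique D → ∀ i → let q = 2 ^ i in
          q * (q * q) * length (level (differences B D) i) ≤ 512 * (n * (length D * length D))
        level-cube {D} D-unique i = cancel (length X) refl
          where
          open ≤-Reasoning
          X = level (differences B D) i
          q = 2 ^ i
          d = length D
          cancel : ∀ x → length X ≡ x → q * (q * q) * x ≤ 512 * (n * (d * d))
          cancel zero    _    = ≤-trans (≤-reflexive (*-zeroʳ (q * (q * q)))) z≤n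
          cancel x@(suc _) eq = *-cancelʳ-≤ _ _ (x * x) (begin
            q * (q * q) * x * (x * x)               ≡⟨ cubes q x ⟩
            q * x * (q * x * (q * x))               ≤⟨ *-mono-≤ qx≤ (*-mono-≤ qx≤ qx≤) ⟩
            J D X * (J D X * J D X)                 ≤⟨ J³-bound D-unique (level-unique (differences B D) i) ⟩
            512 * (n * ((d * d) * (length X * length X)))  ≡⟨ cong (λ x → 512 * (n * ((d * d) * (x * x)))) eq ⟩
            512 * (n * ((d * d) * (x * x)))         ≡⟨ regroup n (d * d) (x * x) ⟩
            512 * (n * (d * d)) * (x * x)           ∎)
            where
            qx≤ : q * x ≤ J D X
            qx≤ = subst (λ x → q * x ≤ J D X) eq (level-J D i)
            cubes : ∀ q x → q * (q * q) * x * (x * x) ≡ q * x * (q * x * (q * x))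
            cubes = solve-∀
            regroup : ∀ n d x → 512 * (n * (d * x)) ≡ 512 * (n * d) * x
            regroup = solve-∀

        level-diffs-cube : ∀ i → let q = 2 ^ i in q * (q * q) * length (level diffs i) ≤ 512 * (n * (n * n))
        level-diffs-cube i = ≤-trans (level-cube unique i) (*-monoʳ-≤ 512 (*-monoʳ-≤ n (*-mono-≤ B≤n B≤n)))

        level-diffs-length : ∀ i → 2 ^ i * length (level diffs i) ≤ n * n
        level-diffs-length i = ≤-trans (level-length diffs i) (≤-trans
          (≤-reflexive (trans (length-map minus Pairs) (length-× B B))) (*-mono-≤ B≤n B≤n))

        level-length-≤ : ∀ D i → 2 ^ i * length (level (differences B D) i) ≤ n * length D
        level-length-≤ D i = ≤-trans (level-length (differences B D) i) (≤-trans
          (≤-reflexive (trans (length-map minus (cartesianProduct B D)) (length-× B D))) (*-monoˡ-≤ (length D) B≤n))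

        -- The additive energy of `B` and its third-moment analogue.
        E₂ E₃ : ℕ
        E₂ = ∑ (support diffs) (λ y → mult diffs y * mult diffs y)
        E₃ = ∑ (support diffs) (λ y → mult diffs y * (mult diffs y * mult diffs y))

        E₂-dyadic : ∃[ k ] k < L × E₂ ≤ L * (2 ^ suc k * 2 ^ suc k * length (level diffs k))
        E₂-dyadic =
          let k , k<L , E≤ = ∑-upTo-max l (λ k → 2 ^ suc k * 2 ^ suc k * ∑ (level diffs k) (λ _ → 1))
          in k , k<L , (begin
            E₂                                                                 ≡⟨ ∑-cong (λ {y} _ → sym (*-identityʳ _)) ⟩
            ∑ (support diffs) (λ y → mult diffs y * mult diffs y * 1)
              ≤⟨ ∑-dyadic diffs L (λ a → a * a) (λ _ → 1) (λ a≤b → *-mono-≤ a≤b a≤b) (mult-differences-< unique) ⟩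
            ∑ (upTo L) (λ k → 2 ^ suc k * 2 ^ suc k * ∑ (level diffs k) (λ _ → 1)) ≤⟨ E≤ ⟩
            L * (2 ^ suc k * 2 ^ suc k * ∑ (level diffs k) (λ _ → 1))
              ≡⟨ cong (λ s → L * (2 ^ suc k * 2 ^ suc k * s)) (∑-one (level diffs k)) ⟩
            L * (2 ^ suc k * 2 ^ suc k * length (level diffs k)) ∎)
          where open ≤-Reasoning

        -- By `level-diffs-cube` all scales have the same bound, so the third moment loses only the
        -- number of scales. 4096 = 2³ · 512, where 2³ is the cost of rounding multiplicities up to
        -- 2^(i+1).
        E₃-bound : E₃ ≤ L * (4096 * (n * (n * n)))
        E₃-bound = begin
          E₃                                                                 ≡⟨ ∑-cong (λ {y} _ → sym (*-identityʳ _)) ⟩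
          ∑ (support diffs) (λ y → mult diffs y * (mult diffs y * mult diffs y) * 1)
            ≤⟨ ∑-dyadic diffs L (λ a → a * (a * a)) (λ _ → 1) (λ a≤b → *-mono-≤ a≤b (*-mono-≤ a≤b a≤b)) (mult-differences-< unique) ⟩
          ∑ (upTo L) (λ k → 2 ^ suc k * (2 ^ suc k * 2 ^ suc k) * ∑ (level diffs k) (λ _ → 1))
            ≤⟨ ∑-≤-max (upTo L) _ (4096 * (n * (n * n))) (λ {k} _ → each k) ⟩
          length (upTo L) * (4096 * (n * (n * n)))  ≡⟨ cong (_* (4096 * (n * (n * n)))) (length-upTo L) ⟩
          L * (4096 * (n * (n * n))) ∎
          where
          open ≤-Reasoning
          double : ∀ q x → 2 * q * (2 * q * (2 * q)) * x ≡ 8 * (q * (q * q) * x)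
          double = solve-∀
          each : ∀ k → 2 ^ suc k * (2 ^ suc k * 2 ^ suc k) * ∑ (level diffs k) (λ _ → 1) ≤ 4096 * (n * (n * n))
          each k = begin
            2 ^ suc k * (2 ^ suc k * 2 ^ suc k) * ∑ (level diffs k) (λ _ → 1)
              ≡⟨ cong (2 ^ suc k * (2 ^ suc k * 2 ^ suc k) *_) (∑-one (level diffs k)) ⟩
            2 ^ suc k * (2 ^ suc k * 2 ^ suc k) * length (level diffs k)
              ≡⟨ double (2 ^ k) (length (level diffs k)) ⟩
            8 * (2 ^ k * (2 ^ k * 2 ^ k) * length (level diffs k))
              ≤⟨ *-monoʳ-≤ 8 (level-diffs-cube k) ⟩
            8 * (512 * (n * (n * n)))
              ≡⟨ sym (*-assoc 8 512 (n * (n * n))) ⟩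
            4096 * (n * (n * n)) ∎

        -- Cauchy-Schwarz needs sums, of which there are at most m, while the level sets are made of
        -- differences. The two energies agree because a + b = a′ + b′ is the same as a - a′ = b′ -
        -- b.
        E₂-lower : length B * length B * (length B * length B) ≤ m * E₂
        E₂-lower = begin
          length B * length B * (length B * length B)     ≡⟨ sym (cong₂ _*_ len len) ⟩
          length (sums B) * length (sums B)               ≤⟨ collisions-bound (sums B) S-unique into ⟩
          m * collisions (sums B)                         ≡⟨ cong (m *_) (collisions-map plus Pairs) ⟩
          m * length (filter same-sum? (cartesianProduct Pairs Pairs))
            ≤⟨ *-monoʳ-≤ m (injection flip (Uniqueₚ.filter⁺ same-sum? (Uniqueₚ.cartesianProduct⁺ Pairs-unique Pairs-unique)) flip∈ (λ { _ _ refl → refl })) ⟩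
          m * length (filter same-difference? (cartesianProduct Pairs Pairs))
            ≡⟨ cong (m *_) (sym (collisions-map minus Pairs)) ⟩
          m * collisions diffs                            ≡⟨ cong (m *_) (∑-fibre diffs (mult diffs) (support-unique diffs) ∈-support) ⟩
          m * E₂                                          ∎
          where
          open ≤-Reasoning
          len : length (sums B) ≡ length B * length B
          len = trans (length-map plus Pairs) (length-× B B)
          into : ∀ {w} → w ∈ sums B → w ∈ S
          into w∈ with ∈-map⁻ plus w∈
          ... | (a , b) , p∈ , refl = let a∈ , b∈ = ∈-cartesianProduct⁻ B B p∈ in A+A⊆S (subset a∈) (subset b∈)
          same-sum? : Decidable (λ (p : (ℤ × ℤ) × (ℤ × ℤ)) → plus (proj₂ p) ≡ plus (proj₁ p))
          same-sum? p = plus (proj₂ p) ℤₚ.≟ plus (proj₁ p)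
          same-difference? : Decidable (λ (p : (ℤ × ℤ) × (ℤ × ℤ)) → minus (proj₂ p) ≡ minus (proj₁ p))
          same-difference? p = minus (proj₂ p) ℤₚ.≟ minus (proj₁ p)
          flip : (ℤ × ℤ) × (ℤ × ℤ) → (ℤ × ℤ) × (ℤ × ℤ)
          flip ((a , b) , (a′ , b′)) = (a , a′) , (b′ , b)
          left : ∀ b b′ a′ → b′ ℤ.- b ≡ a′ ℤ.+ b′ ℤ.- a′ ℤ.- b
          left = ℤ-Ring.solve-∀
          right : ∀ a b a′ → a ℤ.+ b ℤ.- a′ ℤ.- b ≡ a ℤ.- a′
          right = ℤ-Ring.solve-∀
          flip∈ : ∀ {p} → p ∈ filter same-sum? (cartesianProduct Pairs Pairs) → flip p ∈ filter same-difference? (cartesianProduct Pairs Pairs)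
          flip∈ {(a , b) , (a′ , b′)} p∈ =
            let p∈× , eq = ∈-filter⁻ same-sum? {xs = cartesianProduct Pairs Pairs} p∈
                q∈ , q′∈ = ∈-cartesianProduct⁻ Pairs Pairs p∈×
                a∈ , b∈ = ∈-cartesianProduct⁻ B B q∈
                a′∈ , b′∈ = ∈-cartesianProduct⁻ B B q′∈
            in ∈-filter⁺ same-difference? (∈-cartesianProduct⁺ (∈-Pairs a∈ a′∈) (∈-Pairs b′∈ b∈))
                 (trans (left b b′ a′) (trans (cong (λ s → s ℤ.- a′ ℤ.- b) eq) (right a b a′)))

        P : List ℤ
        P = filter (popular? B) S

        P-unique : Unique P
        P-unique = Uniqueₚ.filter⁺ (popular? B) S-unique

        module _ {D : List ℤ} (D-unique : Unique D) where

          popular-differences : List (ℤ × ℤ)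
          popular-differences = filter (λ p → minus p ∈? D) (cartesianProduct P P)

          private
            Triple : Set
            Triple = (ℤ × ℤ) × ℤ

            Good : Triple → Set
            Good ((a , b) , c) = a ℤ.- b ∈ D × (a ℤ.+ c ∈ P × b ℤ.+ c ∈ P)

            good? : Decidable Good
            good? ((a , b) , c) = (a ℤ.- b ∈? D) ×-dec ((a ℤ.+ c ∈? P) ×-dec (b ℤ.+ c ∈? P))

            all-triples : List Triple
            all-triples = cartesianProduct Pairs B

            triples : List Triple
            triples = filter good? all-triples

            triples-unique : Unique triples
            triples-unique = Uniqueₚ.filter⁺ good? (Uniqueₚ.cartesianProduct⁺ Pairs-unique unique)

            ∈-triples⁻ : ∀ {a b c} → ((a , b) , c) ∈ triples → (a ∈ B × b ∈ B × c ∈ B) × Good ((a , b) , c)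
            ∈-triples⁻ t∈ =
              let t∈× , good = ∈-filter⁻ good? {xs = all-triples} t∈
                  p∈ , c∈ = ∈-cartesianProduct⁻ Pairs B t∈×
                  a∈ , b∈ = ∈-cartesianProduct⁻ B B p∈
              in (a∈ , b∈ , c∈) , good

            corners : Triple → ℤ × ℤ
            corners ((a , b) , c) = a ℤ.+ c , b ℤ.+ c

            _≟²_ : DecidableEquality (ℤ × ℤ)
            _≟²_ = ≡-dec ℤₚ._≟_ ℤₚ._≟_

            module M² = Multiplicity _≟²_

            corners∈ : ∀ {w} → w ∈ map corners triples → w ∈ popular-differences
            corners∈ w∈ with ∈-map⁻ corners w∈
            ... | ((a , b) , c) , t∈ , refl with ∈-triples⁻ t∈
            ... | _ , ab∈D , ac∈P , bc∈P = ∈-filter⁺ (λ p → minus p ∈? D) (∈-cartesianProduct⁺ ac∈P bc∈P)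
              (subst (_∈ D) (shift a b c) ab∈D)
              where
              shift : ∀ a b c → a ℤ.- b ≡ (a ℤ.+ c) ℤ.- (b ℤ.+ c)
              shift = ℤ-Ring.solve-∀

            Sextuple : Set
            Sextuple = (ℤ × ℤ) × ((ℤ × ℤ) × (ℤ × ℤ))

            parallel? : Decidable (λ (p : Sextuple) → minus (proj₁ (proj₂ p)) ≡ minus (proj₁ p) × minus (proj₂ (proj₂ p)) ≡ minus (proj₁ p))
            parallel? (p , (q , r)) = (minus q ℤₚ.≟ minus p) ×-dec (minus r ℤₚ.≟ minus p)

            parallel : List Sextuple
            parallel = filter parallel? (cartesianProduct Pairs (cartesianProduct Pairs Pairs))

            length-parallel : length parallel ≡ E₃
            length-parallel = begin
              length parallel
                ≡⟨ length-filter parallel? (cartesianProduct Pairs (cartesianProduct Pairs Pairs)) ⟩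
              ∑ (cartesianProduct Pairs (cartesianProduct Pairs Pairs)) (λ p → 𝟙 (parallel? p))
                ≡⟨ ∑-× Pairs (cartesianProduct Pairs Pairs) (λ p → 𝟙 (parallel? p)) ⟩
              ∑ Pairs (λ p → ∑ (cartesianProduct Pairs Pairs) (λ qr → 𝟙 (parallel? (p , qr))))
                ≡⟨ ∑-cong (λ {p} _ → inner p) ⟩
              ∑ Pairs (λ p → mult diffs (minus p) * mult diffs (minus p))
                ≡⟨ sym (∑-map minus Pairs (λ w → mult diffs w * mult diffs w)) ⟩
              ∑ diffs (λ w → mult diffs w * mult diffs w)
                ≡⟨ ∑-fibre diffs (λ w → mult diffs w * mult diffs w) (support-unique diffs) ∈-support ⟩
              E₃ ∎
              where
              open ≡-Reasoning
              inner : ∀ p → ∑ (cartesianProduct Pairs Pairs) (λ qr → 𝟙 (parallel? (p , qr))) ≡ mult diffs (minus p) * mult diffs (minus p)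
              inner p = begin
                ∑ (cartesianProduct Pairs Pairs) (λ qr → 𝟙 (parallel? (p , qr)))
                  ≡⟨ ∑-× Pairs Pairs (λ qr → 𝟙 (parallel? (p , qr))) ⟩
                ∑ Pairs (λ q → ∑ Pairs (λ r → 𝟙 (parallel? (p , (q , r)))))
                  ≡⟨ ∑-cong (λ {q} _ → trans (∑-cong (λ {r} _ → 𝟙-×-dec (minus q ℤₚ.≟ minus p) (minus r ℤₚ.≟ minus p)))
                       (∑-*ˡ Pairs (𝟙 (minus q ℤₚ.≟ minus p)) (λ r → 𝟙 (minus r ℤₚ.≟ minus p)))) ⟩
                ∑ Pairs (λ q → 𝟙 (minus q ℤₚ.≟ minus p) * ∑ Pairs (λ r → 𝟙 (minus r ℤₚ.≟ minus p)))
                  ≡⟨ ∑-*ʳ Pairs (∑ Pairs (λ r → 𝟙 (minus r ℤₚ.≟ minus p))) (λ q → 𝟙 (minus q ℤₚ.≟ minus p)) ⟩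
                ∑ Pairs (λ q → 𝟙 (minus q ℤₚ.≟ minus p)) * ∑ Pairs (λ r → 𝟙 (minus r ℤₚ.≟ minus p))
                  ≡⟨ sym (cong₂ _*_ (∑-map minus Pairs (λ w → 𝟙 (w ℤₚ.≟ minus p))) (∑-map minus Pairs (λ w → 𝟙 (w ℤₚ.≟ minus p)))) ⟩
                mult diffs (minus p) * mult diffs (minus p) ∎

            same-corners? : Decidable (λ (p : Triple × Triple) → corners (proj₂ p) ≡ corners (proj₁ p))
            same-corners? p = corners (proj₂ p) ≟² corners (proj₁ p)

            -- Equal corners say that a - a′ = b - b′ = c′ - c, which is one difference represented
            -- three times.
            rearrange : Triple × Triple → Sextuple
            rearrange (((a , b) , c) , ((a′ , b′) , c′)) = (a , a′) , ((b , b′) , (c′ , c))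

            rearrange∈ : ∀ {p} → p ∈ filter same-corners? (cartesianProduct triples triples) → rearrange p ∈ parallel
            rearrange∈ {((a , b) , c) , ((a′ , b′) , c′)} p∈ =
              let p∈× , eq = ∈-filter⁻ same-corners? {xs = cartesianProduct triples triples} p∈
                  t∈ , t′∈ = ∈-cartesianProduct⁻ triples triples p∈×
                  (a∈ , b∈ , c∈) , _ = ∈-triples⁻ t∈
                  (a′∈ , b′∈ , c′∈) , _ = ∈-triples⁻ t′∈
                  c-eq : c′ ℤ.- c ≡ a ℤ.- a′
                  c-eq = trans (left c c′ a′) (trans (cong (λ s → s ℤ.- a′ ℤ.- c) (cong proj₁ eq)) (right a c a′))
                  b-eq : c′ ℤ.- c ≡ b ℤ.- b′
                  b-eq = trans (left c c′ b′) (trans (cong (λ s → s ℤ.- b′ ℤ.- c) (cong proj₂ eq)) (right b c b′))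
              in ∈-filter⁺ parallel? (∈-cartesianProduct⁺ (∈-Pairs a∈ a′∈) (∈-cartesianProduct⁺ (∈-Pairs b∈ b′∈) (∈-Pairs c′∈ c∈)))
                   (trans (sym b-eq) c-eq , c-eq)
              where
              left : ∀ b b′ a′ → b′ ℤ.- b ≡ a′ ℤ.+ b′ ℤ.- a′ ℤ.- b
              left = ℤ-Ring.solve-∀
              right : ∀ a b a′ → a ℤ.+ b ℤ.- a′ ℤ.- b ≡ a ℤ.- a′
              right = ℤ-Ring.solve-∀

            triples² : length triples * length triples ≤ length popular-differences * E₃
            triples² = begin
              length triples * length triples
                ≡⟨ sym (cong₂ _*_ (length-map corners triples) (length-map corners triples)) ⟩
              length (map corners triples) * length (map corners triples)
                ≤⟨ M².collisions-bound (map corners triples) (Uniqueₚ.filter⁺ (λ p → minus p ∈? D) (Uniqueₚ.cartesianProduct⁺ P-unique P-unique)) corners∈ ⟩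
              length popular-differences * M².collisions (map corners triples)
                ≡⟨ cong (length popular-differences *_) (M².collisions-map corners triples) ⟩
              length popular-differences * length (filter same-corners? (cartesianProduct triples triples))
                ≤⟨ *-monoʳ-≤ (length popular-differences) (injection rearrange
                     (Uniqueₚ.filter⁺ same-corners? (Uniqueₚ.cartesianProduct⁺ triples-unique triples-unique))
                     rearrange∈ (λ { _ _ refl → refl })) ⟩
              length popular-differences * length parallel
                ≡⟨ cong (length popular-differences *_) length-parallel ⟩
              length popular-differences * E₃ ∎
              where open ≤-Reasoning

            completions : ℤ → ℤ → ℕ
            completions a b = ∑ B (λ c → 𝟙 ((a ℤ.+ c ∈? P) ×-dec (b ℤ.+ c ∈? P)))

            n≤2completions : ∀ {a b} → a ∈ B → b ∈ B → n ≤ 2 * completions a b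
            n≤2completions {a} {b} a∈ b∈ = *-cancelˡ-≤ 4 (+-cancelʳ-≤ (n + n) _ _ (begin
              4 * n + (n + n)                                 ≤⟨ m≤m+n _ n ⟩
              4 * n + (n + n) + n                             ≡⟨ seven n ⟩
              7 * n                                           ≤⟨ large ⟩
              8 * length B                                    ≡⟨ cong (8 *_) (sym (∑-one B)) ⟩
              8 * ∑ B (λ _ → 1)                               ≤⟨ *-monoʳ-≤ 8 (∑-mono pointwise) ⟩
              8 * ∑ B (λ c → G c + (𝟙 (U a c) + 𝟙 (U b c)))    ≡⟨ cong (8 *_) (trans (∑-+ B G (λ c → 𝟙 (U a c) + 𝟙 (U b c)))
                                                                   (cong (∑ B G +_) (∑-+ B (𝟙 ∘ U a) (𝟙 ∘ U b)))) ⟩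
              8 * (∑ B G + (∑ B (𝟙 ∘ U a) + ∑ B (𝟙 ∘ U b)))    ≡⟨ cong₂ (λ u v → 8 * (∑ B G + (u + v))) (sym (length-filter (U a) B)) (sym (length-filter (U b) B)) ⟩
              8 * (∑ B G + (unpopular B a + unpopular B b))   ≡⟨ distribute (∑ B G) (unpopular B a) (unpopular B b) ⟩
              4 * (2 * ∑ B G) + (8 * unpopular B a + 8 * unpopular B b)
                ≤⟨ +-monoʳ-≤ (4 * (2 * ∑ B G)) (+-mono-≤ (regular a∈) (regular b∈)) ⟩
              4 * (2 * ∑ B G) + (n + n) ∎))
              where
              open ≤-Reasoning
              seven : ∀ n → 4 * n + (n + n) + n ≡ 7 * n
              seven = solve-∀
              distribute : ∀ g u v → 8 * (g + (u + v)) ≡ 4 * (2 * g) + (8 * u + 8 * v)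
              distribute = solve-∀
              U : ∀ a c → Dec (¬ Popular B (a ℤ.+ c))
              U a c = ¬? (popular? B (a ℤ.+ c))
              G : ℤ → ℕ
              G c = 𝟙 ((a ℤ.+ c ∈? P) ×-dec (b ℤ.+ c ∈? P))
              member : ∀ {a c} → a ∈ B → c ∈ B → Popular B (a ℤ.+ c) → a ℤ.+ c ∈ P
              member a∈ c∈ pop = ∈-filter⁺ (popular? B) (A+A⊆S (subset a∈) (subset c∈)) pop
              pointwise : ∀ {c} → c ∈ B → 1 ≤ G c + (𝟙 (U a c) + 𝟙 (U b c))
              pointwise {c} c∈ = cases (popular? B (a ℤ.+ c)) (popular? B (b ℤ.+ c))
                where
                cases : (d : Dec (Popular B (a ℤ.+ c))) (e : Dec (Popular B (b ℤ.+ c))) → 1 ≤ G c + (𝟙 (¬? d) + 𝟙 (¬? e))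
                cases (yes p) (yes q) = ≤-trans (≤-reflexive (sym (𝟙-yes ((a ℤ.+ c ∈? P) ×-dec (b ℤ.+ c ∈? P)) (member a∈ c∈ p , member b∈ c∈ q)))) (m≤m+n (G c) _)
                cases (no _)  e       = ≤-trans (m≤m+n 1 (𝟙 (¬? e))) (m≤n+m _ (G c))
                cases (yes _) (no _)  = m≤n+m 1 (G c)

            length-triples : length triples ≡ ∑ Pairs (λ p → 𝟙 (minus p ∈? D) * completions (proj₁ p) (proj₂ p))
            length-triples = begin
              length triples                                        ≡⟨ length-filter good? all-triples ⟩
              ∑ all-triples (λ t → 𝟙 (good? t))                     ≡⟨ ∑-× Pairs B (λ t → 𝟙 (good? t)) ⟩
              ∑ Pairs (λ p → ∑ B (λ c → 𝟙 (good? (p , c))))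
                ≡⟨ ∑-cong (λ { {a , b} _ → trans (∑-cong (λ {c} _ → 𝟙-×-dec (a ℤ.- b ∈? D) ((a ℤ.+ c ∈? P) ×-dec (b ℤ.+ c ∈? P))))
                     (∑-*ˡ B (𝟙 (a ℤ.- b ∈? D)) (λ c → 𝟙 ((a ℤ.+ c ∈? P) ×-dec (b ℤ.+ c ∈? P)))) }) ⟩
              ∑ Pairs (λ p → 𝟙 (minus p ∈? D) * completions (proj₁ p) (proj₂ p)) ∎
              where open ≡-Reasoning

            D-pairs-≤ : ∑ D (mult diffs) ≤ ∑ Pairs (λ p → 𝟙 (minus p ∈? D))
            D-pairs-≤ = begin
              ∑ D (mult diffs)                              ≡⟨ ∑-cong (λ {d} d∈ → trans (sym (*-identityʳ _)) (cong (mult diffs d *_) (sym (𝟙-yes (d ∈? D) d∈)))) ⟩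
              ∑ D (λ d → mult diffs d * 𝟙 (d ∈? D))         ≤⟨ ∑-fibre-≤ diffs (λ d → 𝟙 (d ∈? D)) D-unique ⟩
              ∑ diffs (λ d → 𝟙 (d ∈? D))                    ≡⟨ ∑-map minus Pairs (λ d → 𝟙 (d ∈? D)) ⟩
              ∑ Pairs (λ p → 𝟙 (minus p ∈? D))              ∎
              where open ≤-Reasoning

            triples-lower : ∑ D (mult diffs) * n ≤ 2 * length triples
            triples-lower = begin
              ∑ D (mult diffs) * n                                        ≤⟨ *-monoˡ-≤ n D-pairs-≤ ⟩
              ∑ Pairs (λ p → 𝟙 (minus p ∈? D)) * n                        ≡⟨ sym (∑-*ʳ Pairs n (λ p → 𝟙 (minus p ∈? D))) ⟩
              ∑ Pairs (λ p → 𝟙 (minus p ∈? D) * n)                        ≤⟨ ∑-mono each ⟩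
              ∑ Pairs (λ p → 2 * (𝟙 (minus p ∈? D) * completions (proj₁ p) (proj₂ p)))
                ≡⟨ ∑-*ˡ Pairs 2 (λ p → 𝟙 (minus p ∈? D) * completions (proj₁ p) (proj₂ p)) ⟩
              2 * ∑ Pairs (λ p → 𝟙 (minus p ∈? D) * completions (proj₁ p) (proj₂ p)) ≡⟨ cong (2 *_) (sym length-triples) ⟩
              2 * length triples ∎
              where
              open ≤-Reasoning
              commute : ∀ x y → x * (2 * y) ≡ 2 * (x * y)
              commute = solve-∀
              each : ∀ {p} → p ∈ Pairs → 𝟙 (minus p ∈? D) * n ≤ 2 * (𝟙 (minus p ∈? D) * completions (proj₁ p) (proj₂ p))
              each {a , b} p∈ = let a∈ , b∈ = ∈-cartesianProduct⁻ B B p∈ in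
                ≤-trans (*-monoʳ-≤ (𝟙 (a ℤ.- b ∈? D)) (n≤2completions a∈ b∈)) (≤-reflexive (commute (𝟙 (a ℤ.- b ∈? D)) (completions a b)))

          -- Cauchy–Schwarz over the triples (a , b , c) with a − b ∈ D and a + c , b + c ∈ P: triples with
          -- the same image (a + c , b + c) differ by a translation (t , t , − t), so E₃ counts the coincidences.
          triple-count : (∑ D (mult diffs) * n) * (∑ D (mult diffs) * n) ≤ 4 * (length popular-differences * (L * (4096 * (n * (n * n)))))
          triple-count = begin
            (∑ D (mult diffs) * n) * (∑ D (mult diffs) * n)       ≤⟨ *-mono-≤ triples-lower triples-lower ⟩
            2 * length triples * (2 * length triples)             ≡⟨ four (length triples) ⟩
            4 * (length triples * length triples)                 ≤⟨ *-monoʳ-≤ 4 triples² ⟩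
            4 * (length popular-differences * E₃)                 ≤⟨ *-monoʳ-≤ 4 (*-monoʳ-≤ (length popular-differences) E₃-bound) ⟩
            4 * (length popular-differences * (L * (4096 * (n * (n * n))))) ∎
            where
            open ≤-Reasoning
            four : ∀ t → 2 * t * (2 * t) ≡ 4 * (t * t)
            four = solve-∀

          private
            Quadruple : Set
            Quadruple = (ℤ × ℤ) × (ℤ × ℤ)

            sum-difference? : Decidable (λ (p : Quadruple) → plus (proj₁ p) ℤ.- plus (proj₂ p) ∈ D)
            sum-difference? p = plus (proj₁ p) ℤ.- plus (proj₂ p) ∈? D

          quadruples : List Quadruple
          quadruples = filter sum-difference? (cartesianProduct Pairs Pairs)

          popular-expansion : n * n * (n * n) * length popular-differences ≤ K * K * length quadruples
          popular-expansion = begin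
            n * n * (n * n) * length popular-differences
              ≡⟨ *-comm (n * n * (n * n)) _ ⟩
            length popular-differences * (n * n * (n * n))
              ≡⟨ sym (∑-const popular-differences (n * n * (n * n))) ⟩
            ∑ popular-differences (λ _ → n * n * (n * n))
              ≤⟨ ∑-mono {xs = popular-differences} (λ p∈ →
                   let p∈× , _ = ∈-filter⁻ (λ p → minus p ∈? D) {xs = cartesianProduct P P} p∈
                       s∈ , s′∈ = ∈-cartesianProduct⁻ P P p∈×
                   in ≤-trans (*-mono-≤ (proj₂ (∈-filter⁻ (popular? B) {xs = S} s∈)) (proj₂ (∈-filter⁻ (popular? B) {xs = S} s′∈)))
                        (≤-reflexive (interchange K _ _))) ⟩
            ∑ popular-differences (λ p → K * K * (ρ (proj₁ p) * ρ (proj₂ p)))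
              ≡⟨ ∑-*ˡ popular-differences (K * K) (λ p → ρ (proj₁ p) * ρ (proj₂ p)) ⟩
            K * K * ∑ popular-differences (λ p → ρ (proj₁ p) * ρ (proj₂ p))
              ≤⟨ *-monoʳ-≤ (K * K) weights ⟩
            K * K * length quadruples ∎
            where
            open ≤-Reasoning
            ρ : ℤ → ℕ
            ρ = mult (sums B)
            interchange : ∀ k a b → k * a * (k * b) ≡ k * k * (a * b)
            interchange = solve-∀
            rotate : ∀ i a b → i * (a * b) ≡ a * (b * i)
            rotate = solve-∀
            weights : ∑ popular-differences (λ p → ρ (proj₁ p) * ρ (proj₂ p)) ≤ length quadruples
            weights = begin
              ∑ popular-differences (λ p → ρ (proj₁ p) * ρ (proj₂ p))
                ≡⟨ ∑-filter (λ p → minus p ∈? D) (cartesianProduct P P) (λ p → ρ (proj₁ p) * ρ (proj₂ p)) ⟩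
              ∑ (cartesianProduct P P) (λ p → 𝟙 (minus p ∈? D) * (ρ (proj₁ p) * ρ (proj₂ p)))
                ≡⟨ ∑-× P P (λ p → 𝟙 (minus p ∈? D) * (ρ (proj₁ p) * ρ (proj₂ p))) ⟩
              ∑ P (λ s → ∑ P (λ s′ → 𝟙 (s ℤ.- s′ ∈? D) * (ρ s * ρ s′)))
                ≡⟨ ∑-cong (λ {s} _ → trans (∑-cong (λ {s′} _ → rotate (𝟙 (s ℤ.- s′ ∈? D)) (ρ s) (ρ s′)))
                     (∑-*ˡ P (ρ s) (λ s′ → ρ s′ * 𝟙 (s ℤ.- s′ ∈? D)))) ⟩
              ∑ P (λ s → ρ s * ∑ P (λ s′ → ρ s′ * 𝟙 (s ℤ.- s′ ∈? D)))
                ≤⟨ ∑-mono (λ {s} _ → *-monoʳ-≤ (ρ s) (∑-fibre-≤ (sums B) (λ s′ → 𝟙 (s ℤ.- s′ ∈? D)) P-unique)) ⟩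
              ∑ P (λ s → ρ s * ∑ (sums B) (λ s′ → 𝟙 (s ℤ.- s′ ∈? D)))
                ≤⟨ ∑-fibre-≤ (sums B) (λ s → ∑ (sums B) (λ s′ → 𝟙 (s ℤ.- s′ ∈? D))) P-unique ⟩
              ∑ (sums B) (λ s → ∑ (sums B) (λ s′ → 𝟙 (s ℤ.- s′ ∈? D)))
                ≡⟨ trans (∑-map plus Pairs _) (∑-cong (λ {p} _ → ∑-map plus Pairs (λ s′ → 𝟙 (plus p ℤ.- s′ ∈? D)))) ⟩
              ∑ Pairs (λ p → ∑ Pairs (λ q → 𝟙 (plus p ℤ.- plus q ∈? D)))
                ≡⟨ sym (∑-× Pairs Pairs (λ p → 𝟙 (sum-difference? p))) ⟩
              ∑ (cartesianProduct Pairs Pairs) (λ p → 𝟙 (sum-difference? p))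
                ≡⟨ sym (length-filter sum-difference? (cartesianProduct Pairs Pairs)) ⟩
              length quadruples ∎

          private
            incident? : Decidable (λ (p : Quadruple) → minus (proj₁ p) ℤ.+ minus (proj₂ p) ∈ A)
            incident? p = minus (proj₁ p) ℤ.+ minus (proj₂ p) ∈? A

            incident : List Quadruple
            incident = filter incident? (cartesianProduct (cartesianProduct B D) Pairs)

            -- a + e − d = b + c is read as (a − d) + (e − c) = b.
            regroup : Quadruple → Quadruple
            regroup ((a , e) , (b , c)) = (a , (a ℤ.+ e) ℤ.- (b ℤ.+ c)) , (e , c)

            regroup∈ : ∀ {p} → p ∈ quadruples → regroup p ∈ incident
            regroup∈ {(a , e) , (b , c)} p∈ =
              let p∈× , d∈ = ∈-filter⁻ sum-difference? {xs = cartesianProduct Pairs Pairs} p∈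
                  q∈ , q′∈ = ∈-cartesianProduct⁻ Pairs Pairs p∈×
                  a∈ , e∈ = ∈-cartesianProduct⁻ B B q∈
                  b∈ , c∈ = ∈-cartesianProduct⁻ B B q′∈
              in ∈-filter⁺ incident? (∈-cartesianProduct⁺ (∈-cartesianProduct⁺ a∈ d∈) (∈-Pairs e∈ c∈))
                   (subst (_∈ A) (recover a e b c) (subset b∈))
              where
              recover : ∀ a e b c → b ≡ (a ℤ.- ((a ℤ.+ e) ℤ.- (b ℤ.+ c))) ℤ.+ (e ℤ.- c)
              recover = ℤ-Ring.solve-∀

            regroup-injective : ∀ {p q} → regroup p ≡ regroup q → p ≡ q
            regroup-injective {(a , e) , (b , c)} {(a′ , e′) , (b′ , c′)} eq
              with cong (proj₁ ∘ proj₁) eq | cong proj₂ eq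
            ... | refl | refl = cong (λ b → (a , e) , (b , c)) (trans (recover a e b c)
              (trans (cong (λ d → a ℤ.+ e ℤ.- c ℤ.- d) (cong (proj₂ ∘ proj₁) eq)) (sym (recover a e b′ c))))
              where
              recover : ∀ a e b c → b ≡ a ℤ.+ e ℤ.- c ℤ.- ((a ℤ.+ e) ℤ.- (b ℤ.+ c))
              recover = ℤ-Ring.solve-∀

          -- Two successive choices of a scale, one for a - d in B - D and then, with `i` fixed, one
          -- for e - c in B - B, leave the incidences between two level sets. Each choice costs a
          -- factor `L`; j < L is recorded for the maximality of D.
          quadruples-dyadic : ∃[ i ] ∃[ j ] j < L ×
            length quadruples ≤ L * (2 ^ suc i * (L * (2 ^ suc j * J (level (differences B D) i) (level diffs j))))
          quadruples-dyadic =
            let i , _ , ≤i = ∑-upTo-max l (λ i → 2 ^ suc i * ∑ (level ws i) h)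
                j , j<L , ≤j = ∑-upTo-max l (λ j → 2 ^ suc j * ∑ (level diffs j) (λ y → ∑ (level ws i) (λ x → 𝟙 (x ℤ.+ y ∈? A))))
            in i , j , j<L , (begin
              length quadruples
                ≤⟨ injection regroup (Uniqueₚ.filter⁺ sum-difference? (Uniqueₚ.cartesianProduct⁺ Pairs-unique Pairs-unique))
                     regroup∈ (λ _ _ → regroup-injective) ⟩
              length incident
                ≡⟨ trans (length-filter incident? _) (∑-× (cartesianProduct B D) Pairs (λ p → 𝟙 (incident? p))) ⟩
              ∑ (cartesianProduct B D) (λ p → ∑ Pairs (λ q → 𝟙 (minus p ℤ.+ minus q ∈? A)))
                ≡⟨ ∑-cong (λ {p} _ → sym (∑-map minus Pairs (λ y → 𝟙 (minus p ℤ.+ y ∈? A)))) ⟩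
              ∑ (cartesianProduct B D) (λ p → h (minus p))
                ≡⟨ sym (∑-map minus (cartesianProduct B D) h) ⟩
              ∑ ws h
                ≡⟨ ∑-fibre ws h (support-unique ws) ∈-support ⟩
              ∑ (support ws) (λ x → mult ws x * h x)
                ≤⟨ ∑-dyadic ws L (λ a → a) h (λ a≤b → a≤b) (mult-differences-< D-unique) ⟩
              ∑ (upTo L) (λ i → 2 ^ suc i * ∑ (level ws i) h)
                ≤⟨ ≤i ⟩
              L * (2 ^ suc i * ∑ (level ws i) h)
                ≡⟨ cong (λ s → L * (2 ^ suc i * s)) (trans (∑-swap (level ws i) diffs (λ x y → 𝟙 (x ℤ.+ y ∈? A)))
                     (∑-fibre diffs (λ y → ∑ (level ws i) (λ x → 𝟙 (x ℤ.+ y ∈? A))) (support-unique diffs) ∈-support)) ⟩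
              L * (2 ^ suc i * ∑ (support diffs) (λ y → mult diffs y * ∑ (level ws i) (λ x → 𝟙 (x ℤ.+ y ∈? A))))
                ≤⟨ *-monoʳ-≤ L (*-monoʳ-≤ (2 ^ suc i) (≤-trans
                     (∑-dyadic diffs L (λ a → a) (λ y → ∑ (level ws i) (λ x → 𝟙 (x ℤ.+ y ∈? A))) (λ a≤b → a≤b) (mult-differences-< unique))
                     ≤j)) ⟩
              L * (2 ^ suc i * (L * (2 ^ suc j * ∑ (level diffs j) (λ y → ∑ (level ws i) (λ x → 𝟙 (x ℤ.+ y ∈? A))))))
                ≡⟨ cong (λ s → L * (2 ^ suc i * (L * (2 ^ suc j * s))))
                     (∑-swap (level diffs j) (level ws i) (λ y x → 𝟙 (x ℤ.+ y ∈? A))) ⟩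
              L * (2 ^ suc i * (L * (2 ^ suc j * J (level ws i) (level diffs j)))) ∎)
            where
            open ≤-Reasoning
            ws : List ℤ
            ws = differences B D
            h : ℤ → ℕ
            h x = ∑ diffs (λ y → 𝟙 (x ℤ.+ y ∈? A))

        regular-bound : .{{_ : NonZero n}} → PowerBound 138 1191 117 87 n L m
        regular-bound {{n≢0}} =
          let Y = level diffs
              -- The maximised quantity is the seventh power of Δ^(12/7) |D|, which is a natural
              -- number.
              j₀ , _ , maximal = argmax-upTo l (λ j → (2 ^ j) ^ 12 * length (Y j) ^ 7)
              D-unique = level-unique diffs j₀
              i , j , j<L , f₃ = quadruples-dyadic D-unique
              k , k<L , E₂≤ = E₂-dyadic
              X = level (differences B (Y j₀)) i
          in Combination.combination L n m (length (Y j₀)) (2 ^ j₀)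
               (length (popular-differences D-unique)) (length (quadruples D-unique))
               (2 ^ i) (length X) (2 ^ j) (length (Y j)) (J X (Y j)) (2 ^ k) (length (Y k)) {{n≢0}} {{m^n≢0 2 j₀}}
               (≤-trans (square (*-monoˡ-≤ n (level-∑ diffs j₀))) (triple-count D-unique))
               (popular-expansion D-unique)
               f₃
               (J³-bound (level-unique (differences B (Y j₀)) i) (level-unique diffs j))
               (level-length-≤ (Y j₀) i)
               (level-cube D-unique i)
               (level-diffs-length j)
               (maximal j<L)
               (begin
                 n ^ 4                                               ≤⟨ ^-monoˡ-≤ 4 n≤2B ⟩
                 (2 * length B) ^ 4                                  ≡⟨ fourth (length B) ⟩
                 16 * (length B * length B * (length B * length B))  ≤⟨ *-monoʳ-≤ 16 (≤-trans E₂-lower (*-monoʳ-≤ m E₂≤)) ⟩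
                 16 * (m * (L * (2 ^ suc k * 2 ^ suc k * length (Y k)))) ∎)
               (level-diffs-cube k)
               (maximal k<L)
          where
          open ≤-Reasoning
          square : ∀ {a b} → a ≤ b → a * a ≤ b * b
          square a≤b = *-mono-≤ a≤b a≤b
          fourth : ∀ b → (2 * b) * ((2 * b) * ((2 * b) * ((2 * b) * 1))) ≡ 16 * (b * b * (b * b))
          fourth = solve-∀

      sumset-bound : .{{_ : NonZero n}} → ∀ l → n < 2 ^ suc l → PowerBound 138 1191 117 87 n (suc l) m
      sumset-bound l n<2^[1+l] = Regularised.regular-bound (proj₂ regularise) l n<2^[1+l]
        where
        inhabited : ∀ {X : Set} (xs : List X) → .{{NonZero (length xs)}} → ∃[ x ] x ∈ xs
        inhabited (x ∷ _) = x , here refl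
        nonempty : ∀ {X : Set} {x : X} {xs} → x ∈ xs → NonZero (length xs)
        nonempty (here _)  = _
        nonempty (there _) = _
        instance
          m≢0 : NonZero m
          m≢0 = let a , a∈ = inhabited A in nonempty (A+A⊆S a∈ a∈)

-- Absorbing the logarithms and clearing rational exponents

module Exponents where

  open Arithmetic using (^-distribʳ-*)
  open Monomials using (PowerBound)

  open import Data.Nat.Base
  open import Data.Nat.DivMod using (m≡m%n+[m/n]*n; m%n<n; m/n*n≤m)
  open import Data.Nat.Properties
  open import Data.Nat.Tactic.RingSolver using (solve-∀)
  open import Data.Product.Base using (∃-syntax; _×_; _,_)
  open import Relation.Binary.PropositionalEquality
  open import Relation.Nullary using (yes; no)

  ^-cancelʳ-≤ : ∀ {a b} e .{{_ : NonZero e}} → a ^ e ≤ b ^ e → a ≤ b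
  ^-cancelʳ-≤ e a^e≤b^e = ≮⇒≥ λ b<a → <⇒≱ (^-monoˡ-< e b<a) a^e≤b^e

  n<2^n : ∀ n → n < 2 ^ n
  n<2^n zero    = s≤s z≤n
  n<2^n (suc n) = begin-strict
    1 + n            ≤⟨ n<2^n n ⟩
    2 ^ n            <⟨ m<m+n (2 ^ n) (<-≤-trans (>-nonZero⁻¹ (2 ^ n) {{m^n≢0 2 n}}) (m≤m+n (2 ^ n) 0)) ⟩
    2 ^ n + (2 ^ n + 0) ∎
    where open ≤-Reasoning

  -- Both bounds are used: n < 2^(l+1) makes l + 1 scales sufficient for all multiplicities, and
  -- 2^(l+1) ≤ 2n lets a power of l + 1 be absorbed into n.
  binary-length : ∀ n .{{_ : NonZero n}} → ∃[ l ] n < 2 ^ suc l × 2 ^ suc l ≤ 2 * n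
  binary-length n = search n (<-trans (n<2^n n) (^-monoʳ-< 2 (s≤s (s≤s z≤n)) (n<1+n n)))
    where
    search : ∀ l → n < 2 ^ suc l → ∃[ l ] n < 2 ^ suc l × 2 ^ suc l ≤ 2 * n
    search zero    n<2 = 0 , n<2 , *-monoʳ-≤ 2 (>-nonZero⁻¹ n)
    search (suc l) n< with 2 ^ suc l ≤? n
    ... | yes ≤n = suc l , n< , *-monoʳ-≤ 2 ≤n
    ... | no ≰n  = search l (≰⇒> ≰n)

  -- L ≤ t (⌊L/t⌋ + 1) ≤ t 2^⌊L/t⌋.
  L^t≤t^t*2^L : ∀ L t .{{_ : NonZero t}} → L ^ t ≤ t ^ t * 2 ^ L
  L^t≤t^t*2^L L t = begin
    L ^ t                     ≤⟨ ^-monoˡ-≤ t L≤ ⟩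
    (t * 2 ^ (L / t)) ^ t     ≡⟨ ^-distribʳ-* t t (2 ^ (L / t)) ⟩
    t ^ t * (2 ^ (L / t)) ^ t ≡⟨ cong (t ^ t *_) (^-*-assoc 2 (L / t) t) ⟩
    t ^ t * 2 ^ (L / t * t)   ≤⟨ *-monoʳ-≤ (t ^ t) (^-monoʳ-≤ 2 (m/n*n≤m L t)) ⟩
    t ^ t * 2 ^ L             ∎
    where
    open ≤-Reasoning
    L≤ : L ≤ t * 2 ^ (L / t)
    L≤ = begin
      L                     ≡⟨ m≡m%n+[m/n]*n L t ⟩
      L % t + L / t * t     ≤⟨ +-monoˡ-≤ (L / t * t) (<⇒≤ (m%n<n L t)) ⟩
      t + L / t * t         ≡⟨ *-comm (suc (L / t)) t ⟩
      t * suc (L / t)       ≤⟨ *-monoʳ-≤ t (n<2^n (L / t)) ⟩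
      t * 2 ^ (L / t)       ∎

  module _ (a b c e M : ℕ) .{{_ : NonZero c}} .{{_ : NonZero e}} .{{_ : NonZero M}} where

    private
      t : ℕ
      t = c * M

      instance
        t≢0 : NonZero t
        t≢0 = m*n≢0 c M
        eM≢0 : NonZero (e * M)
        eM≢0 = m*n≢0 e M

    -- In the M-th power of n^a ≤ 2^b L^c m^e the logarithm occurs as L^t with t = cM, and L^t ≤ t^t
    -- 2^L ≤ t^t · 2n. The loss is a constant and a single factor n, which amounts to n^(1/M) before
    -- the M-th power is taken.
    logarithm-constant : ℕ
    logarithm-constant = 2 ^ (b * M) * t ^ t * 2

    logarithm-constant≢0 : NonZero logarithm-constant
    logarithm-constant≢0 = m*n≢0 (2 ^ (b * M) * t ^ t) 2 {{m*n≢0 (2 ^ (b * M)) (t ^ t) {{m^n≢0 2 (b * M)}} {{m^n≢0 t t}}}}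

    private
      C : ℕ
      C = logarithm-constant

      absorb-logarithm : ∀ n L m → 2 ^ L ≤ 2 * n → n ^ a ≤ 2 ^ b * L ^ c * m ^ e →
        n ^ (a * M) ≤ C * n * m ^ (e * M)
      absorb-logarithm n L m 2^L≤ bound = begin
        n ^ (a * M)                                   ≡⟨ ^-*-assoc n a M ⟨
        (n ^ a) ^ M                                   ≤⟨ ^-monoˡ-≤ M bound ⟩
        (2 ^ b * L ^ c * m ^ e) ^ M                   ≡⟨ trans (^-distribʳ-* M (2 ^ b * L ^ c) (m ^ e))
                                                           (cong (_* (m ^ e) ^ M) (^-distribʳ-* M (2 ^ b) (L ^ c))) ⟩
        (2 ^ b) ^ M * (L ^ c) ^ M * (m ^ e) ^ M       ≡⟨ cong₂ _*_ (cong₂ _*_ (^-*-assoc 2 b M) (^-*-assoc L c M)) (^-*-assoc m e M) ⟩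
        2 ^ (b * M) * L ^ t * m ^ (e * M)             ≤⟨ *-monoˡ-≤ (m ^ (e * M)) (*-monoʳ-≤ (2 ^ (b * M)) (≤-trans (L^t≤t^t*2^L L t) (*-monoʳ-≤ (t ^ t) 2^L≤))) ⟩
        2 ^ (b * M) * (t ^ t * (2 * n)) * m ^ (e * M) ≡⟨ regroup (2 ^ (b * M)) (t ^ t) n (m ^ (e * M)) ⟩
        C * n * m ^ (e * M)                           ∎
        where
        open ≤-Reasoning
        regroup : ∀ x y n z → x * (y * (2 * n)) * z ≡ x * y * 2 * n * z
        regroup = solve-∀

      -- The last hypothesis is (p - s)/q + 1/M ≤ a/e multiplied by eMq. Both sides are compared
      -- after raising to the power q. The factor n^e is what the slack 1/M gains; it pays for the
      -- factor n lost in `absorb-logarithm`.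
      clear-exponent : ∀ n .{{_ : NonZero n}} j K p s q .{{_ : NonZero q}} →
        j ^ q * n ^ s ≤ n ^ p * K ^ q →
        p * (e * M) + e * q ≤ a * M * q + s * (e * M) →
        j ^ (e * M) * n ^ e ≤ n ^ (a * M) * K ^ (e * M)
      clear-exponent n j K p s q below near = ^-cancelʳ-≤ q (begin
        (j ^ (e * M) * n ^ e) ^ q                 ≡⟨ raise j (e * M) (n ^ e) ⟩
        j ^ (q * (e * M)) * (n ^ e) ^ q           ≡⟨ cong (j ^ (q * (e * M)) *_) (^-*-assoc n e q) ⟩
        j ^ (q * (e * M)) * n ^ (e * q)           ≤⟨ *-cancelʳ-≤ _ _ (n ^ (s * (e * M))) {{m^n≢0 n (s * (e * M))}} main ⟩
        n ^ (a * M * q) * K ^ (q * (e * M))       ≡⟨ cong (_* K ^ (q * (e * M))) (^-*-assoc n (a * M) q) ⟨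
        (n ^ (a * M)) ^ q * K ^ (q * (e * M))     ≡⟨ trans (*-comm _ (K ^ (q * (e * M)))) (trans (sym (raise K (e * M) (n ^ (a * M))))
                                                       (cong (_^ q) (*-comm (K ^ (e * M)) (n ^ (a * M))))) ⟩
        (n ^ (a * M) * K ^ (e * M)) ^ q           ∎)
        where
        open ≤-Reasoning
        raise : ∀ x k y → (x ^ k * y) ^ q ≡ x ^ (q * k) * y ^ q
        raise x k y = trans (^-distribʳ-* q (x ^ k) y) (cong (_* y ^ q) (trans (^-*-assoc x k q) (cong (x ^_) (*-comm k q))))
        swap : ∀ x y z → x * y * z ≡ x * z * y
        swap = solve-∀
        raised : j ^ (q * (e * M)) * n ^ (s * (e * M)) ≤ n ^ (p * (e * M)) * K ^ (q * (e * M))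
        raised = begin
          j ^ (q * (e * M)) * n ^ (s * (e * M))   ≡⟨ cong₂ _*_ (^-*-assoc j q (e * M)) (^-*-assoc n s (e * M)) ⟨
          (j ^ q) ^ (e * M) * (n ^ s) ^ (e * M)   ≡⟨ ^-distribʳ-* (e * M) (j ^ q) (n ^ s) ⟨
          (j ^ q * n ^ s) ^ (e * M)               ≤⟨ ^-monoˡ-≤ (e * M) below ⟩
          (n ^ p * K ^ q) ^ (e * M)               ≡⟨ ^-distribʳ-* (e * M) (n ^ p) (K ^ q) ⟩
          (n ^ p) ^ (e * M) * (K ^ q) ^ (e * M)   ≡⟨ cong₂ _*_ (^-*-assoc n p (e * M)) (^-*-assoc K q (e * M)) ⟩
          n ^ (p * (e * M)) * K ^ (q * (e * M))   ∎
        main : j ^ (q * (e * M)) * n ^ (e * q) * n ^ (s * (e * M)) ≤ n ^ (a * M * q) * K ^ (q * (e * M)) * n ^ (s * (e * M))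
        main = begin
          j ^ (q * (e * M)) * n ^ (e * q) * n ^ (s * (e * M))   ≡⟨ swap (j ^ (q * (e * M))) (n ^ (e * q)) (n ^ (s * (e * M))) ⟩
          j ^ (q * (e * M)) * n ^ (s * (e * M)) * n ^ (e * q)   ≤⟨ *-monoˡ-≤ (n ^ (e * q)) raised ⟩
          n ^ (p * (e * M)) * K ^ (q * (e * M)) * n ^ (e * q)   ≡⟨ swap (n ^ (p * (e * M))) (K ^ (q * (e * M))) (n ^ (e * q)) ⟩
          n ^ (p * (e * M)) * n ^ (e * q) * K ^ (q * (e * M))   ≡⟨ cong (_* K ^ (q * (e * M))) (^-distribˡ-+-* n (p * (e * M)) (e * q)) ⟨
          n ^ (p * (e * M) + e * q) * K ^ (q * (e * M))         ≤⟨ *-monoˡ-≤ (K ^ (q * (e * M))) (^-monoʳ-≤ n near) ⟩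
          n ^ (a * M * q + s * (e * M)) * K ^ (q * (e * M))     ≡⟨ cong (_* K ^ (q * (e * M))) (^-distribˡ-+-* n (a * M * q) (s * (e * M))) ⟩
          n ^ (a * M * q) * n ^ (s * (e * M)) * K ^ (q * (e * M)) ≡⟨ swap (n ^ (a * M * q)) (n ^ (s * (e * M))) (K ^ (q * (e * M))) ⟩
          n ^ (a * M * q) * K ^ (q * (e * M)) * n ^ (s * (e * M)) ∎

    -- If nᵃ ≤ 2ᵇ Lᶜ mᵉ with L about log₂ n, then j/K ≤ n^((p − s)/q) and (p − s)/q ≤ a/e − 1/M
    -- give j/K ≤ C m.
    power-bound : ∀ n .{{_ : NonZero n}} L m j K p s q .{{_ : NonZero q}} →
      2 ^ L ≤ 2 * n → n ^ a ≤ 2 ^ b * L ^ c * m ^ e →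
      j ^ q * n ^ s ≤ n ^ p * K ^ q →
      p * (e * M) + e * q ≤ a * M * q + s * (e * M) →
      j ≤ logarithm-constant * (m * K)
    power-bound n L m j K p s q 2^L≤ bound below near = ^-cancelʳ-≤ (e * M) (*-cancelʳ-≤ _ _ n (begin
      j ^ (e * M) * n                               ≤⟨ *-monoʳ-≤ (j ^ (e * M)) (n≤n^ e) ⟩
      j ^ (e * M) * n ^ e                           ≤⟨ clear-exponent n j K p s q below near ⟩
      n ^ (a * M) * K ^ (e * M)                     ≤⟨ *-monoˡ-≤ (K ^ (e * M)) (absorb-logarithm n L m 2^L≤ bound) ⟩
      C * n * m ^ (e * M) * K ^ (e * M)             ≡⟨ regroup C n (m ^ (e * M)) (K ^ (e * M)) ⟩
      C * (m ^ (e * M) * K ^ (e * M)) * n           ≡⟨ cong (λ x → C * x * n) (^-distribʳ-* (e * M) m K) ⟨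
      C * (m * K) ^ (e * M) * n                     ≤⟨ *-monoˡ-≤ n (*-monoˡ-≤ ((m * K) ^ (e * M)) (x≤x^ C {{logarithm-constant≢0}} (e * M))) ⟩
      C ^ (e * M) * (m * K) ^ (e * M) * n           ≡⟨ cong (_* n) (^-distribʳ-* (e * M) C (m * K)) ⟨
      (C * (m * K)) ^ (e * M) * n                   ∎))
      where
      open ≤-Reasoning
      x≤x^ : ∀ x .{{_ : NonZero x}} k .{{_ : NonZero k}} → x ≤ x ^ k
      x≤x^ x (suc k) = m≤m*n x (x ^ k) {{m^n≢0 x k}}
      n≤n^ : ∀ k .{{_ : NonZero k}} → n ≤ n ^ k
      n≤n^ k = x≤x^ n k
      regroup : ∀ c n x y → c * n * x * y ≡ c * (x * y) * n
      regroup = solve-∀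

  abstract

    -- The constant is chosen before n and hidden behind its existence, since it contains powers
    -- such as (cM)^(cM) that must stay unevaluated.
    power-bound-constant : ∀ a b c e M .{{_ : NonZero c}} .{{_ : NonZero e}} .{{_ : NonZero M}} →
      ∃[ C ] (∀ n .{{_ : NonZero n}} L m j K p s q .{{_ : NonZero q}} →
        2 ^ L ≤ 2 * n → PowerBound a b c e n L m →
        j ^ q * n ^ s ≤ n ^ p * K ^ q →
        p * (e * M) + e * q ≤ a * M * q + s * (e * M) →
        j ≤ C * (m * K))
    power-bound-constant a b c e M = logarithm-constant a b c e M ,
      λ n L m j K p s q 2^L≤ bound → power-bound a b c e M n L m j K p s q 2^L≤ (PowerBound.bound bound)

-- Convex integer sequences as input for the sumset bound

module Sequences where

  open Counting
  open Incidence
  open Monomials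
  open import Data.Empty using (⊥-elim)
  open import Data.Fin.Base as Fin using (Fin; toℕ; fromℕ<; inject₁)
  import Data.Fin.Properties as Finₚ
  open import Data.Integer.Base as ℤ using (ℤ)
  import Data.Integer.Properties as ℤₚ
  import Data.Integer.Tactic.RingSolver as ℤ-Ring
  open import Data.List.Base using (List; length; map; allFin; cartesianProduct)
  open import Data.List.Membership.Propositional using (_∈_)
  open import Data.List.Membership.Propositional.Properties using (∈-map⁺; ∈-map⁻; ∈-allFin; ∈-cartesianProduct⁺; ∈-cartesianProduct⁻; ∈-deduplicate⁻)
  open import Data.List.Properties using (length-map; length-tabulate)
  open import Data.List.Relation.Unary.Unique.Propositional using (Unique)
  import Data.List.Relation.Unary.Unique.Propositional.Properties as Uniqueₚ
  open import Data.Nat.Base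
  open import Data.Nat.Properties
  open import Data.Product.Base using (∃-syntax; _×_; _,_; proj₁; proj₂)
  open import Function.Base using (id)
  open import Relation.Binary.Definitions using (tri<; tri≈; tri>)
  open import Relation.Binary.PropositionalEquality
  open import Relation.Nullary using (Dec; yes; no)

  module ConvexSequence {n : ℕ} (p : Fin (suc n) → ℤ)
    (increasing : ∀ {i j} → i Fin.< j → p i ℤ.< p j)
    (convex : ∀ {i j : Fin n} → i Fin.< j →
              p (Fin.suc i) ℤ.- p (inject₁ i) ℤ.< p (Fin.suc j) ℤ.- p (inject₁ j))
    where

    private
      clamp : ℕ → Fin (suc n)
      clamp t = fromℕ< (s≤s (m⊓n≤n t n))

      toℕ-clamp : ∀ {t} → t ≤ n → toℕ (clamp t) ≡ t
      toℕ-clamp t≤n = trans (Finₚ.toℕ-fromℕ< _) (m≤n⇒m⊓n≡m t≤n)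

      -- Indexing by ℕ; the value is constant beyond n.
      P : ℕ → ℤ
      P t = p (clamp t)

      P-toℕ : ∀ i → P (toℕ i) ≡ p i
      P-toℕ i = cong p (Finₚ.toℕ-injective (toℕ-clamp (≤-pred (Finₚ.toℕ<n i))))

      P-suc : ∀ {t} (t<n : t < n) → P (suc t) ≡ p (Fin.suc (fromℕ< t<n))
      P-suc t<n = cong p (Finₚ.toℕ-injective (trans (toℕ-clamp t<n) (cong suc (sym (Finₚ.toℕ-fromℕ< t<n)))))

      P-inject : ∀ {t} (t<n : t < n) → P t ≡ p (inject₁ (fromℕ< t<n))
      P-inject t<n = cong p (Finₚ.toℕ-injective (trans (toℕ-clamp (<⇒≤ t<n))
        (sym (trans (Finₚ.toℕ-inject₁ _) (Finₚ.toℕ-fromℕ< t<n)))))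

      gap-< : ∀ {i k} → i < k → k < n → P (suc i) ℤ.- P i ℤ.< P (suc k) ℤ.- P k
      gap-< {i} {k} i<k k<n = subst₂ ℤ._<_
        (sym (cong₂ ℤ._-_ (P-suc i<n) (P-inject i<n))) (sym (cong₂ ℤ._-_ (P-suc k<n) (P-inject k<n)))
        (convex (subst₂ _<_ (sym (Finₚ.toℕ-fromℕ< i<n)) (sym (Finₚ.toℕ-fromℕ< k<n)) i<k))
        where i<n = <-trans i<k k<n

      -- A difference over e + 1 steps is a sum of e + 1 consecutive gaps, and each of these gaps
      -- grows when the starting index does.
      shift-< : ∀ e {i k} → i < k → k + suc e ≤ n →
                P (i + suc e) ℤ.- P i ℤ.< P (k + suc e) ℤ.- P k
      shift-< zero {i} {k} i<k k+1≤n = subst₂ (λ a b → P a ℤ.- P i ℤ.< P b ℤ.- P k) (+-comm 1 i) (+-comm 1 k)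
        (gap-< i<k (subst (_≤ n) (+-comm k 1) k+1≤n))
      shift-< (suc e) {i} {k} i<k le = subst₂ ℤ._<_ (step i) (step k)
        (ℤₚ.+-mono-< (gap-< (+-monoˡ-< (suc e) i<k) (subst (_≤ n) (+-suc k (suc e)) le))
          (shift-< e i<k (≤-trans (+-monoʳ-≤ k (n≤1+n (suc e))) le)))
        where
        telescope : ∀ a b c → (a ℤ.- b) ℤ.+ (b ℤ.- c) ≡ a ℤ.- c
        telescope = ℤ-Ring.solve-∀
        step : ∀ i → (P (suc (i + suc e)) ℤ.- P (i + suc e)) ℤ.+ (P (i + suc e) ℤ.- P i) ≡ P (i + suc (suc e)) ℤ.- P i
        step i = trans (telescope (P (suc (i + suc e))) (P (i + suc e)) (P i))
          (cong (λ t → P t ℤ.- P i) (sym (+-suc i (suc e))))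

      no-parallel-< : ∀ {i i′ k k′} → k′ ≤ n → i < k → i < i′ → i′ + k ≡ i + k′ → P i′ ℤ.+ P k ≢ P i ℤ.+ P k′
      no-parallel-< {i} {i′} {k} {k′} k′≤n i<k i<i′ eq sums =
        ℤₚ.<-irrefl steps-equal (subst₂ (λ a b → P a ℤ.- P i ℤ.< P b ℤ.- P k) i+e k+e
          (shift-< e i<k (subst (_≤ n) (sym k+e) k′≤n)))
        where
        e = i′ ∸ suc i
        i+e : i + suc e ≡ i′
        i+e = trans (+-suc i e) (m+[n∸m]≡n i<i′)
        k+e : k + suc e ≡ k′
        k+e = +-cancelˡ-≡ i _ _ (trans (sym (+-assoc i k (suc e))) (trans (cong (_+ suc e) (+-comm i k))
          (trans (+-assoc k i (suc e)) (trans (cong (k +_) i+e) (trans (+-comm k i′) eq)))))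
        l₁ : ∀ a b c → a ℤ.- b ≡ (a ℤ.+ c) ℤ.- b ℤ.- c
        l₁ = ℤ-Ring.solve-∀
        l₂ : ∀ b c d → (b ℤ.+ d) ℤ.- b ℤ.- c ≡ d ℤ.- c
        l₂ = ℤ-Ring.solve-∀
        steps-equal : P i′ ℤ.- P i ≡ P k′ ℤ.- P k
        steps-equal = trans (l₁ (P i′) (P i) (P k)) (trans (cong (λ s → s ℤ.- P i ℤ.- P k) sums) (l₂ (P i) (P k) (P k′)))

      no-parallel : ∀ {i i′ k k′} → k ≤ n → k′ ≤ n → i < k → i ≢ i′ → i′ + k ≡ i + k′ → P i′ ℤ.+ P k ≢ P i ℤ.+ P k′
      no-parallel {i} {i′} {k} {k′} k≤n k′≤n i<k i≢i′ eq sums with <-cmp i i′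
      ... | tri< i<i′ _ _ = no-parallel-< k′≤n i<k i<i′ eq sums
      ... | tri≈ _ i≡i′ _ = i≢i′ i≡i′
      ... | tri> _ _ i′<i = no-parallel-< k≤n i′<k′ i′<i (sym eq) (sym sums)
        where
        i′<k′ : i′ < k′
        i′<k′ = +-cancelʳ-< k i′ k′ (subst₂ _<_ (sym eq) (+-comm k k′) (+-monoˡ-< k′ i<k))

    -- The pairs from i to i′ and from k to k′ have the same index step and the same difference; if
    -- they started at different indices, `shift-<` would make the differences unequal. The case
    -- distinctions arrange the indices so that the step is positive and the smaller start comes
    -- first.
    parallel⇒≡ : ∀ {i i′ k k′} → i ≢ i′ → p i′ ℤ.+ p k ≡ p i ℤ.+ p k′ → toℕ i′ + toℕ k ≡ toℕ i + toℕ k′ → i ≡ k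
    parallel⇒≡ {i} {i′} {k} {k′} i≢i′ sums eq with <-cmp (toℕ i) (toℕ k)
    ... | tri< i<k _ _ = ⊥-elim (no-parallel (bound k) (bound k′) i<k (λ e → i≢i′ (Finₚ.toℕ-injective e)) eq
        (subst₂ _≡_ (sym (cong₂ ℤ._+_ (P-toℕ i′) (P-toℕ k))) (sym (cong₂ ℤ._+_ (P-toℕ i) (P-toℕ k′))) sums))
      where
      bound : ∀ (i : Fin (suc n)) → toℕ i ≤ n
      bound i = ≤-pred (Finₚ.toℕ<n i)
    ... | tri≈ _ i≡k _ = Finₚ.toℕ-injective i≡k
    ... | tri> _ _ k<i = ⊥-elim (no-parallel (bound i) (bound i′) k<i k≢k′
        (trans (+-comm (toℕ k′) (toℕ i)) (trans (sym eq) (+-comm (toℕ i′) (toℕ k))))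
        (subst₂ _≡_ (sym (cong₂ ℤ._+_ (P-toℕ k′) (P-toℕ i))) (sym (cong₂ ℤ._+_ (P-toℕ k) (P-toℕ i′)))
          (trans (ℤₚ.+-comm (p k′) (p i)) (trans (sym sums) (ℤₚ.+-comm (p i′) (p k))))))
      where
      bound : ∀ (i : Fin (suc n)) → toℕ i ≤ n
      bound i = ≤-pred (Finₚ.toℕ<n i)
      k≢k′ : toℕ k ≢ toℕ k′
      k≢k′ k≡k′ = i≢i′ (Finₚ.toℕ-injective (sym (+-cancelʳ-≡ (toℕ k) _ _ (trans eq (cong (toℕ i +_) (sym k≡k′))))))

    injective : ∀ {i j} → p i ≡ p j → i ≡ j
    injective {i} {j} eq with <-cmp (toℕ i) (toℕ j)
    ... | tri< i<j _ _ = ⊥-elim (ℤₚ.<-irrefl eq (increasing i<j))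
    ... | tri≈ _ i≡j _ = Finₚ.toℕ-injective i≡j
    ... | tri> _ _ j<i = ⊥-elim (ℤₚ.<-irrefl (sym eq) (increasing j<i))

    reflects-< : ∀ {i j} → p i ℤ.< p j → toℕ i < toℕ j
    reflects-< {i} {j} pi<pj with <-cmp (toℕ i) (toℕ j)
    ... | tri< i<j _ _ = i<j
    ... | tri≈ _ i≡j _ = ⊥-elim (ℤₚ.<-irrefl (cong p (Finₚ.toℕ-injective i≡j)) pi<pj)
    ... | tri> _ _ j<i = ⊥-elim (ℤₚ.<-asym pi<pj (increasing j<i))

    private
      A : List ℤ
      A = map p (allFin (suc n))

      length-A : length A ≡ suc n
      length-A = trans (length-map p (allFin (suc n))) (length-tabulate {n = suc n} id)

      index : ∀ {v} → Dec (∃[ i ] p i ≡ v) → ℕ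
      index (yes (i , _)) = toℕ i
      index (no _)        = 0

      idx : ℤ → ℕ
      idx v = index (Finₚ.any? (λ i → p i ℤₚ.≟ v))

      idx-p : ∀ i → idx (p i) ≡ toℕ i
      idx-p i = go (Finₚ.any? (λ j → p j ℤₚ.≟ p i))
        where
        go : (d : Dec (∃[ j ] p j ≡ p i)) → index d ≡ toℕ i
        go (yes (j , eq)) = cong toℕ (injective eq)
        go (no none)      = ⊥-elim (none (i , refl))

      idx-mono : ∀ {v w} → v ∈ A → w ∈ A → v ℤ.< w → idx v < idx w
      idx-mono v∈ w∈ v<w with ∈-map⁻ p v∈ | ∈-map⁻ p w∈
      ... | i , _ , refl | j , _ , refl = subst₂ _<_ (sym (idx-p i)) (sym (idx-p j)) (reflects-< v<w)

      idx-< : ∀ {v} → v ∈ A → idx v < length A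
      idx-< v∈ with ∈-map⁻ p v∈
      ... | i , _ , refl = subst₂ _<_ (sym (idx-p i)) (sym length-A) (Finₚ.toℕ<n i)

      idx-convex : ∀ {v v′ w w′} → v ∈ A → v′ ∈ A → w ∈ A → w′ ∈ A → v ≢ v′ →
                   v′ ℤ.+ w ≡ v ℤ.+ w′ → idx v′ + idx w ≡ idx v + idx w′ → v ≡ w
      idx-convex v∈ v′∈ w∈ w′∈ v≢v′ sums eq with ∈-map⁻ p v∈ | ∈-map⁻ p v′∈ | ∈-map⁻ p w∈ | ∈-map⁻ p w′∈
      ... | i , _ , refl | i′ , _ , refl | k , _ , refl | k′ , _ , refl = cong p (parallel⇒≡ (λ i≡i′ → v≢v′ (cong p i≡i′)) sums
        (subst₂ _≡_ (cong₂ _+_ (idx-p i′) (idx-p k)) (cong₂ _+_ (idx-p i) (idx-p k′)) eq))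

      A-unique : Unique A
      A-unique = Uniqueₚ.map⁺ injective (Uniqueₚ.allFin⁺ (suc n))

    open Multiplicity ℤₚ._≟_ using (support; support-unique; ∈-support)

    -- `κ` will label each sum of two reals by its place in an enumeration of the real sumset. Equal
    -- labels force equal integer sums, so the integer sumset has at most m elements, even if the
    -- model has additional coincidences.
    module _ {m : ℕ} (κ : Fin (suc n) → Fin (suc n) → Fin m)
      (κ-sum : ∀ {i j i′ j′} → κ i j ≡ κ i′ j′ → p i ℤ.+ p j ≡ p i′ ℤ.+ p j′) where

      private
        A+A S : List ℤ
        A+A = map (λ ab → proj₁ ab ℤ.+ proj₂ ab) (cartesianProduct A A)
        S = support A+A

        A+A⊆S : ∀ {a b} → a ∈ A → b ∈ A → a ℤ.+ b ∈ S
        A+A⊆S a∈ b∈ = ∈-support (∈-map⁺ (λ ab → proj₁ ab ℤ.+ proj₂ ab) (∈-cartesianProduct⁺ a∈ b∈))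

        Labelled : ℤ → Fin m → Set
        Labelled s y = ∃[ i ] ∃[ j ] s ≡ p i ℤ.+ p j × κ i j ≡ y

        label : ∀ {s} → s ∈ S → ∃[ y ] y ∈ allFin m × Labelled s y
        label s∈ with ∈-map⁻ (λ ab → proj₁ ab ℤ.+ proj₂ ab) (∈-deduplicate⁻ ℤₚ._≟_ A+A s∈)
        ... | (a , b) , ab∈ , refl with ∈-cartesianProduct⁻ A A ab∈
        ... | a∈ , b∈ with ∈-map⁻ p a∈ | ∈-map⁻ p b∈
        ... | i , _ , refl | j , _ , refl = κ i j , ∈-allFin (κ i j) , i , j , refl , refl

        S≤m : length S ≤ m
        S≤m = ≤-trans (relation-injection Labelled (support-unique A+A) label
          (λ { _ _ (i , j , refl , eq) (i′ , j′ , refl , eq′) → κ-sum (trans eq (sym eq′)) }))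
          (≤-reflexive (length-tabulate {n = m} id))

      convex-sequence-bound : ∀ l → suc n < 2 ^ suc l → PowerBound 138 1191 117 87 (suc n) (suc l) m
      convex-sequence-bound l n< = power-bound-mono S≤m
        (subst (λ k → PowerBound 138 1191 117 87 k (suc l) (length S)) length-A
          (ConvexSets.Sumset.sumset-bound A idx idx-mono idx-< idx-convex A-unique S (support-unique A+A) A+A⊆S
            {{subst NonZero (sym length-A) _}} l (subst (_< 2 ^ suc l) (sym length-A) n<)))

-- Simultaneous approximation and rounding

module Diophantine where

  open Arithmetic using (same-quotient-<)
  open import Data.Fin.Base using (Fin; toℕ; fromℕ<; funToFin; finToFun)
  import Data.Fin.Properties as Finₚ
  open import Data.Integer.Base as ℤ using (ℤ; +_; _+_; _*_; _-_; _<_; _≤_)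
  open import Data.Integer.DivMod using (_/ℕ_; _%ℕ_; n%ℕd<d; a≡a%ℕn+[a/ℕn]*n)
  open import Data.Integer.Properties
  open import Data.Integer.Tactic.RingSolver using (solve-∀)
  open import Data.Nat.Base as ℕ using (ℕ; suc; z≤n)
  import Data.Nat.DivMod as ℕ
  import Data.Nat.Properties as ℕₚ
  open import Data.Product.Base using (Σ; ∃-syntax; _×_; _,_; proj₁; proj₂)
  open import Relation.Binary.PropositionalEquality

  -- |x - y| < d/8. An eighth, because expressions in four terms will be rounded, and their total
  -- error must stay below d/2.
  Near : ℕ → ℤ → ℤ → Set
  Near d x y = + 8 * (x - y) < + d × + 8 * (y - x) < + d

  abstract

    -- Pigeonhole for the multipliers jQ with 0 ≤ j ≤ 8^n: the residues of jQ · u i modulo d fall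
    -- into 8 boxes for each i, so two multipliers agree in every box and their difference is q.
    -- Taking only multiples of `Q` gives q ≥ Q, and the upper bound on q does not involve d or u.
    dirichlet : ∀ n (u : Fin n → ℤ) d .{{_ : ℕ.NonZero d}} Q →
      ∃[ q ] Q ℕ.≤ q × q ℕ.≤ 8 ℕ.^ n ℕ.* Q × Σ (Fin n → ℤ) λ p → (∀ i → Near d (+ q * u i) (+ d * p i))
    dirichlet n u d Q =
      let j , j′ , j<j′ , eq = Finₚ.pigeonhole (ℕₚ.n<1+n (8 ℕ.^ n)) (λ j → funToFin (box j))
          e = toℕ j′ ℕ.∸ toℕ j
      in e ℕ.* Q
       , ℕₚ.≤-trans (ℕₚ.≤-reflexive (sym (ℕₚ.*-identityˡ Q))) (ℕₚ.*-monoˡ-≤ Q (ℕₚ.m<n⇒0<n∸m j<j′))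
       , ℕₚ.*-monoˡ-≤ Q (ℕₚ.≤-trans (ℕₚ.m∸n≤m (toℕ j′) (toℕ j)) (ℕₚ.≤-pred (Finₚ.toℕ<n j′)))
       , (λ i → quot i j′ - quot i j)
       , λ i → near i j j′ (ℕₚ.<⇒≤ j<j′) (same-box i j j′ eq)
      where
      multiple : Fin n → Fin (suc (8 ℕ.^ n)) → ℤ
      multiple i j = + (toℕ j ℕ.* Q) * u i
      rem : Fin n → Fin (suc (8 ℕ.^ n)) → ℕ
      rem i j = multiple i j %ℕ d
      quot : Fin n → Fin (suc (8 ℕ.^ n)) → ℤ
      quot i j = multiple i j /ℕ d
      rem-< : ∀ i j → 8 ℕ.* rem i j ℕ.< 8 ℕ.* d
      rem-< i j = ℕₚ.*-monoʳ-< 8 (n%ℕd<d (multiple i j) d)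
      box : Fin (suc (8 ℕ.^ n)) → Fin n → Fin 8
      box j i = fromℕ< (ℕ.m<n*o⇒m/o<n {n = 8} {o = d} (rem-< i j))
      same-box : ∀ i j j′ → funToFin (box j) ≡ funToFin (box j′) → 8 ℕ.* rem i j ℕ./ d ≡ 8 ℕ.* rem i j′ ℕ./ d
      same-box i j j′ eq = trans (sym (Finₚ.toℕ-fromℕ< _)) (trans (cong toℕ
        (trans (sym (Finₚ.finToFun-funToFin (box j) i)) (trans (cong (λ f → finToFun f i) eq) (Finₚ.finToFun-funToFin (box j′) i))))
        (Finₚ.toℕ-fromℕ< _))
      bound : ∀ i j j′ → 8 ℕ.* rem i j ℕ./ d ≡ 8 ℕ.* rem i j′ ℕ./ d → + 8 * (+ rem i j - + rem i j′) < + d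
      bound i j j′ eq = subst₂ _<_ (lhs (+ rem i j) (+ rem i j′)) (rhs (+ rem i j′) (+ d))
        (+-monoˡ-< (ℤ.- (+ 8 * + rem i j′)) (subst₂ _<_ (pos-* 8 (rem i j)) (cong (_+ + d) (pos-* 8 (rem i j′)))
          (ℤ.+<+ (same-quotient-< (8 ℕ.* rem i j) (8 ℕ.* rem i j′) d eq))))
        where
        lhs : ∀ a b → + 8 * a + ℤ.- (+ 8 * b) ≡ + 8 * (a - b)
        lhs = solve-∀
        rhs : ∀ b d → + 8 * b + d + ℤ.- (+ 8 * b) ≡ d
        rhs = solve-∀
      near : ∀ i j j′ → toℕ j ℕ.≤ toℕ j′ → 8 ℕ.* rem i j ℕ./ d ≡ 8 ℕ.* rem i j′ ℕ./ d →
        Near d (+ ((toℕ j′ ℕ.∸ toℕ j) ℕ.* Q) * u i) (+ d * (quot i j′ - quot i j))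
      near i j j′ j≤j′ eq =
          subst (λ x → + 8 * x < + d) (sym forward) (bound i j′ j (sym eq))
        , subst (λ x → + 8 * x < + d) (sym backward) (bound i j j′ eq)
        where
        E : ℕ
        E = (toℕ j′ ℕ.∸ toℕ j) ℕ.* Q
        split : multiple i j′ ≡ + E * u i + multiple i j
        split = trans (cong (λ t → + (t ℕ.* Q) * u i) (sym (ℕₚ.m∸n+n≡m j≤j′)))
          (trans (cong (λ t → + t * u i) (ℕₚ.*-distribʳ-+ Q (toℕ j′ ℕ.∸ toℕ j) (toℕ j)))
            (trans (cong (_* u i) (pos-+ E (toℕ j ℕ.* Q))) (*-distribʳ-+ (u i) (+ E) (+ (toℕ j ℕ.* Q)))))
        division : ∀ j → multiple i j ≡ + rem i j + quot i j * + d
        division j = a≡a%ℕn+[a/ℕn]*n (multiple i j) d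
        l₁ : ∀ x y d a b → x - d * (a - b) ≡ (x + y) - a * d - (y - b * d)
        l₁ = solve-∀
        l₂ : ∀ r a d r′ b → (r + a * d) - a * d - ((r′ + b * d) - b * d) ≡ r - r′
        l₂ = solve-∀
        l₃ : ∀ x y → x - y ≡ ℤ.- (y - x)
        l₃ = solve-∀
        forward : + E * u i - + d * (quot i j′ - quot i j) ≡ + rem i j′ - + rem i j
        forward = trans (l₁ (+ E * u i) (multiple i j) (+ d) (quot i j′) (quot i j))
          (trans (cong₂ (λ x y → x - quot i j′ * + d - (y - quot i j * + d)) (trans (sym split) (division j′)) (division j))
            (l₂ (+ rem i j′) (quot i j′) (+ d) (+ rem i j) (quot i j)))
        backward : + d * (quot i j′ - quot i j) - + E * u i ≡ + rem i j - + rem i j′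
        backward = trans (l₃ (+ d * (quot i j′ - quot i j)) (+ E * u i)) (trans (cong ℤ.-_ forward) (sym (l₃ (+ rem i j) (+ rem i j′))))

  module Rounding {n : ℕ} (u p : Fin n → ℤ) (d q : ℕ) .{{_ : ℕ.NonZero d}}
    (near : ∀ i → Near d (+ q * u i) (+ d * p i)) where

    -- One shape for three purposes: a difference of two terms (with c = e), a difference of two
    -- gaps, and a difference of two sums of two terms.
    combine₄ : (Fin n → ℤ) → Fin n → Fin n → Fin n → Fin n → ℤ
    combine₄ x a b c e = (x a - x b) - (x c - x e)

    private
      four-error : ∀ a b c e → (s : ℤ) →
        + 8 * (s * (+ q * u a - + d * p a)) < + d → + 8 * (s * (+ d * p b - + q * u b)) < + d →
        + 8 * (s * (+ d * p c - + q * u c)) < + d → + 8 * (s * (+ q * u e - + d * p e)) < + d →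
        + 2 * (s * (+ q * combine₄ u a b c e - + d * combine₄ p a b c e)) < + d
      four-error a b c e s h₁ h₂ h₃ h₄ = *-cancelˡ-<-nonNeg (+ 4) (subst₂ _<_
        (l₁ s (+ q) (+ d) (u a) (u b) (u c) (u e) (p a) (p b) (p c) (p e)) (l₂ (+ d))
        (+-mono-< (+-mono-< h₁ h₂) (+-mono-< h₃ h₄)))
        where
        l₁ : ∀ s q d ua ub uc ue pa pb pc pe →
          (+ 8 * (s * (q * ua - d * pa)) + + 8 * (s * (d * pb - q * ub))) + (+ 8 * (s * (d * pc - q * uc)) + + 8 * (s * (q * ue - d * pe)))
            ≡ + 4 * (+ 2 * (s * (q * ((ua - ub) - (uc - ue)) - d * ((pa - pb) - (pc - pe)))))
        l₁ = solve-∀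
        l₂ : ∀ d → (d + d) + (d + d) ≡ + 4 * d
        l₂ = solve-∀

    excess : ∀ a b c e → + 2 * (+ q * combine₄ u a b c e - + d * combine₄ p a b c e) < + d
    excess a b c e = subst (λ x → + 2 * x < + d) (*-identityˡ _) (four-error a b c e (+ 1)
      (pos (+ q * u a - + d * p a) (proj₁ (near a))) (pos (+ d * p b - + q * u b) (proj₂ (near b)))
      (pos (+ d * p c - + q * u c) (proj₂ (near c))) (pos (+ q * u e - + d * p e) (proj₁ (near e))))
      where
      pos : ∀ x → + 8 * x < + d → + 8 * (+ 1 * x) < + d
      pos x = subst (λ y → + 8 * y < + d) (sym (*-identityˡ x))

    deficit : ∀ a b c e → + 2 * (+ d * combine₄ p a b c e - + q * combine₄ u a b c e) < + d
    deficit a b c e = subst (λ x → + 2 * x < + d) (l₀ (+ q * combine₄ u a b c e) (+ d * combine₄ p a b c e)) (four-error a b c e (ℤ.- + 1)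
      (flip (+ d * p a) (+ q * u a) (proj₂ (near a))) (flip (+ q * u b) (+ d * p b) (proj₁ (near b)))
      (flip (+ q * u c) (+ d * p c) (proj₁ (near c))) (flip (+ d * p e) (+ q * u e) (proj₂ (near e))))
      where
      l₀ : ∀ x y → ℤ.- + 1 * (x - y) ≡ y - x
      l₀ = solve-∀
      flip : ∀ x y → + 8 * (x - y) < + d → + 8 * (ℤ.- + 1 * (y - x)) < + d
      flip x y = subst (λ z → + 8 * z < + d) (sym (l₀ y x))

    -- The error is below d/2, so a scaled value of at least d stays positive.
    combine-pos : ∀ a b c e → + d ≤ + q * combine₄ u a b c e → + 0 < combine₄ p a b c e
    combine-pos a b c e d≤ = *-cancelˡ-<-nonNeg (+ d) (*-cancelˡ-<-nonNeg (+ 2) (begin-strict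
      + 2 * (+ d * + 0)                                  ≡⟨ l₀ (+ d) ⟩
      + 0                                                ≤⟨ ℤ.+≤+ z≤n ⟩
      + d                                                ≡⟨ l₁ (+ d) ⟩
      + 2 * + d - + d                                    ≤⟨ +-monoˡ-≤ (ℤ.- + d) (*-monoˡ-≤-nonNeg (+ 2) d≤) ⟩
      + 2 * x - + d                                      <⟨ +-monoʳ-< (+ 2 * x) (neg-mono-< (excess a b c e)) ⟩
      + 2 * x - + 2 * (x - + d * y)                      ≡⟨ l₂ x (+ d * y) ⟩
      + 2 * (+ d * y)                                    ∎))
      where
      open ≤-Reasoning
      x = + q * combine₄ u a b c e
      y = combine₄ p a b c e
      l₀ : ∀ d → + 2 * (d * + 0) ≡ + 0
      l₀ = solve-∀
      l₁ : ∀ d → d ≡ + 2 * d - d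
      l₁ = solve-∀
      l₂ : ∀ x z → + 2 * x - + 2 * (x - z) ≡ + 2 * z
      l₂ = solve-∀

    -- A scaled value of at most d/2 plus an error below d/2 is less than d; after division by d, an
    -- integer below 1 remains.
    combine-≤0 : ∀ a b c e → + 2 * (+ q * combine₄ u a b c e) ≤ + d → combine₄ p a b c e ≤ + 0
    combine-≤0 a b c e ≤d = ≮⇒≥ λ 0<y → <-irrefl refl (begin-strict
      + 2 * + d                            ≡⟨ cong (+ 2 *_) (sym (*-identityʳ (+ d))) ⟩
      + 2 * (+ d * + 1)                    ≤⟨ *-monoˡ-≤-nonNeg (+ 2) (*-monoˡ-≤-nonNeg (+ d) (i<j⇒suc[i]≤j 0<y)) ⟩
      + 2 * (+ d * y)                      ≡⟨ l₀ (+ d * y) x ⟩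
      + 2 * (+ d * y - x) + + 2 * x        <⟨ +-mono-<-≤ (deficit a b c e) ≤d ⟩
      + d + + d                            ≡⟨ l₁ (+ d) ⟩
      + 2 * + d                            ∎)
      where
      open ≤-Reasoning
      x = + q * combine₄ u a b c e
      y = combine₄ p a b c e
      l₀ : ∀ z x → + 2 * z ≡ + 2 * (z - x) + + 2 * x
      l₀ = solve-∀
      l₁ : ∀ d → d + d ≡ + 2 * d
      l₁ = solve-∀

-- Integer models of convex sets of reals

module Approximation where

  open import Defs using (ℝ; seq; _≈_; StrictlyIncreasing; gaps)
  import Defs as ℝ
  open Diophantine
  open import Data.Empty using (⊥-elim)
  open import Data.Fin.Base as Fin using (Fin; inject₁)
  import Data.Fin.Properties as Finₚ
  open import Data.Integer.Base as ℤ using (ℤ; +_)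
  import Data.Integer.Properties as ℤₚ
  import Data.Integer.Tactic.RingSolver as ℤ-Ring
  open import Data.Nat.Base as ℕ using (ℕ; zero; suc)
  import Data.Nat.Properties as ℕₚ
  import Data.Nat.Tactic.RingSolver as ℕ-Ring
  open import Data.Product.Base using (Σ; ∃-syntax; _×_; _,_; proj₁; proj₂)
  open import Data.Rational.Base as ℚ using (ℚ; 0ℚ; 1ℚ; _/_; _+_; _*_; _-_; _≤_; _<_; ∣_∣; ↥_; ↧_; ↧ₙ_; toℚᵘ; fromℚᵘ)
  open import Data.Rational.Properties
  open import Data.Rational.Solver using (module +-*-Solver)
  import Data.Rational.Unnormalised.Base as ℚᵘ
  import Data.Rational.Unnormalised.Properties as ℚᵘₚ
  open import Data.Sum.Base using (inj₁; inj₂)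
  open import Relation.Binary.PropositionalEquality
  open import Relation.Nullary using (Dec; yes; no)

  ι : ℤ → ℚ
  ι z = z / 1

  unit : ℕ → ℚ
  unit M = + 1 / suc M

  private
    fromℚᵘ-+ : ∀ p q → fromℚᵘ (p ℚᵘ.+ q) ≡ fromℚᵘ p + fromℚᵘ q
    fromℚᵘ-+ p q = toℚᵘ-injective (ℚᵘₚ.≃-trans (toℚᵘ-fromℚᵘ (p ℚᵘ.+ q)) (ℚᵘₚ.≃-trans
      (ℚᵘₚ.+-cong (ℚᵘₚ.≃-sym (toℚᵘ-fromℚᵘ p)) (ℚᵘₚ.≃-sym (toℚᵘ-fromℚᵘ q)))
      (ℚᵘₚ.≃-sym (toℚᵘ-homo-+ (fromℚᵘ p) (fromℚᵘ q)))))

    fromℚᵘ-* : ∀ p q → fromℚᵘ (p ℚᵘ.* q) ≡ fromℚᵘ p * fromℚᵘ q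
    fromℚᵘ-* p q = toℚᵘ-injective (ℚᵘₚ.≃-trans (toℚᵘ-fromℚᵘ (p ℚᵘ.* q)) (ℚᵘₚ.≃-trans
      (ℚᵘₚ.*-cong (ℚᵘₚ.≃-sym (toℚᵘ-fromℚᵘ p)) (ℚᵘₚ.≃-sym (toℚᵘ-fromℚᵘ q)))
      (ℚᵘₚ.≃-sym (toℚᵘ-homo-* (fromℚᵘ p) (fromℚᵘ q)))))

  ι-+ : ∀ x y → ι (x ℤ.+ y) ≡ ι x + ι y
  ι-+ x y = trans (fromℚᵘ-cong {ℚᵘ.mkℚᵘ (x ℤ.+ y) 0} {ℚᵘ.mkℚᵘ x 0 ℚᵘ.+ ℚᵘ.mkℚᵘ y 0} (ℚᵘ.*≡* (lem x y)))
    (fromℚᵘ-+ (ℚᵘ.mkℚᵘ x 0) (ℚᵘ.mkℚᵘ y 0))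
    where
    lem : ∀ x y → (x ℤ.+ y) ℤ.* + 1 ≡ (x ℤ.* + 1 ℤ.+ y ℤ.* + 1) ℤ.* + 1
    lem = ℤ-Ring.solve-∀

  ι-* : ∀ x y → ι (x ℤ.* y) ≡ ι x * ι y
  ι-* x y = fromℚᵘ-* (ℚᵘ.mkℚᵘ x 0) (ℚᵘ.mkℚᵘ y 0)

  ι-- : ∀ x y → ι (x ℤ.- y) ≡ ι x - ι y
  ι-- x y = trans (lem (ι (x ℤ.- y)) (ι y)) (cong (_- ι y) (trans (sym (ι-+ (x ℤ.- y) y)) (cong ι (lem′ x y))))
    where
    open +-*-Solver
    lem : ∀ a b → a ≡ a + b - b
    lem = solve 2 (λ a b → a := a :+ b :- b) refl
    lem′ : ∀ x y → x ℤ.- y ℤ.+ y ≡ x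
    lem′ = ℤ-Ring.solve-∀

  ι-mono : ∀ {x y} → x ℤ.≤ y → ι x ≤ ι y
  ι-mono {x} {y} x≤y = toℚᵘ-cancel-≤ (begin
    toℚᵘ (ι x)     ≃⟨ toℚᵘ-fromℚᵘ (ℚᵘ.mkℚᵘ x 0) ⟩
    ℚᵘ.mkℚᵘ x 0    ≤⟨ ℚᵘ.*≤* (ℤₚ.*-monoʳ-≤-nonNeg (+ 1) x≤y) ⟩
    ℚᵘ.mkℚᵘ y 0    ≃⟨ ℚᵘₚ.≃-sym (toℚᵘ-fromℚᵘ (ℚᵘ.mkℚᵘ y 0)) ⟩
    toℚᵘ (ι y)     ∎)
    where open ℚᵘₚ.≤-Reasoning

  ι-cancel : ∀ {x y} → ι x ≤ ι y → x ℤ.≤ y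
  ι-cancel {x} {y} ιx≤ιy = ℤₚ.*-cancelʳ-≤-pos x y (+ 1) (ℚᵘₚ.drop-*≤* (begin
    ℚᵘ.mkℚᵘ x 0    ≃⟨ ℚᵘₚ.≃-sym (toℚᵘ-fromℚᵘ (ℚᵘ.mkℚᵘ x 0)) ⟩
    toℚᵘ (ι x)     ≤⟨ toℚᵘ-mono-≤ ιx≤ιy ⟩
    toℚᵘ (ι y)     ≃⟨ toℚᵘ-fromℚᵘ (ℚᵘ.mkℚᵘ y 0) ⟩
    ℚᵘ.mkℚᵘ y 0    ∎))
    where open ℚᵘₚ.≤-Reasoning

  ι-nonNeg : ∀ k → ℚ.NonNegative (ι (+ k))
  ι-nonNeg k = normalize-nonNeg k 1

  unit-* : ∀ M → unit M * ι (+ suc M) ≡ 1ℚ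
  unit-* M = trans (sym (fromℚᵘ-* (ℚᵘ.mkℚᵘ (+ 1) M) (ℚᵘ.mkℚᵘ (+ suc M) 0)))
    (fromℚᵘ-cong {ℚᵘ.mkℚᵘ (+ 1) M ℚᵘ.* ℚᵘ.mkℚᵘ (+ suc M) 0} {ℚᵘ.1ℚᵘ}
      (ℚᵘ.*≡* (trans (ℤₚ.*-identityʳ _) (cong (λ k → + 1 ℤ.* + k) (sym (ℕₚ.*-identityʳ (suc M)))))))

  numerator-unit : ∀ j k → + j / suc k ≡ ι (+ j) * unit k
  numerator-unit j k = trans (fromℚᵘ-cong {ℚᵘ.mkℚᵘ (+ j) k} {ℚᵘ.mkℚᵘ (+ j) 0 ℚᵘ.* ℚᵘ.mkℚᵘ (+ 1) k}
      (ℚᵘ.*≡* (cong₂ ℤ._*_ (sym (ℤₚ.*-identityʳ (+ j))) (cong (λ t → + suc t) (ℕₚ.+-identityʳ k)))))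
    (fromℚᵘ-* (ℚᵘ.mkℚᵘ (+ j) 0) (ℚᵘ.mkℚᵘ (+ 1) k))

  half-unit : ∀ M → unit (suc (M ℕ.+ M)) + unit (suc (M ℕ.+ M)) ≡ unit M
  half-unit M = trans (sym (fromℚᵘ-+ h h)) (fromℚᵘ-cong {h ℚᵘ.+ h} {ℚᵘ.mkℚᵘ (+ 1) M} (ℚᵘ.*≡* (cong +_ (lem M))))
    where
    h = ℚᵘ.mkℚᵘ (+ 1) (suc (M ℕ.+ M))
    lem : ∀ M → (1 ℕ.* suc (suc (M ℕ.+ M)) ℕ.+ 1 ℕ.* suc (suc (M ℕ.+ M))) ℕ.* suc M ≡ 1 ℕ.* (suc (suc (M ℕ.+ M)) ℕ.* suc (suc (M ℕ.+ M)))
    lem = ℕ-Ring.solve-∀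

  clear-denominator : ∀ x → x * ι (↧ x) ≡ ι (↥ x)
  clear-denominator x@(ℚ.mkℚ z d _) = trans (cong (_* ι (+ suc d)) (sym (fromℚᵘ-toℚᵘ x)))
    (trans (sym (fromℚᵘ-* (ℚᵘ.mkℚᵘ z d) (ℚᵘ.mkℚᵘ (+ suc d) 0)))
      (fromℚᵘ-cong {ℚᵘ.mkℚᵘ z d ℚᵘ.* ℚᵘ.mkℚᵘ (+ suc d) 0} {ℚᵘ.mkℚᵘ z 0}
        (ℚᵘ.*≡* (trans (ℤₚ.*-identityʳ _) (cong (λ k → z ℤ.* + k) (sym (ℕₚ.*-identityʳ (suc d))))))))

  unit-pos : ∀ M → 0ℚ < unit M
  unit-pos M = positive⁻¹ (unit M) {{normalize-pos 1 (suc M)}}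

  private
    unit-≤ : ∀ M x → 1ℚ ≤ x * ι (+ suc M) → unit M ≤ x
    unit-≤ M x h = *-cancelʳ-≤-pos (ι (+ suc M)) {{normalize-pos (suc M) 1}} (≤-trans (≤-reflexive (unit-* M)) h)

  unit-antimono : ∀ {M N} → M ℕ.≤ N → unit N ≤ unit M
  unit-antimono {M} {N} M≤N = unit-≤ N (unit M) (≤-trans (≤-reflexive (sym (unit-* M)))
    (*-monoˡ-≤-nonNeg (unit M) {{normalize-nonNeg 1 (suc M)}} (ι-mono (ℤ.+≤+ (ℕ.s≤s M≤N)))))

  archimedean : ∀ ε → 0ℚ < ε → ∃[ M ] unit M ≤ ε
  archimedean ε@(ℚ.mkℚ z d _) 0<ε = d , unit-≤ d ε (≤-trans (ι-mono {+ 1} {z} 1≤z) (≤-reflexive (sym (clear-denominator ε))))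
    where
    0<z : + 0 ℤ.< z
    0<z = ℤₚ.positive⁻¹ z {{ℚ.positive 0<ε}}
    1≤z : + 1 ℤ.≤ z
    1≤z = ℤₚ.i<j⇒suc[i]≤j 0<z

  common-denominator : ∀ n (x : Fin n → ℚ) → ∃[ d ] ℕ.NonZero d × Σ (Fin n → ℤ) λ u → ∀ i → x i * ι (+ d) ≡ ι (u i)
  common-denominator zero    x = 1 , _ , (λ ()) , λ ()
  common-denominator (suc n) x =
    let d , d≢0 , u , eq = common-denominator n (λ i → x (Fin.suc i))
        d₀ = ↧ₙ (x Fin.zero)
    in d₀ ℕ.* d , ℕₚ.m*n≢0 d₀ d {{_}} {{d≢0}}
     , (λ { Fin.zero → ↥ (x Fin.zero) ℤ.* + d ; (Fin.suc i) → u i ℤ.* + d₀ })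
     , λ { Fin.zero → trans (expand d₀ d (x Fin.zero)) (trans (cong (_* ι (+ d)) (clear-denominator (x Fin.zero)))
                        (sym (ι-* (↥ (x Fin.zero)) (+ d))))
         ; (Fin.suc i) → trans (expand′ d₀ d (x (Fin.suc i))) (trans (cong (_* ι (+ d₀)) (eq i)) (sym (ι-* (u i) (+ d₀)))) }
    where
    expand : ∀ a b y → y * ι (+ (a ℕ.* b)) ≡ y * ι (+ a) * ι (+ b)
    expand a b y = trans (cong (y *_) (trans (cong ι (ℤₚ.pos-* a b)) (ι-* (+ a) (+ b)))) (sym (*-assoc y (ι (+ a)) (ι (+ b))))
    expand′ : ∀ a b y → y * ι (+ (a ℕ.* b)) ≡ y * ι (+ b) * ι (+ a)
    expand′ a b y = trans (cong (λ k → y * ι (+ k)) (ℕₚ.*-comm a b)) (expand b a y)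

  uniform : ∀ {n} {P : Fin n → ℕ → Set} → (∀ i {w w′} → w ℕ.≤ w′ → P i w → P i w′) →
            (∀ i → ∃[ w ] P i w) → ∃[ w ] (∀ i → P i w)
  uniform {zero}  mono each = 0 , λ ()
  uniform {suc n} mono each =
    let w₀ , p₀ = each Fin.zero
        w₁ , p₁ = uniform (λ i → mono (Fin.suc i)) (λ i → each (Fin.suc i))
    in w₀ ℕ.⊔ w₁ , λ { Fin.zero → mono Fin.zero (ℕₚ.m≤m⊔n w₀ w₁) p₀
                     ; (Fin.suc i) → mono (Fin.suc i) (ℕₚ.m≤n⊔m w₀ w₁) (p₁ i) }

  -- A single number is both the index threshold and, through `unit w`, the size of the gap, so that
  -- `uniform` can pass to the maximum over finitely many pairs.
  SeparatedFrom : ℝ → ℝ → ℕ → Set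
  SeparatedFrom x y w = ∀ k → w ℕ.≤ k → seq x k + unit w ≤ seq y k

  separated-mono : ∀ x y {w w′} → w ℕ.≤ w′ → SeparatedFrom x y w → SeparatedFrom x y w′
  separated-mono x y w≤w′ sep k w′≤k =
    ≤-trans (+-monoʳ-≤ (seq x k) (unit-antimono w≤w′)) (sep k (ℕₚ.≤-trans w≤w′ w′≤k))

  <⇒separated : ∀ x y → x ℝ.< y → ∃[ w ] SeparatedFrom x y w
  <⇒separated x y (δ , 0<δ , N , apart) =
    let M , unit≤δ = archimedean δ 0<δ
    in M ℕ.⊔ N , λ k w≤k → ≤-trans
         (+-monoʳ-≤ (seq x k) (≤-trans (unit-antimono (ℕₚ.m≤m⊔n M N)) unit≤δ))
         (apart k (ℕₚ.m⊔n≤o⇒n≤o M N w≤k))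

  increasing⇒separated : ∀ {n} (f : Fin n → ℝ) → StrictlyIncreasing f →
    ∃[ w ] (∀ i j → i Fin.< j → SeparatedFrom (f i) (f j) w)
  increasing⇒separated f inc = uniform (λ i w≤w′ p j i<j → separated-mono (f i) (f j) w≤w′ (p j i<j))
    (λ i → uniform (λ j w≤w′ p i<j → separated-mono (f i) (f j) w≤w′ (p i<j)) (λ j → each i j (i Finₚ.<? j)))
    where
    each : ∀ i j → Dec (i Fin.< j) → ∃[ w ] (i Fin.< j → SeparatedFrom (f i) (f j) w)
    each i j (yes i<j) = let w , sep = <⇒separated (f i) (f j) (inc i<j) in w , λ _ → sep
    each i j (no i≮j)  = 0 , λ i<j → ⊥-elim (i≮j i<j)

  ∣x-y∣≤e⇒x≤y+e : ∀ x y {e} → ∣ x - y ∣ ≤ e → x ≤ y + e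
  ∣x-y∣≤e⇒x≤y+e x y h = ≤-trans (≤-reflexive (lem x y)) (+-monoʳ-≤ y (≤-trans (p≤∣p∣ (x - y)) h))
    where
    open +-*-Solver
    lem : ∀ x y → x ≡ y + (x - y)
    lem = solve 2 (λ x y → x := y :+ (x :- y)) refl
    p≤∣p∣ : ∀ p → p ≤ ∣ p ∣
    p≤∣p∣ p with ≤-total 0ℚ p
    ... | inj₁ 0≤p = ≤-reflexive (sym (0≤p⇒∣p∣≡p 0≤p))
    ... | inj₂ p≤0 = ≤-trans p≤0 (nonNegative⁻¹ ∣ p ∣ {{∣-∣-nonNeg p}})

  ∣x-y∣≤e⇒y≤x+e : ∀ x y {e} → ∣ x - y ∣ ≤ e → y ≤ x + e
  ∣x-y∣≤e⇒y≤x+e x y h = ∣x-y∣≤e⇒x≤y+e y x (≤-trans (≤-reflexive (trans (cong ∣_∣ (lem x y)) (∣-p∣≡∣p∣ (x - y)))) h)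
    where
    open +-*-Solver
    lem : ∀ x y → y - x ≡ ℚ.- (x - y)
    lem = solve 2 (λ x y → y :- x := :- (x :- y)) refl

  private
    module Scaled {n : ℕ} (x : Fin n → ℚ) (d : ℕ) (u : Fin n → ℤ) (scaled : ∀ i → x i * ι (+ d) ≡ ι (u i)) where

      module _ (a b c e : Fin n) where

        X : ℚ
        X = (x a - x b) - (x c - x e)

        U : ℤ
        U = (u a ℤ.- u b) ℤ.- (u c ℤ.- u e)

        X*d : X * ι (+ d) ≡ ι U
        X*d = begin
          X * ι (+ d)
            ≡⟨ distribute (x a) (x b) (x c) (x e) (ι (+ d)) ⟩
          (x a * ι (+ d) - x b * ι (+ d)) - (x c * ι (+ d) - x e * ι (+ d))
            ≡⟨ cong₂ _-_ (cong₂ _-_ (scaled a) (scaled b)) (cong₂ _-_ (scaled c) (scaled e)) ⟩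
          (ι (u a) - ι (u b)) - (ι (u c) - ι (u e))
            ≡⟨ cong₂ _-_ (sym (ι-- (u a) (u b))) (sym (ι-- (u c) (u e))) ⟩
          ι (u a ℤ.- u b) - ι (u c ℤ.- u e)
            ≡⟨ sym (ι-- (u a ℤ.- u b) (u c ℤ.- u e)) ⟩
          ι U ∎
          where
          open ≡-Reasoning
          open +-*-Solver using (solve; _:=_; _:-_; _:*_)
          distribute : ∀ a b c e d → ((a - b) - (c - e)) * d ≡ (a * d - b * d) - (c * d - e * d)
          distribute = solve 5 (λ a b c e d → ((a :- b) :- (c :- e)) :* d := (a :* d :- b :* d) :- (c :* d :- e :* d)) refl

        private
          W : ℕ → ℚ
          W w = ι (+ suc w)

          X*Wd : ∀ w → X * (W w * ι (+ d)) ≡ ι (+ suc w ℤ.* U)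
          X*Wd w = trans (swap X (W w) (ι (+ d))) (trans (cong (W w *_) X*d) (sym (ι-* (+ suc w) U)))
            where
            open +-*-Solver
            swap : ∀ x w d → x * (w * d) ≡ w * (x * d)
            swap = solve 3 (λ x w d → x :* (w :* d) := w :* (x :* d)) refl

          unit*Wd : ∀ w → unit w * (W w * ι (+ d)) ≡ ι (+ d)
          unit*Wd w = trans (sym (*-assoc (unit w) (W w) (ι (+ d)))) (trans (cong (_* ι (+ d)) (unit-* w)) (*-identityˡ (ι (+ d))))

          Wd-nonNeg : ∀ w → ℚ.NonNegative (W w * ι (+ d))
          Wd-nonNeg w = nonNeg*nonNeg⇒nonNeg (W w) {{ι-nonNeg (suc w)}} (ι (+ d)) {{ι-nonNeg d}}

        clear-lower : ∀ w → unit w ≤ X → + d ℤ.≤ + suc w ℤ.* U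
        clear-lower w h = ι-cancel (≤-trans (≤-reflexive (sym (unit*Wd w)))
          (≤-trans (*-monoʳ-≤-nonNeg (W w * ι (+ d)) {{Wd-nonNeg w}} h) (≤-reflexive (X*Wd w))))

        clear-upper : ∀ w → X ≤ unit w + unit w → + suc w ℤ.* U ℤ.≤ + d ℤ.+ + d
        clear-upper w h = ι-cancel (≤-trans (≤-reflexive (sym (X*Wd w)))
          (≤-trans (*-monoʳ-≤-nonNeg (W w * ι (+ d)) {{Wd-nonNeg w}} h)
            (≤-reflexive (trans (*-distribʳ-+ (W w * ι (+ d)) (unit w) (unit w))
              (trans (cong₂ _+_ (unit*Wd w) (unit*Wd w)) (sym (ι-+ (+ d) (+ d))))))))

  private
    -- d ≤ vU with d > 0 forces U > 0, so v may be replaced by a larger factor.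
    scale-up : ∀ {d v} q .{{_ : ℕ.NonZero d}} → v ℕ.≤ q → ∀ U → + d ℤ.≤ + v ℤ.* U → + d ℤ.≤ + q ℤ.* U
    scale-up {d} {v} q v≤q U d≤ with ℤₚ.≤-total (+ 0) U
    ... | inj₁ 0≤U = ℤₚ.≤-trans d≤ (ℤₚ.*-monoʳ-≤-nonNeg U {{ℤ.nonNegative 0≤U}} (ℤ.+≤+ v≤q))
    ... | inj₂ U≤0 = ⊥-elim (ℤₚ.≤⇒≯ (ℤₚ.≤-trans d≤ (ℤₚ.≤-trans (ℤₚ.*-monoˡ-≤-nonNeg (+ v) U≤0) (ℤₚ.≤-reflexive (ℤₚ.*-zeroʳ (+ v)))))
      (ℤ.+<+ (ℕ.>-nonZero⁻¹ d)))

    scale-down : ∀ {d v} q → 4 ℕ.* q ℕ.≤ v → ∀ U → + v ℤ.* U ℤ.≤ + d ℤ.+ + d → + 2 ℤ.* (+ q ℤ.* U) ℤ.≤ + d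
    scale-down {d} {v} q 4q≤v U ≤2d with ℤₚ.≤-total (+ 0) U
    ... | inj₂ U≤0 = ℤₚ.≤-trans (ℤₚ.*-monoˡ-≤-nonNeg (+ 2) (ℤₚ.≤-trans (ℤₚ.*-monoˡ-≤-nonNeg (+ q) U≤0) (ℤₚ.≤-reflexive (ℤₚ.*-zeroʳ (+ q)))))
      (ℤ.+≤+ ℕ.z≤n)
    ... | inj₁ 0≤U = ℤₚ.*-cancelˡ-≤-pos (+ 2 ℤ.* (+ q ℤ.* U)) (+ d) (+ 2) (begin
      + 2 ℤ.* (+ 2 ℤ.* (+ q ℤ.* U))   ≡⟨ l₁ (+ q) U ⟩
      (+ 4 ℤ.* + q) ℤ.* U             ≡⟨ cong (ℤ._* U) (sym (ℤₚ.pos-* 4 q)) ⟩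
      + (4 ℕ.* q) ℤ.* U               ≤⟨ ℤₚ.*-monoʳ-≤-nonNeg U {{ℤ.nonNegative 0≤U}} (ℤ.+≤+ 4q≤v) ⟩
      + v ℤ.* U                       ≤⟨ ≤2d ⟩
      + d ℤ.+ + d                     ≡⟨ l₂ (+ d) ⟩
      + 2 ℤ.* + d                     ∎)
      where
      open ℤₚ.≤-Reasoning
      l₁ : ∀ q U → + 2 ℤ.* (+ 2 ℤ.* (q ℤ.* U)) ≡ (+ 4 ℤ.* q) ℤ.* U
      l₁ = ℤ-Ring.solve-∀
      l₂ : ∀ d → d ℤ.+ d ≡ + 2 ℤ.* d
      l₂ = ℤ-Ring.solve-∀

    0<x-y⇒y<x : ∀ {x y} → + 0 ℤ.< x ℤ.- y → y ℤ.< x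
    0<x-y⇒y<x {x} {y} h = subst₂ ℤ._<_ (ℤₚ.+-identityˡ y) (l x y) (ℤₚ.+-monoˡ-< y h)
      where
      l : ∀ x y → x ℤ.- y ℤ.+ y ≡ x
      l = ℤ-Ring.solve-∀

  module IntegerModel {n m : ℕ} (a : Fin (suc n) → ℝ)
    (increasing : StrictlyIncreasing a) (convex : StrictlyIncreasing (gaps a))
    (b : Fin m → ℝ) (κ : Fin (suc n) → Fin (suc n) → Fin m)
    (labelled : ∀ i j → a i ℝ.+ a j ≈ b (κ i j)) where

    record ConvexModel : Set where
      field
        p            : Fin (suc n) → ℤ
        p-increasing : ∀ {i j} → i Fin.< j → p i ℤ.< p j
        p-convex     : ∀ {i j : Fin n} → i Fin.< j →
                       p (Fin.suc i) ℤ.- p (inject₁ i) ℤ.< p (Fin.suc j) ℤ.- p (inject₁ j)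
        p-sums       : ∀ {i j i′ j′} → κ i j ≡ κ i′ j′ → p i ℤ.+ p j ≡ p i′ ℤ.+ p j′

    private
      separation : ∃[ w ] (∀ i j → i Fin.< j → SeparatedFrom (a i) (a j) w) ×
                          (∀ i j → i Fin.< j → SeparatedFrom (gaps a i) (gaps a j) w)
      separation =
        let w₁ , sep₁ = increasing⇒separated a increasing
            w₂ , sep₂ = increasing⇒separated (gaps a) convex
        in w₁ ℕ.⊔ w₂
         , (λ i j i<j → separated-mono (a i) (a j) (ℕₚ.m≤m⊔n w₁ w₂) (sep₁ i j i<j))
         , (λ i j i<j → separated-mono (gaps a i) (gaps a j) (ℕₚ.m≤n⊔m w₁ w₂) (sep₂ i j i<j))

      -- `E` is fixed before q is known. It is at least 4q for every q that `dirichlet` can return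
      -- for Q = w + 1, because that range depends only on the number of points and on Q. Sums with
      -- equal labels, which differ by at most 2/(E + 1) at the index `k`, therefore differ by at
      -- most 1/2 after multiplication by q.
      w E : ℕ
      w = proj₁ separation
      E = 4 ℕ.* (8 ℕ.^ suc n ℕ.* suc w)

      Close : Fin (suc n) → Fin (suc n) → ℕ → Set
      Close i j N = ∀ k → N ℕ.≤ k → ∣ (seq (a i) k + seq (a j) k) - seq (b (κ i j)) k ∣ ≤ unit E

      closeness : ∃[ N ] (∀ i j → Close i j N)
      closeness = uniform (λ i N≤N′ close j k N′≤k → close j k (ℕₚ.≤-trans N≤N′ N′≤k))
        (λ i → uniform (λ j N≤N′ close k N′≤k → close k (ℕₚ.≤-trans N≤N′ N′≤k))
          (λ j → labelled i j (unit E) (unit-pos E)))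

      k : ℕ
      k = w ℕ.⊔ proj₁ closeness

      x : Fin (suc n) → ℚ
      x i = seq (a i) k

      x-separated : ∀ {i j} → i Fin.< j → unit w ≤ (x j - x i) - (x i - x i)
      x-separated {i} {j} i<j = ≤-trans (≤-reflexive (l₁ (x i) (unit w))) (≤-trans
        (+-monoˡ-≤ (ℚ.- x i) (proj₁ (proj₂ separation) i j i<j k (ℕₚ.m≤m⊔n w (proj₁ closeness)))) (≤-reflexive (l₂ (x i) (x j))))
        where
        open +-*-Solver
        l₁ : ∀ x t → t ≡ x + t - x
        l₁ = solve 2 (λ x t → t := x :+ t :- x) refl
        l₂ : ∀ x y → y - x ≡ (y - x) - (x - x)
        l₂ = solve 2 (λ x y → y :- x := (y :- x) :- (x :- x)) refl

      x-gaps-separated : ∀ {i j : Fin n} → i Fin.< j →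
        unit w ≤ (x (Fin.suc j) - x (inject₁ j)) - (x (Fin.suc i) - x (inject₁ i))
      x-gaps-separated {i} {j} i<j = ≤-trans (≤-reflexive (l₁ (x (Fin.suc i) - x (inject₁ i)) (unit w)))
        (+-monoˡ-≤ (ℚ.- (x (Fin.suc i) - x (inject₁ i))) (proj₂ (proj₂ separation) i j i<j k (ℕₚ.m≤m⊔n w (proj₁ closeness))))
        where
        open +-*-Solver
        l₁ : ∀ x t → t ≡ x + t - x
        l₁ = solve 2 (λ x t → t := x :+ t :- x) refl

      x-sums : ∀ {i j i′ j′} → κ i j ≡ κ i′ j′ → (x i - x i′) - (x j′ - x j) ≤ unit E + unit E
      x-sums {i} {j} {i′} {j′} eq = begin
        (x i - x i′) - (x j′ - x j)                       ≡⟨ l₁ (x i) (x j) (x i′) (x j′) ⟩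
        (x i + x j) - (x i′ + x j′)                       ≤⟨ +-monoˡ-≤ (ℚ.- (x i′ + x j′)) (∣x-y∣≤e⇒x≤y+e (x i + x j) y (close i j)) ⟩
        y + unit E - (x i′ + x j′)                        ≤⟨ +-monoˡ-≤ (ℚ.- (x i′ + x j′)) (+-monoˡ-≤ (unit E) y≤) ⟩
        x i′ + x j′ + unit E + unit E - (x i′ + x j′)     ≡⟨ l₂ (x i′ + x j′) (unit E) ⟩
        unit E + unit E                                   ∎
        where
        open ≤-Reasoning
        close : ∀ i j → ∣ (x i + x j) - seq (b (κ i j)) k ∣ ≤ unit E
        close i j = proj₂ closeness i j k (ℕₚ.m≤n⊔m w (proj₁ closeness))
        y = seq (b (κ i j)) k
        y≤ : y ≤ x i′ + x j′ + unit E
        y≤ = ∣x-y∣≤e⇒y≤x+e (x i′ + x j′) y (subst (λ κ → ∣ (x i′ + x j′) - seq (b κ) k ∣ ≤ unit E) (sym eq) (close i′ j′))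
        open +-*-Solver using (solve; _:=_; _:+_; _:-_)
        l₁ : ∀ a b c d → (a - c) - (d - b) ≡ (a + b) - (c + d)
        l₁ = solve 4 (λ a b c d → (a :- c) :- (d :- b) := (a :+ b) :- (c :+ d)) refl
        l₂ : ∀ s e → s + e + e - s ≡ e + e
        l₂ = solve 2 (λ s e → s :+ e :+ e :- s := e :+ e) refl

      rational : ∃[ d ] ℕ.NonZero d × Σ (Fin (suc n) → ℤ) λ u → ∀ i → x i * ι (+ d) ≡ ι (u i)
      rational = common-denominator (suc n) x

      d : ℕ
      d = proj₁ rational

      instance
        d≢0 : ℕ.NonZero d
        d≢0 = proj₁ (proj₂ rational)

      u : Fin (suc n) → ℤ
      u = proj₁ (proj₂ (proj₂ rational))

      approximation : ∃[ q ] suc w ℕ.≤ q × q ℕ.≤ 8 ℕ.^ suc n ℕ.* suc w ×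
        Σ (Fin (suc n) → ℤ) λ p → ∀ i → Near d (+ q ℤ.* u i) (+ d ℤ.* p i)
      approximation = dirichlet (suc n) u d (suc w)

      q : ℕ
      q = proj₁ approximation

      p : Fin (suc n) → ℤ
      p = proj₁ (proj₂ (proj₂ (proj₂ approximation)))

      q> : suc w ℕ.≤ q
      q> = proj₁ (proj₂ approximation)

      4q≤ : 4 ℕ.* q ℕ.≤ suc E
      4q≤ = ℕₚ.m≤n⇒m≤1+n (ℕₚ.*-monoʳ-≤ 4 (proj₁ (proj₂ (proj₂ approximation))))

      open Rounding u p d q (proj₂ (proj₂ (proj₂ (proj₂ approximation))))
      open Scaled x d u (proj₂ (proj₂ (proj₂ rational))) using (clear-lower; clear-upper)

      increasing′ : ∀ {i j} → i Fin.< j → p i ℤ.< p j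
      increasing′ {i} {j} i<j = 0<x-y⇒y<x (subst (+ 0 ℤ.<_) (l (p i) (p j))
        (combine-pos j i i i (scale-up q q> (combine₄ u j i i i) (clear-lower j i i i w (x-separated i<j)))))
        where
        l : ∀ x y → (y ℤ.- x) ℤ.- (x ℤ.- x) ≡ y ℤ.- x
        l = ℤ-Ring.solve-∀

      sums′ : ∀ {i j i′ j′} → κ i j ≡ κ i′ j′ → p i ℤ.+ p j ℤ.≤ p i′ ℤ.+ p j′
      sums′ {i} {j} {i′} {j′} eq = ℤₚ.i-j≤0⇒i≤j (subst (ℤ._≤ + 0) (l (p i) (p j) (p i′) (p j′))
        (combine-≤0 i i′ j′ j (scale-down q 4q≤ (combine₄ u i i′ j′ j) (clear-upper i i′ j′ j E (x-sums eq)))))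
        where
        l : ∀ a b c d → (a ℤ.- c) ℤ.- (d ℤ.- b) ≡ (a ℤ.+ b) ℤ.- (c ℤ.+ d)
        l = ℤ-Ring.solve-∀

    -- Simultaneous Diophantine approximation of a sufficiently good rational approximation of a:
    -- the factor q > w makes the strict inequalities survive the rounding, and equal sums are
    -- rounded to integers less than 1 apart.
    model : ConvexModel
    model = record
      { p            = p
      ; p-increasing = increasing′
      ; p-convex     = λ {i} {j} i<j → 0<x-y⇒y<x (combine-pos (Fin.suc j) (inject₁ j) (Fin.suc i) (inject₁ i)
          (scale-up q q> (combine₄ u (Fin.suc j) (inject₁ j) (Fin.suc i) (inject₁ i)) (clear-lower (Fin.suc j) (inject₁ j) (Fin.suc i) (inject₁ i) w (x-gaps-separated i<j))))
      ; p-sums       = λ eq → ℤₚ.≤-antisym (sums′ eq) (sums′ (sym eq))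
      }

-- Passage from real sets and real exponents to the integer bound

open Monomials
open Exponents
open Approximation
open Sequences
open import Data.Empty using (⊥-elim)
open import Data.Fin.Base as Fin using (Fin; toℕ)
import Data.Fin.Properties as Finₚ
open import Data.Nat.Base as ℕ using (suc; zero)
import Data.Nat.Properties as ℕₚ
open import Data.Integer.Base as ℤ using (-[1+_])
import Data.Integer.Properties as ℤₚ
import Data.Integer.Tactic.RingSolver as ℤ-Ring
open import Data.Rational.Base as ℚ using (ℚ; 0ℚ; 1ℚ; ∣_∣; ↥_; ↧ₙ_)
import Data.Rational.Properties as ℚₚ
open import Data.Rational.Solver using (module +-*-Solver)
open import Data.Product.Base using (_,_; proj₁; proj₂)
open import Function.Bundles using (Equivalence)
open import Relation.Binary.Definitions using (tri<; tri≈; tri>)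
open import Relation.Binary.PropositionalEquality
open import Relation.Nullary using (¬_; yes; no)
open import Relation.Unary using (Decidable; _∈_)

open import Defs
open import Data.Integer.Base using (+_)
open import Data.Nat.Base using (ℕ)
open import Data.Product.Base using (∃-syntax; _×_)
open import Data.Rational.Base using (_/_)
open import Level using (0ℓ)
open import Relation.Unary using (Pred)

≈-refl : ∀ {x} → x ≈ x
≈-refl {x} ε 0<ε = 0 , λ n _ → ℚₚ.≤-trans (ℚₚ.≤-reflexive (cong ∣_∣ (ℚₚ.+-inverseʳ (seq x n)))) (ℚₚ.<⇒≤ 0<ε)

≈-sym : ∀ {x y} → x ≈ y → y ≈ x
≈-sym {x} {y} x≈y ε 0<ε =
  let N , close = x≈y ε 0<ε
  in N , λ n N≤n → ℚₚ.≤-trans (ℚₚ.≤-reflexive (trans (cong ∣_∣ (lem (seq x n) (seq y n))) (ℚₚ.∣-p∣≡∣p∣ (seq x n ℚ.- seq y n)))) (close n N≤n)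
  where
  open +-*-Solver
  lem : ∀ x y → y ℚ.- x ≡ ℚ.- (x ℚ.- y)
  lem = solve 2 (λ x y → y :- x := :- (x :- y)) refl

≈-trans : ∀ {x y z} → x ≈ y → y ≈ z → x ≈ z
≈-trans {x} {y} {z} x≈y y≈z ε 0<ε =
  let M , unit≤ = archimedean ε 0<ε
      h = unit (suc (M ℕ.+ M))
      N₁ , close₁ = x≈y h (unit-pos (suc (M ℕ.+ M)))
      N₂ , close₂ = y≈z h (unit-pos (suc (M ℕ.+ M)))
  in N₁ ℕ.⊔ N₂ , λ n N≤n → let open ℚₚ.≤-Reasoning in begin
    ∣ seq x n ℚ.- seq z n ∣                                    ≡⟨ cong ∣_∣ (lem (seq x n) (seq y n) (seq z n)) ⟩
    ∣ (seq x n ℚ.- seq y n) ℚ.+ (seq y n ℚ.- seq z n) ∣        ≤⟨ ℚₚ.∣p+q∣≤∣p∣+∣q∣ (seq x n ℚ.- seq y n) (seq y n ℚ.- seq z n) ⟩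
    ∣ seq x n ℚ.- seq y n ∣ ℚ.+ ∣ seq y n ℚ.- seq z n ∣        ≤⟨ ℚₚ.+-mono-≤ (close₁ n (ℕₚ.m⊔n≤o⇒m≤o N₁ N₂ N≤n)) (close₂ n (ℕₚ.m⊔n≤o⇒n≤o N₁ N₂ N≤n)) ⟩
    h ℚ.+ h                                                    ≡⟨ half-unit M ⟩
    unit M                                                     ≤⟨ unit≤ ⟩
    ε                                                          ∎
  where
  open +-*-Solver
  lem : ∀ x y z → x ℚ.- z ≡ (x ℚ.- y) ℚ.+ (y ℚ.- z)
  lem = solve 3 (λ x y z → x :- z := (x :- y) :+ (y :- z)) refl

<⇒≉ : ∀ {x y} → x < y → ¬ x ≈ y
<⇒≉ {x} {y} (δ , 0<δ , N , apart) x≈y =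
  let ε , 0<ε , ε<δ = ℚₚ.<-dense 0<δ
      N′ , close = x≈y ε 0<ε
      k = N ℕ.⊔ N′
  in ℚₚ.<-irrefl refl (ℚₚ.<-≤-trans (ℚₚ.+-monoʳ-< (seq x k) ε<δ)
       (ℚₚ.≤-trans (apart k (ℕₚ.m≤m⊔n N N′)) (∣x-y∣≤e⇒y≤x+e (seq x k) (seq y k) (close k (ℕₚ.m≤n⊔m N N′)))))

increasing-injective : ∀ {n} {a : Fin n → ℝ} → StrictlyIncreasing a → ∀ {i j} → a i ≈ a j → i ≡ j
increasing-injective {a = a} inc {i} {j} ai≈aj with ℕₚ.<-cmp (toℕ i) (toℕ j)
... | tri< i<j _ _ = ⊥-elim (<⇒≉ {a i} {a j} (inc i<j) ai≈aj)
... | tri≈ _ i≡j _ = Finₚ.toℕ-injective i≡j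
... | tri> _ _ j<i = ⊥-elim (<⇒≉ {a j} {a i} (inc j<i) (≈-sym {a i} {a j} ai≈aj))

enumeration-≤ : ∀ {A : Pred ℝ 0ℓ} {n m} (a : Fin n → ℝ) (b : Fin m → ℝ) →
  A IsEnumeratedBy a → A IsEnumeratedBy b → (∀ {i j} → a i ≈ a j → i ≡ j) → n ℕ.≤ m
enumeration-≤ {A} {n} {m} a b a-enum b-enum a-inj = Finₚ.injective⇒≤ {f = λ i → proj₁ (partner i)} λ {i} {j} eq →
  a-inj (≈-trans {a i} {b (proj₁ (partner i))} {a j} (proj₂ (partner i))
    (subst (λ k → b k ≈ a j) (sym eq) (≈-sym {a j} {b (proj₁ (partner j))} (proj₂ (partner j)))))
  where
  partner : ∀ i → ∃[ k ] a i ≈ b k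
  partner i = Equivalence.to (b-enum (a i)) (Equivalence.from (a-enum (a i)) (i , ≈-refl {a i}))

convex-set-bound : ∀ (A : Pred ℝ 0ℓ) {n m} .{{_ : ℕ.NonZero n}} (a : Fin n → ℝ) → A IsEnumeratedBy a →
  StrictlyIncreasing a → StrictlyIncreasing (gaps a) → HasCardinality (A ⊕ A) m →
  ∀ l → n ℕ.< 2 ℕ.^ suc l → PowerBound 138 1191 117 87 n (suc l) m
convex-set-bound A {suc n} {m} a a-enum increasing convex (b , b-enum , _) =
  ConvexSequence.convex-sequence-bound p p-increasing p-convex (λ i j → proj₁ (label i j)) p-sums
  where
  a∈A : ∀ i → a i ∈ A
  a∈A i = Equivalence.from (a-enum (a i)) (i , ≈-refl {a i})
  label : ∀ i j → ∃[ k ] a i + a j ≈ b k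
  label i j = Equivalence.to (b-enum (a i + a j)) (a i , a j , a∈A i , a∈A j , ≈-refl {a i + a j})
  open IntegerModel a increasing convex b (λ i j → proj₁ (label i j)) (λ i j → proj₂ (label i j))
  open ConvexModel model

⌊⌋-below : ∀ K n r → Below n r K ⌊ K · n ^ r ⌋
⌊⌋-below K n r@record{} = greatest-holds (below? n r K) ℕ.z≤n (n ℕ.^ posPart (↥ r) ℕ.* K)
  where
  greatest-holds : {P : Pred ℕ 0ℓ} (P? : Decidable P) → P 0 → ∀ b → P (greatest P? b)
  greatest-holds P? P0 zero = P0
  greatest-holds P? P0 (suc b) with P? (suc b)
  ... | yes p = p
  ... | no  _ = greatest-holds P? P0 b

-- r + 1/(M + 1) ≤ a/e is multiplied by e(M + 1) and by the denominator of r, and the negative part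
-- of the numerator is moved to the other side. This is the form in ℕ that `power-bound` takes.
exponent-gap : ∀ r v M a e → v ℚ.* ι (+ e) ≡ ι (+ a) → r ℚ.+ unit M ℚ.≤ v →
  posPart (↥ r) ℕ.* (e ℕ.* suc M) ℕ.+ e ℕ.* ↧ₙ r ℕ.≤ a ℕ.* suc M ℕ.* ↧ₙ r ℕ.+ negPart (↥ r) ℕ.* (e ℕ.* suc M)
exponent-gap r v M a e v≡a/e gap = ℤₚ.drop‿+≤+ (begin
  + (P ℕ.* (e ℕ.* suc M) ℕ.+ e ℕ.* q)
    ≡⟨ cong₂ ℤ._+_ (pos-*₃ P e (suc M)) (ℤₚ.pos-* e q) ⟩
  + P ℤ.* (+ e ℤ.* + suc M) ℤ.+ + e ℤ.* + q
    ≡⟨ l₁ (+ P) (+ S) (+ e) (+ suc M) (+ q) ⟩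
  ((+ P ℤ.- + S) ℤ.* (+ e ℤ.* + suc M) ℤ.+ + e ℤ.* + q) ℤ.+ + S ℤ.* (+ e ℤ.* + suc M)
    ≡⟨ cong (λ z → (z ℤ.* (+ e ℤ.* + suc M) ℤ.+ + e ℤ.* + q) ℤ.+ + S ℤ.* (+ e ℤ.* + suc M)) (sym (parts (↥ r))) ⟩
  (↥ r ℤ.* (+ e ℤ.* + suc M) ℤ.+ + e ℤ.* + q) ℤ.+ + S ℤ.* (+ e ℤ.* + suc M)
    ≤⟨ ℤₚ.+-monoˡ-≤ (+ S ℤ.* (+ e ℤ.* + suc M)) cleared ⟩
  + a ℤ.* + suc M ℤ.* + q ℤ.+ + S ℤ.* (+ e ℤ.* + suc M)
    ≡⟨ cong₂ ℤ._+_ (trans (cong (ℤ._* + q) (sym (ℤₚ.pos-* a (suc M)))) (sym (ℤₚ.pos-* (a ℕ.* suc M) q))) (sym (pos-*₃ S e (suc M))) ⟩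
  + (a ℕ.* suc M ℕ.* q ℕ.+ S ℕ.* (e ℕ.* suc M)) ∎)
  where
  open ℤₚ.≤-Reasoning
  P S q : ℕ
  P = posPart (↥ r)
  S = negPart (↥ r)
  q = ↧ₙ r
  pos-*₃ : ∀ x y z → + (x ℕ.* (y ℕ.* z)) ≡ + x ℤ.* (+ y ℤ.* + z)
  pos-*₃ x y z = trans (ℤₚ.pos-* x (y ℕ.* z)) (cong (+ x ℤ.*_) (ℤₚ.pos-* y z))
  l₁ : ∀ p s e m q → p ℤ.* (e ℤ.* m) ℤ.+ e ℤ.* q ≡ ((p ℤ.- s) ℤ.* (e ℤ.* m) ℤ.+ e ℤ.* q) ℤ.+ s ℤ.* (e ℤ.* m)
  l₁ = ℤ-Ring.solve-∀
  parts : ∀ i → i ≡ + posPart i ℤ.- + negPart i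
  parts (+ n)    = sym (ℤₚ.+-identityʳ (+ n))
  parts -[1+ n ] = refl
  weight : ℚ
  weight = ι (+ e) ℚ.* (ι (+ suc M) ℚ.* ι (+ q))
  weight-nonNeg : ℚ.NonNegative weight
  weight-nonNeg = ℚₚ.nonNeg*nonNeg⇒nonNeg (ι (+ e)) {{ι-nonNeg e}} (ι (+ suc M) ℚ.* ι (+ q))
    {{ℚₚ.nonNeg*nonNeg⇒nonNeg (ι (+ suc M)) {{ι-nonNeg (suc M)}} (ι (+ q)) {{ι-nonNeg q}}}}
  left : (r ℚ.+ unit M) ℚ.* weight ≡ ι (↥ r ℤ.* (+ e ℤ.* + suc M) ℤ.+ + e ℤ.* + q)
  left = trans (expand r (unit M) (ι (+ e)) (ι (+ suc M)) (ι (+ q)))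
    (trans (cong₂ ℚ._+_
        (trans (cong (ℚ._* (ι (+ e) ℚ.* ι (+ suc M))) (clear-denominator r))
          (trans (cong (ι (↥ r) ℚ.*_) (sym (ι-* (+ e) (+ suc M)))) (sym (ι-* (↥ r) (+ e ℤ.* + suc M)))))
        (trans (cong (ℚ._* (ι (+ e) ℚ.* ι (+ q))) (unit-* M)) (trans (ℚₚ.*-identityˡ _) (sym (ι-* (+ e) (+ q))))))
      (sym (ι-+ (↥ r ℤ.* (+ e ℤ.* + suc M)) (+ e ℤ.* + q))))
    where
    open +-*-Solver
    expand : ∀ r t e m q → (r ℚ.+ t) ℚ.* (e ℚ.* (m ℚ.* q)) ≡ (r ℚ.* q) ℚ.* (e ℚ.* m) ℚ.+ (t ℚ.* m) ℚ.* (e ℚ.* q)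
    expand = solve 5 (λ r t e m q → (r :+ t) :* (e :* (m :* q)) := (r :* q) :* (e :* m) :+ (t :* m) :* (e :* q)) refl
  right : v ℚ.* weight ≡ ι (+ a ℤ.* + suc M ℤ.* + q)
  right = trans (regroup v (ι (+ e)) (ι (+ suc M)) (ι (+ q))) (trans (cong (λ z → z ℚ.* ι (+ suc M) ℚ.* ι (+ q)) v≡a/e)
    (trans (cong (ℚ._* ι (+ q)) (sym (ι-* (+ a) (+ suc M)))) (sym (ι-* (+ a ℤ.* + suc M) (+ q)))))
    where
    open +-*-Solver
    regroup : ∀ v e m q → v ℚ.* (e ℚ.* (m ℚ.* q)) ≡ v ℚ.* e ℚ.* m ℚ.* q
    regroup = solve 4 (λ v e m q → v :* (e :* (m :* q)) := v :* e :* m :* q) refl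
  cleared : ↥ r ℤ.* (+ e ℤ.* + suc M) ℤ.+ + e ℤ.* + q ℤ.≤ + a ℤ.* + suc M ℤ.* + q
  cleared = ι-cancel (ℚₚ.≤-trans (ℚₚ.≤-reflexive (sym left))
    (ℚₚ.≤-trans (ℚₚ.*-monoʳ-≤-nonNeg weight {{weight-nonNeg}} gap) (ℚₚ.≤-reflexive right)))

-- The final constant is 1/(C + 1), which is positive whatever C is.
unit-ratio-≤ : ∀ C m j k → j ℕ.≤ C ℕ.* (m ℕ.* suc k) → unit C ℚ.* (+ j / suc k) ℚ.≤ + m / 1
unit-ratio-≤ C m j k j≤ = begin
  unit C ℚ.* (+ j / suc k)                       ≡⟨ cong (unit C ℚ.*_) (numerator-unit j k) ⟩
  unit C ℚ.* (ι (+ j) ℚ.* unit k)                ≤⟨ ℚₚ.*-monoˡ-≤-nonNeg (unit C) {{ℚₚ.normalize-nonNeg 1 (suc C)}}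
                                                      (ℚₚ.*-monoʳ-≤-nonNeg (unit k) {{ℚₚ.normalize-nonNeg 1 (suc k)}} (ι-mono (ℤ.+≤+ j≤′))) ⟩
  unit C ℚ.* (ι (+ (suc C ℕ.* (m ℕ.* suc k))) ℚ.* unit k)
    ≡⟨ cong (λ z → unit C ℚ.* (z ℚ.* unit k)) (trans (ι-ℕ* (suc C) (m ℕ.* suc k)) (cong (ι (+ suc C) ℚ.*_) (ι-ℕ* m (suc k)))) ⟩
  unit C ℚ.* (ι (+ suc C) ℚ.* (ι (+ m) ℚ.* ι (+ suc k)) ℚ.* unit k)
    ≡⟨ regroup (unit C) (ι (+ suc C)) (ι (+ m)) (unit k) (ι (+ suc k)) ⟩
  (unit C ℚ.* ι (+ suc C)) ℚ.* (ι (+ m) ℚ.* (unit k ℚ.* ι (+ suc k)))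
    ≡⟨ cong₂ (λ x y → x ℚ.* (ι (+ m) ℚ.* y)) (unit-* C) (unit-* k) ⟩
  1ℚ ℚ.* (ι (+ m) ℚ.* 1ℚ)                        ≡⟨ trans (ℚₚ.*-identityˡ _) (ℚₚ.*-identityʳ (ι (+ m))) ⟩
  ι (+ m)                                        ∎
  where
  open ℚₚ.≤-Reasoning
  j≤′ : j ℕ.≤ suc C ℕ.* (m ℕ.* suc k)
  j≤′ = ℕₚ.≤-trans j≤ (ℕₚ.*-monoˡ-≤ (m ℕ.* suc k) (ℕₚ.n≤1+n C))
  ι-ℕ* : ∀ x y → ι (+ (x ℕ.* y)) ≡ ι (+ x) ℚ.* ι (+ y)
  ι-ℕ* x y = trans (cong ι (ℤₚ.pos-* x y)) (ι-* (+ x) (+ y))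
  open +-*-Solver using (solve; _:=_; _:*_)
  regroup : ∀ u c m t k → u ℚ.* (c ℚ.* (m ℚ.* k) ℚ.* t) ≡ (u ℚ.* c) ℚ.* (m ℚ.* (t ℚ.* k))
  regroup = solve 5 (λ u c m t k → u :* (c :* (m :* k) :* t) := (u :* c) :* (m :* (t :* k))) refl

theorem1p4 : (ε : ℝ) → 0ℝ < ε →
    ∃[ c ] (0ℝ < c × ((A : Pred ℝ 0ℓ) → Convex A →
    (∣A∣ ∣A+A∣ : ℕ) → HasCardinality A ∣A∣ → HasCardinality (A ⊕ A) ∣A+A∣ →
    c * (∣A∣ ^ (fromℚ (+ 46 / 29) - ε)) ≤ fromℕ ∣A+A∣))
theorem1p4 ε (δ , 0<δ , N₀ , ε≥δ) =
  fromℚ (unit C) , (unit C , unit-pos C , 0 , λ _ _ → ℚₚ.≤-reflexive (ℚₚ.+-identityˡ (unit C))) , bound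
  where
  -- `δ` is a rational number below ε from the index `N₀` on. Since 1/(M + 1) ≤ δ, the exponent
  -- 46/29 - ε leaves enough slack for the logarithms.
  M : ℕ
  M = proj₁ (archimedean δ 0<δ)

  constant : ∃[ C ] (∀ n .{{_ : ℕ.NonZero n}} L m j K p s q .{{_ : ℕ.NonZero q}} →
      2 ℕ.^ L ℕ.≤ 2 ℕ.* n → PowerBound 138 1191 117 87 n L m →
      j ℕ.^ q ℕ.* n ℕ.^ s ℕ.≤ n ℕ.^ p ℕ.* K ℕ.^ q →
      p ℕ.* (87 ℕ.* suc M) ℕ.+ 87 ℕ.* q ℕ.≤ 138 ℕ.* suc M ℕ.* q ℕ.+ s ℕ.* (87 ℕ.* suc M) →
      j ℕ.≤ C ℕ.* (m ℕ.* K))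
  constant = power-bound-constant 138 1191 117 87 (suc M)

  C : ℕ
  C = proj₁ constant

  x : ℝ
  x = fromℚ (+ 46 / 29) - ε

  -- On the reals x ≤ y is the negation of y < x, so the inequality is proved by refuting a rational
  -- excess `δ′` at a single index.
  no-excess : ∀ {m δ′ y} → 0ℚ ℚ.< δ′ → y ℚ.≤ + m / 1 → ¬ (+ m / 1 ℚ.+ δ′ ℚ.≤ y)
  no-excess {m} {δ′} 0<δ′ y≤m m+δ≤y = ℚₚ.<-irrefl refl (ℚₚ.<-≤-trans
    (ℚₚ.≤-<-trans (ℚₚ.≤-reflexive (sym (ℚₚ.+-identityʳ (+ m / 1)))) (ℚₚ.+-monoʳ-< (+ m / 1) 0<δ′))
    (ℚₚ.≤-trans m+δ≤y y≤m))

  x-gap : ∀ k → N₀ ℕ.≤ k → seq x k ℚ.+ unit M ℚ.≤ + 46 / 29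
  x-gap k N₀≤k = ℚₚ.≤-trans (ℚₚ.+-monoʳ-≤ (seq x k)
      (ℚₚ.≤-trans (proj₂ (archimedean δ 0<δ)) (ℚₚ.≤-trans (ℚₚ.≤-reflexive (sym (ℚₚ.+-identityˡ δ))) (ε≥δ k N₀≤k))))
    (ℚₚ.≤-reflexive (lem (+ 46 / 29) (seq ε k)))
    where
    open +-*-Solver
    lem : ∀ v e → v ℚ.- e ℚ.+ e ≡ v
    lem = solve 2 (λ v e → v :- e :+ e := v) refl

  bound : (A : Pred ℝ 0ℓ) → Convex A → (∣A∣ ∣A+A∣ : ℕ) → HasCardinality A ∣A∣ → HasCardinality (A ⊕ A) ∣A+A∣ →
    fromℚ (unit C) * (∣A∣ ^ x) ≤ fromℕ ∣A+A∣
  -- For the empty set the power is 0 by the convention on 0^x.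
  bound A _ zero m _ _ (δ′ , 0<δ′ , N′ , excess) = no-excess {m} 0<δ′
    (ℚₚ.≤-trans (ℚₚ.≤-reflexive (ℚₚ.*-zeroʳ (unit C))) (ℚₚ.nonNegative⁻¹ (+ m / 1) {{ℚₚ.normalize-nonNeg m 1}}))
    (excess N′ ℕₚ.≤-refl)
  bound A (N , a , a-enum , increasing , convex) n@(suc _) m (a′ , a′-enum , a′-inj) sums (δ′ , 0<δ′ , N′ , excess) =
    no-excess {m} 0<δ′ (unit-ratio-≤ C m j k (proj₂ constant n (suc l) m j (suc k)
        (posPart (↥ r)) (negPart (↥ r)) (↧ₙ r) (proj₂ (proj₂ binary)) power
        (⌊⌋-below (suc k) n r) (exponent-gap r (+ 46 / 29) M 138 87 refl (x-gap k (ℕₚ.m≤m⊔n N₀ N′)))))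
      (excess k (ℕₚ.m≤n⊔m N₀ N′))
    where
    -- An index late enough both for the supposed excess and for the lower bound `δ` on ε.
    k : ℕ
    k = N₀ ℕ.⊔ N′
    r : ℚ
    r = seq x k
    j : ℕ
    j = ⌊ suc k · n ^ r ⌋
    binary : ∃[ l ] n ℕ.< 2 ℕ.^ suc l × 2 ℕ.^ suc l ℕ.≤ 2 ℕ.* n
    binary = binary-length n
    l : ℕ
    l = proj₁ binary
    -- The enumeration witnessing convexity and the one witnessing the cardinality are unrelated, so
    -- their lengths are compared through injections both ways.
    N≡n : N ≡ n
    N≡n = ℕₚ.≤-antisym
      (enumeration-≤ a a′ a-enum a′-enum (increasing-injective {a = a} increasing))
      (enumeration-≤ a′ a a′-enum a-enum a′-inj)
    power : PowerBound 138 1191 117 87 n (suc l) m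
    power = subst (λ n → PowerBound 138 1191 117 87 n (suc l) m) N≡n
      (convex-set-bound A {{subst ℕ.NonZero (sym N≡n) _}} a a-enum increasing convex sums l
        (subst (ℕ._< 2 ℕ.^ suc l) (sym N≡n) (proj₁ (proj₂ binary))))
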